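{- Let $\alpha_0\in(0,1)$ and $c_0\ge 2+\sqrt3$ be constants, and let $d\ge 1$ be an integer constant (all independent of $n$). For even $n$ put $p_1=c_0/n$, $p_2=(1+\alpha_0)p_1$ and $q_2=2p_1-p_2-2(p_1-p_2)/n$. Let $E[n_d^{(1)}]$ be the expected number of nodes at distance exactly $d$ from a fixed node $s$ in a random graph drawn from $G(n,p_1)$, and let $E[n_d^{(2)}]$ be the expected number of nodes at distance exactly $d$ from a fixed node $s$ in a random graph drawn from $G(n/2,n/2,p_2,q_2)$. Then $$E[n_d^{(1)}]\in E[n_d^{(2)}]\left(1\pm\frac{2}{c_0-1}\right)$$ up to relative error $O(1/n)$; that is, there exist a constant $C>0$ (which may depend on $c_0,\alpha_0,d$ but not on $n$) and an $N$ such that for all even $n\ge N$, $$\left(1-\frac{2}{c_0-1}\right)\left(1-\frac{C}{n}\right)E[n_d^{(2)}]\;<\;E[n_d^{(1)}]\;<\;\left(1+\frac{2}{c_0-1}\right)\left(1+\frac{C}{n}\right)E[n_d^{(2)}].$$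
   Context: Erdős–Rényi model $G(n,p_1)$ ("one-cluster graph"): a random graph on $n$ nodes in which each pair of distinct nodes is joined by an edge independently with probability $p_1$. Planted partition model $G(n/2,n/2,p_2,q_2)$ ("two-cluster graph"): a random graph on a node set $V^+\cup V^-$ (disjoint union) with $|V^+|=|V^-|=n/2$, in which each pair of distinct nodes $u,v$ is joined by an edge independently, with probability $p_2$ if $u,v$ are both in $V^+$ or both in $V^-$, and with probability $q_2$ if one is in $V^+$ and the other in $V^-$. With the given choice of $q_2$ the expected number of edges is the same in both models. The parameters are considered for $n$ large enough that $0<q_2<p_2<1$ and $0<p_1<1$. The distance between two nodes is the length (number of edges) of a shortest path between them. For $z\in\{1,2\}$, $n_d^{(z)}$ is the random number of nodes at distance exactly $d$ from a fixed source node $s$ in the $z$-cluster random graph; by symmetry its expectation does not depend on the choice of $s$. Approximation convention: for functions $a,b$ of $n$, $a$ and $b$ are called relatively $O(1/n)$-close if there is a constant $c>0$ such that $b(1-c/n)<a<b(1+c/n)$ for all sufficiently large $n$. Relations "within the approximation" are understood up to replacing quantities by relatively $O(1/n)$-close ones. -}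

module Defs where

open import Data.Bool.Base using (Bool; true; false; T; if_then_else_)
open import Data.Bool.Properties as Bool using (T?)
open import Data.Empty using (⊥-elim)
open import Data.Fin.Base using (Fin; zero; suc; toℕ)
open import Data.Fin.Properties as Fin using ()
open import Data.Integer.Base as ℤ using (+_; +[1+_]; -[1+_])
open import Data.Integer.Properties as ℤ using ()
open import Data.List.Base as List using (List; []; _∷_)
open import Data.Nat.Base as ℕ using (ℕ; zero; suc; ⌊_/2⌋)
open import Data.Nat.Properties as ℕ using ()
open import Data.Product.Base using (∃; _×_; _,_; proj₁; proj₂)
open import Data.Rational.Base as ℚ using (ℚ; 0ℚ; 1ℚ; ½; ∣_∣; mkℚ)
open import Data.Rational.Properties as ℚ using ()
open import Data.Rational.Solver using (module +-*-Solver)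
open import Data.Rational.Unnormalised.Base as ℚᵘ using (mkℚᵘ)
open import Data.Rational.Unnormalised.Properties as ℚᵘ using ()
open import Data.Sum.Base using (inj₁; inj₂)
open import Data.Vec.Base as Vec using (Vec; []; _∷_)
open import Data.Vec.Functional as Table using (Vector)
open import Data.Vec.Relation.Unary.AllPairs using (allPairs?)
open import Data.Vec.Relation.Unary.Linked using (Linked; linked?)
open import Data.Vec.Relation.Unary.Unique.Propositional using (Unique)
open import Relation.Binary.PropositionalEquality.Core
  using (_≡_; refl; sym; trans; cong; cong₂; subst; subst₂)
open import Relation.Nullary.Decidable using (Dec; yes; no; does; map′; ¬?; _×-dec_)
open import Relation.Nullary.Negation.Core using (¬_)

open +-*-Solver using (solve; _:+_; _:*_; _:-_; :-_; _:=_; con)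

¼ : ℚ
¼ = + 1 ℚ./ 4

∣∣-≤ : ∀ {a b} → a ℚ.≤ b → ℚ.- a ℚ.≤ b → ∣ a ∣ ℚ.≤ b
∣∣-≤ {a} a≤b -a≤b with ℚ.∣p∣≡p∨∣p∣≡-p a
... | inj₁ eq = subst (ℚ._≤ _) (sym eq) a≤b
... | inj₂ eq = subst (ℚ._≤ _) (sym eq) -a≤b

*-mono-≤-nonNeg : ∀ {a b c d} → 0ℚ ℚ.≤ b → 0ℚ ℚ.≤ c →
                  a ℚ.≤ b → c ℚ.≤ d → a ℚ.* c ℚ.≤ b ℚ.* d
*-mono-≤-nonNeg {a} {b} {c} {d} 0≤b 0≤c a≤b c≤d = ℚ.≤-trans
  (ℚ.*-monoʳ-≤-nonNeg c {{ℚ.nonNegative 0≤c}} a≤b)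
  (ℚ.*-monoˡ-≤-nonNeg b {{ℚ.nonNegative 0≤b}} c≤d)

∣∣-triangle-< : ∀ {a b δ ε} → ∣ a ∣ ℚ.< δ → ∣ b ∣ ℚ.< ε → ∣ a ℚ.+ b ∣ ℚ.< δ ℚ.+ ε
∣∣-triangle-< {a} {b} p q = ℚ.≤-<-trans (ℚ.∣p+q∣≤∣p∣+∣q∣ a b) (ℚ.+-mono-< p q)

½-pos : ∀ {ε} → 0ℚ ℚ.< ε → 0ℚ ℚ.< ½ ℚ.* ε
½-pos {ε} 0<ε = subst (ℚ._< ½ ℚ.* ε) (ℚ.*-zeroʳ ½) (ℚ.*-monoʳ-<-pos ½ 0<ε)

½+½ : ∀ ε → ½ ℚ.* ε ℚ.+ ½ ℚ.* ε ≡ ε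
½+½ = solve 1 (λ e → con ½ :* e :+ con ½ :* e := e) refl

½-< : ∀ {ε} → 0ℚ ℚ.< ε → ½ ℚ.* ε ℚ.< ε
½-< {ε} 0<ε = subst (½ ℚ.* ε ℚ.<_) (½+½ ε)
  (subst (ℚ._< ½ ℚ.* ε ℚ.+ ½ ℚ.* ε) (ℚ.+-identityʳ (½ ℚ.* ε))
    (ℚ.+-monoʳ-< (½ ℚ.* ε) (½-pos 0<ε)))

recip : ℚ → ℚ
recip q with q ℚ.≟ 0ℚ
... | yes _  = 0ℚ
... | no q≢0 = ℚ.1/_ q {{ℚ.≢-nonZero q≢0}}

recip-inverse : ∀ {q} → 0ℚ ℚ.< q → recip q ℚ.* q ≡ 1ℚ
recip-inverse {q} 0<q with q ℚ.≟ 0ℚ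
... | yes refl = ⊥-elim (ℚ.<-irrefl refl 0<q)
... | no q≢0   = ℚ.*-inverseˡ q {{ℚ.≢-nonZero q≢0}}

recip-pos : ∀ {q} → 0ℚ ℚ.< q → 0ℚ ℚ.< recip q
recip-pos {q} 0<q = ℚ.*-cancelʳ-<-nonNeg q {{ℚ.pos⇒nonNeg q {{ℚ.positive 0<q}}}}
  (subst (ℚ._< recip q ℚ.* q) (sym (ℚ.*-zeroˡ q))
    (subst (0ℚ ℚ.<_) (sym (recip-inverse 0<q)) (ℚ.positive⁻¹ 1ℚ)))

recip-anti : ∀ {p q} → 0ℚ ℚ.< p → p ℚ.≤ q → recip q ℚ.≤ recip p
recip-anti {p} {q} 0<p p≤q = subst₂′ lhs rhs
  (*-mono-≤-nonNeg 0≤rr 0≤p ℚ.≤-refl p≤q)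
  where
  0<q = ℚ.<-≤-trans 0<p p≤q
  0≤p = ℚ.<⇒≤ 0<p
  0≤rr : 0ℚ ℚ.≤ recip p ℚ.* recip q
  0≤rr = subst (ℚ._≤ recip p ℚ.* recip q) (ℚ.*-zeroˡ 0ℚ)
    (*-mono-≤-nonNeg (ℚ.<⇒≤ (recip-pos 0<p)) ℚ.≤-refl
      (ℚ.<⇒≤ (recip-pos 0<p)) (ℚ.<⇒≤ (recip-pos 0<q)))
  lhs : (recip p ℚ.* recip q) ℚ.* p ≡ recip q
  lhs = trans (solve 3 (λ a b c → (a :* b) :* c := (a :* c) :* b) refl (recip p) (recip q) p)
    (trans (cong (ℚ._* recip q) (recip-inverse 0<p)) (ℚ.*-identityˡ (recip q)))
  rhs : (recip p ℚ.* recip q) ℚ.* q ≡ recip p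
  rhs = trans (ℚ.*-assoc (recip p) (recip q) q)
    (trans (cong (recip p ℚ.*_) (recip-inverse 0<q)) (ℚ.*-identityʳ (recip p)))
  subst₂′ : ∀ {a b c d} → a ≡ c → b ≡ d → a ℚ.≤ b → c ℚ.≤ d
  subst₂′ refl refl x = x

shrink : ∀ {ε B} → 0ℚ ℚ.< ε → 0ℚ ℚ.< B → ∃ λ δ → 0ℚ ℚ.< δ × δ ℚ.* B ℚ.< ε
shrink {ε} {B} 0<ε 0<B = ½ ℚ.* ε ℚ.* recip B , 0<δ , subst (ℚ._< ε) (sym eq) (½-< 0<ε)
  where
  0<δ : 0ℚ ℚ.< ½ ℚ.* ε ℚ.* recip B
  0<δ = subst (ℚ._< ½ ℚ.* ε ℚ.* recip B) (ℚ.*-zeroˡ (recip B))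
    (ℚ.*-monoˡ-<-pos (recip B) {{ℚ.positive (recip-pos 0<B)}} (½-pos 0<ε))
  eq : ½ ℚ.* ε ℚ.* recip B ℚ.* B ≡ ½ ℚ.* ε
  eq = trans (ℚ.*-assoc (½ ℚ.* ε) (recip B) B)
    (trans (cong (½ ℚ.* ε ℚ.*_) (recip-inverse 0<B)) (ℚ.*-identityʳ (½ ℚ.* ε)))

Eventually : (ℕ → Set) → Set
Eventually P = ∃ λ N → ∀ n → N ℕ.≤ n → P n

IsCauchy : (ℕ → ℚ) → Set
IsCauchy x = ∀ ε → 0ℚ ℚ.< ε →
  ∃ λ N → ∀ m n → N ℕ.≤ m → N ℕ.≤ n → ∣ x m ℚ.- x n ∣ ℚ.< ε

-- Real equality is _≈_, not propositional equality.
record ℝ : Set where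
  constructor mkℝ
  field
    seq    : ℕ → ℚ
    cauchy : IsCauchy seq

open ℝ public

infix  4 _≈_ _<_ _≤_
infixl 6 _+_ _-_
infixl 7 _*_ _/ℕ_
infix  8 -_

_≈_ : ℝ → ℝ → Set
x ≈ y = ∀ ε → 0ℚ ℚ.< ε → Eventually λ n → ∣ seq x n ℚ.- seq y n ∣ ℚ.< ε

_<_ : ℝ → ℝ → Set
x < y = ∃ λ ε → 0ℚ ℚ.< ε × Eventually λ n → seq x n ℚ.+ ε ℚ.≤ seq y n

_≤_ : ℝ → ℝ → Set
x ≤ y = ∀ ε → 0ℚ ℚ.< ε → Eventually λ n → seq x n ℚ.≤ seq y n ℚ.+ ε

fromℚ : ℚ → ℝ
fromℚ q = mkℝ (λ _ → q) λ ε 0<ε →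
  0 , λ _ _ _ _ → subst (λ r → ∣ r ∣ ℚ.< ε) (sym (ℚ.+-inverseʳ q)) 0<ε

fromℕ : ℕ → ℝ
fromℕ n = fromℚ (+ n ℚ./ 1)

0ℝ 1ℝ 2ℝ : ℝ
0ℝ = fromℕ 0
1ℝ = fromℕ 1
2ℝ = fromℕ 2

_+_ : ℝ → ℝ → ℝ
mkℝ x cx + mkℝ y cy = mkℝ (λ n → x n ℚ.+ y n) λ ε 0<ε →
  let M , p = cx (½ ℚ.* ε) (½-pos 0<ε)
      N , q = cy (½ ℚ.* ε) (½-pos 0<ε)
  in M ℕ.⊔ N , λ m n M⊔N≤m M⊔N≤n →
    subst (λ r → ∣ r ∣ ℚ.< ε)
      (solve 4 (λ a b c d → (a :- b) :+ (c :- d) := (a :+ c) :- (b :+ d)) refl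
        (x m) (x n) (y m) (y n))
      (subst (∣ (x m ℚ.- x n) ℚ.+ (y m ℚ.- y n) ∣ ℚ.<_) (½+½ ε)
        (∣∣-triangle-<
          (p m n (ℕ.m⊔n≤o⇒m≤o M N M⊔N≤m) (ℕ.m⊔n≤o⇒m≤o M N M⊔N≤n))
          (q m n (ℕ.m⊔n≤o⇒n≤o M N M⊔N≤m) (ℕ.m⊔n≤o⇒n≤o M N M⊔N≤n))))

-_ : ℝ → ℝ
- mkℝ x cx = mkℝ (λ n → ℚ.- x n) λ ε 0<ε →
  let N , p = cx ε 0<ε
  in N , λ m n N≤m N≤n → subst (ℚ._< ε)
    (trans (sym (ℚ.∣-p∣≡∣p∣ (x m ℚ.- x n)))
      (cong ∣_∣ (solve 2 (λ a b → :- (a :- b) := :- a :- (:- b)) refl (x m) (x n))))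
    (p m n N≤m N≤n)

_-_ : ℝ → ℝ → ℝ
x - y = x + (- y)

cauchy-bounded : ∀ {x} → IsCauchy x →
  ∃ λ B → 0ℚ ℚ.< B × Eventually λ n → ∣ x n ∣ ℚ.≤ B
cauchy-bounded {x} cx =
  let N , p = cx 1ℚ (ℚ.positive⁻¹ 1ℚ)
  in 1ℚ ℚ.+ ∣ x N ∣
   , ℚ.+-mono-<-≤ (ℚ.positive⁻¹ 1ℚ) (ℚ.0≤∣p∣ (x N))
   , N , λ n N≤n → ℚ.≤-trans
       (subst (λ r → ∣ r ∣ ℚ.≤ ∣ x n ℚ.- x N ∣ ℚ.+ ∣ x N ∣)
         (solve 2 (λ a b → (a :- b) :+ b := a) refl (x n) (x N))
         (ℚ.∣p+q∣≤∣p∣+∣q∣ (x n ℚ.- x N) (x N)))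
       (ℚ.+-monoˡ-≤ ∣ x N ∣ (ℚ.<⇒≤ (p n N N≤n ℕ.≤-refl)))

_*_ : ℝ → ℝ → ℝ
mkℝ x cx * mkℝ y cy = mkℝ (λ n → x n ℚ.* y n) λ ε 0<ε →
  let A , 0<A , K , x≤A = cauchy-bounded cx
      B , 0<B , L , y≤B = cauchy-bounded cy
      δ , 0<δ , δ< = shrink 0<ε (ℚ.+-mono-< 0<B 0<A)
      M , p = cx δ 0<δ
      N , q = cy δ 0<δ
      K⊔L = K ℕ.⊔ L
      M⊔N = M ℕ.⊔ N
  in K⊔L ℕ.⊔ M⊔N , λ m n h h′ →
    let K⊔L≤m = ℕ.m⊔n≤o⇒m≤o K⊔L M⊔N h
        K⊔L≤n = ℕ.m⊔n≤o⇒m≤o K⊔L M⊔N h′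
        M⊔N≤m = ℕ.m⊔n≤o⇒n≤o K⊔L M⊔N h
        M⊔N≤n = ℕ.m⊔n≤o⇒n≤o K⊔L M⊔N h′
        Δx = x m ℚ.- x n
        Δy = y m ℚ.- y n
        Δx< = p m n (ℕ.m⊔n≤o⇒m≤o M N M⊔N≤m) (ℕ.m⊔n≤o⇒m≤o M N M⊔N≤n)
        Δy< = q m n (ℕ.m⊔n≤o⇒n≤o M N M⊔N≤m) (ℕ.m⊔n≤o⇒n≤o M N M⊔N≤n)
        bound : ∣ Δx ℚ.* y m ∣ ℚ.+ ∣ Δy ℚ.* x n ∣ ℚ.≤ δ ℚ.* (B ℚ.+ A)
        bound = subst (∣ Δx ℚ.* y m ∣ ℚ.+ ∣ Δy ℚ.* x n ∣ ℚ.≤_)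
          (sym (ℚ.*-distribˡ-+ δ B A))
          (ℚ.+-mono-≤
            (∣*∣≤ 0<δ Δx< (y≤B m (ℕ.m⊔n≤o⇒n≤o K L K⊔L≤m)))
            (∣*∣≤ 0<δ Δy< (x≤A n (ℕ.m⊔n≤o⇒m≤o K L K⊔L≤n))))
    in subst (λ r → ∣ r ∣ ℚ.< ε)
      (solve 4 (λ a b c d → (a :- b) :* c :+ (c :- d) :* b := a :* c :- b :* d) refl
        (x m) (x n) (y m) (y n))
      (ℚ.≤-<-trans (ℚ.∣p+q∣≤∣p∣+∣q∣ (Δx ℚ.* y m) (Δy ℚ.* x n)) (ℚ.≤-<-trans bound δ<))
  where
  ∣*∣≤ : ∀ {a b δ B} → 0ℚ ℚ.< δ → ∣ a ∣ ℚ.< δ → ∣ b ∣ ℚ.≤ B → ∣ a ℚ.* b ∣ ℚ.≤ δ ℚ.* B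
  ∣*∣≤ {a} {b} 0<δ a<δ b≤B = subst (ℚ._≤ _) (sym (ℚ.∣p*q∣≡∣p∣*∣q∣ a b))
    (*-mono-≤-nonNeg (ℚ.<⇒≤ 0<δ) (ℚ.0≤∣p∣ b) (ℚ.<⇒≤ a<δ) b≤B)

-- The reciprocal is taken termwise.  Finitely many terms may vanish, and there
-- recip 0ℚ = 0ℚ; the proof of positivity makes the result Cauchy.
inverse : (x : ℝ) → 0ℝ < x → ℝ
inverse (mkℝ x cx) (η , 0<η , K , η≤x) = mkℝ (λ n → recip (x n)) λ ε 0<ε →
  let rη = recip η
      0<rη = recip-pos 0<η
      0<rη² = subst (ℚ._< rη ℚ.* rη) (ℚ.*-zeroˡ rη)
                (ℚ.*-monoˡ-<-pos rη {{ℚ.positive 0<rη}} 0<rη)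
      δ , 0<δ , δ< = shrink 0<ε 0<rη²
      N , p = cx δ 0<δ
  in K ℕ.⊔ N , λ m n h h′ →
    let η≤xm = η≤ m (ℕ.m⊔n≤o⇒m≤o K N h)
        η≤xn = η≤ n (ℕ.m⊔n≤o⇒m≤o K N h′)
        Δ< = p n m (ℕ.m⊔n≤o⇒n≤o K N h′) (ℕ.m⊔n≤o⇒n≤o K N h)
        Δ = x n ℚ.- x m
        rm = recip (x m)
        rn = recip (x n)
        0≤rm = ℚ.<⇒≤ (recip-pos (ℚ.<-≤-trans 0<η η≤xm))
        0≤rn = ℚ.<⇒≤ (recip-pos (ℚ.<-≤-trans 0<η η≤xn))
        0≤rr = subst (ℚ._≤ rm ℚ.* rn) (ℚ.*-zeroˡ 0ℚ)
                 (*-mono-≤-nonNeg 0≤rm ℚ.≤-refl 0≤rm 0≤rn)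
        rr≤ = *-mono-≤-nonNeg (ℚ.<⇒≤ 0<rη) 0≤rn (recip-anti 0<η η≤xm) (recip-anti 0<η η≤xn)
        ∣Δrr∣ : ∣ Δ ℚ.* (rm ℚ.* rn) ∣ ≡ ∣ Δ ∣ ℚ.* (rm ℚ.* rn)
        ∣Δrr∣ = trans (ℚ.∣p*q∣≡∣p∣*∣q∣ Δ (rm ℚ.* rn))
                  (cong (∣ Δ ∣ ℚ.*_) (ℚ.0≤p⇒∣p∣≡p 0≤rr))
        difference : Δ ℚ.* (rm ℚ.* rn) ≡ rm ℚ.- rn
        difference = trans
          (solve 4 (λ a b s t → (b :- a) :* (s :* t) := s :* (t :* b) :- t :* (s :* a)) refl
            (x m) (x n) rm rn)
          (trans
            (cong₂ (λ a b → rm ℚ.* a ℚ.- rn ℚ.* b)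
              (recip-inverse (ℚ.<-≤-trans 0<η η≤xn))
              (recip-inverse (ℚ.<-≤-trans 0<η η≤xm)))
            (cong₂ ℚ._-_ (ℚ.*-identityʳ rm) (ℚ.*-identityʳ rn)))
    in subst (λ r → ∣ r ∣ ℚ.< ε) difference
      (subst (ℚ._< ε) (sym ∣Δrr∣)
        (ℚ.≤-<-trans (*-mono-≤-nonNeg (ℚ.<⇒≤ 0<δ) 0≤rr (ℚ.<⇒≤ Δ<) rr≤) δ<))
  where
  η≤ : ∀ n → K ℕ.≤ n → η ℚ.≤ x n
  η≤ n K≤n = subst (ℚ._≤ x n) (ℚ.+-identityˡ η) (η≤x n K≤n)

infixl 7 _/_[_]
_/_[_] : ℝ → (y : ℝ) → 0ℝ < y → ℝ
x / y [ 0<y ] = x * inverse y 0<y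

_/ℕ_ : ℝ → (n : ℕ) .{{_ : ℕ.NonZero n}} → ℝ
x /ℕ n = x * fromℚ (+ 1 ℚ./ n)

half^ : ℕ → ℚ
half^ zero    = 1ℚ
half^ (suc n) = ½ ℚ.* half^ n

half^-pos : ∀ n → 0ℚ ℚ.< half^ n
half^-pos zero    = ℚ.positive⁻¹ 1ℚ
half^-pos (suc n) = ½-pos (half^-pos n)

private
  count : ℕ → ℚ
  count zero    = 0ℚ
  count (suc n) = 1ℚ ℚ.+ count n

  count-nonNeg : ∀ n → 0ℚ ℚ.≤ count n
  count-nonNeg zero    = ℚ.≤-refl
  count-nonNeg (suc n) = ℚ.+-mono-≤ (ℚ.<⇒≤ (ℚ.positive⁻¹ 1ℚ)) (count-nonNeg n)

  count≡/1 : ∀ n → count n ≡ + n ℚ./ 1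
  count≡/1 zero    = refl
  count≡/1 (suc n) = trans (cong (1ℚ ℚ.+_) (count≡/1 n)) (ℚ.toℚᵘ-injective
    (ℚᵘ.≃-trans (ℚ.toℚᵘ-homo-+ 1ℚ (+ n ℚ./ 1))
    (ℚᵘ.≃-trans (ℚᵘ.+-congʳ (mkℚᵘ (+ 1) 0) (ℚ.toℚᵘ-fromℚᵘ (mkℚᵘ (+ n) 0)))
    (ℚᵘ.≃-trans (ℚᵘ.*≡* (cong (λ z → ((+ 1) ℤ.+ z) ℤ.* (+ 1)) (ℤ.*-identityʳ (+ n))))
      (ℚᵘ.≃-sym (ℚ.toℚᵘ-fromℚᵘ (mkℚᵘ (+ suc n) 0)))))))

  half^-count : ∀ n → half^ n ℚ.* count (suc n) ℚ.≤ 1ℚ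
  half^-count zero    = ℚ.≤-refl
  half^-count (suc n) = ℚ.≤-trans (ℚ.≤-trans
      (ℚ.*-monoˡ-≤-nonNeg (½ ℚ.* half^ n) {{ℚ.nonNegative (ℚ.<⇒≤ (half^-pos (suc n)))}}
        (ℚ.+-monoʳ-≤ 1ℚ (ℚ.+-monoʳ-≤ 1ℚ
          (subst (ℚ._≤ count n ℚ.+ count n) (ℚ.+-identityˡ (count n))
            (ℚ.+-monoˡ-≤ (count n) (count-nonNeg n))))))
      (ℚ.≤-reflexive (solve 2
        (λ h c → (con ½ :* h) :* (con 1ℚ :+ (con 1ℚ :+ (c :+ c))) := h :* (con 1ℚ :+ c))
        refl (half^ n) (count n))))
    (half^-count n)

  ε*count : ∀ ε → 0ℚ ℚ.< ε → ∃ λ n → 1ℚ ℚ.≤ ε ℚ.* count n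
  ε*count ε@(mkℚ (+ zero) _ _) (ℚ.*<* (ℤ.+<+ ()))
  ε*count ε@(mkℚ -[1+ _ ] _ _) (ℚ.*<* ())
  ε*count ε@(mkℚ +[1+ a ] d _) _ = suc d
    , subst (λ q → 1ℚ ℚ.≤ ε ℚ.* q) (sym (count≡/1 (suc d))) (ℚ.toℚᵘ-cancel-≤
        (ℚᵘ.≤-respʳ-≃
          (ℚᵘ.≃-sym (ℚᵘ.≃-trans (ℚ.toℚᵘ-homo-* ε (+ suc d ℚ./ 1))
            (ℚᵘ.*-congˡ {ℚ.toℚᵘ ε} (ℚ.toℚᵘ-fromℚᵘ (mkℚᵘ (+ suc d) 0)))))
          (ℚᵘ.*≤* (ℤ.+≤+ bound))))
    where
    bound : 1 ℕ.* (suc d ℕ.* 1) ℕ.≤ suc a ℕ.* suc d ℕ.* 1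
    bound = subst₂ ℕ._≤_ (sym (trans (ℕ.*-identityˡ (suc d ℕ.* 1)) (ℕ.*-identityʳ (suc d))))
      (sym (ℕ.*-identityʳ (suc a ℕ.* suc d))) (ℕ.m≤m+n (suc d) (a ℕ.* suc d))

half^-small : ∀ {ε} → 0ℚ ℚ.< ε → ∃ λ n → half^ n ℚ.< ε
half^-small {ε} 0<ε = let n , 1≤εn = ε*count ε 0<ε in
  n , ℚ.*-cancelʳ-<-nonNeg (count (suc n)) {{ℚ.nonNegative (count-nonNeg (suc n))}}
    (ℚ.≤-<-trans (ℚ.≤-trans (half^-count n) 1≤εn)
      (ℚ.*-monoʳ-<-pos ε {{ℚ.positive 0<ε}}
        (subst (ℚ._< count (suc n)) (ℚ.+-identityˡ (count n))
          (ℚ.+-monoˡ-< (count n) (ℚ.positive⁻¹ 1ℚ)))))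

-- Iteration of x ↦ x + (3 - x²)/4, a ½-contraction of [1,2] with fixed point √3.
3ℚ 2ℚ : ℚ
3ℚ = + 3 ℚ./ 1
2ℚ = + 2 ℚ./ 1

√3-step : ℚ → ℚ
√3-step x = x ℚ.+ ¼ ℚ.* (3ℚ ℚ.- x ℚ.* x)

√3-seq : ℕ → ℚ
√3-seq zero    = 1ℚ
√3-seq (suc n) = √3-step (√3-seq n)

0≤-* : ∀ {a b} → 0ℚ ℚ.≤ a → 0ℚ ℚ.≤ b → 0ℚ ℚ.≤ a ℚ.* b
0≤-* {a} {b} 0≤a 0≤b = subst (ℚ._≤ a ℚ.* b) (ℚ.*-zeroˡ 0ℚ)
  (*-mono-≤-nonNeg 0≤a ℚ.≤-refl 0≤a 0≤b)

≤⇒0≤- : ∀ {a b} → a ℚ.≤ b → 0ℚ ℚ.≤ b ℚ.- a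
≤⇒0≤- {a} {b} a≤b = subst (ℚ._≤ b ℚ.- a) (ℚ.+-inverseʳ a) (ℚ.+-monoˡ-≤ (ℚ.- a) a≤b)

0≤-⇒≤ : ∀ {a b} → 0ℚ ℚ.≤ b ℚ.- a → a ℚ.≤ b
0≤-⇒≤ {a} {b} h = subst₂ ℚ._≤_ (ℚ.+-identityˡ a)
  (solve 2 (λ a b → (b :- a) :+ a := b) refl a b) (ℚ.+-monoˡ-≤ a h)

√3-seq-bounds : ∀ n → 1ℚ ℚ.≤ √3-seq n × √3-seq n ℚ.≤ 2ℚ
√3-seq-bounds zero    = ℚ.≤-refl , ℚ.≤ᵇ⇒≤ _
√3-seq-bounds (suc n) = let 1≤x , x≤2 = √3-seq-bounds n
                            0≤x-1 = ≤⇒0≤- 1≤x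
                            0≤2-x = ≤⇒0≤- x≤2 in
  0≤-⇒≤ (subst (0ℚ ℚ.≤_)
    (solve 1 (λ x → con ¼ :* ((con 2ℚ :- x) :* (x :- con 1ℚ) :+ (x :- con 1ℚ) :+ con 2ℚ)
      := (x :+ con ¼ :* (con 3ℚ :- x :* x)) :- con 1ℚ) refl (√3-seq n))
    (0≤-* {¼} (ℚ.≤ᵇ⇒≤ _) (ℚ.+-mono-≤ (ℚ.+-mono-≤ (0≤-* 0≤2-x 0≤x-1) 0≤x-1) (ℚ.≤ᵇ⇒≤ {0ℚ} {2ℚ} _))))
  , 0≤-⇒≤ (subst (0ℚ ℚ.≤_)
    (solve 1 (λ x → con ¼ :* ((con 2ℚ :- x) :* (con 2ℚ :- x) :+ con 1ℚ)
      := con 2ℚ :- (x :+ con ¼ :* (con 3ℚ :- x :* x))) refl (√3-seq n))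
    (0≤-* {¼} (ℚ.≤ᵇ⇒≤ _) (ℚ.+-mono-≤ (0≤-* 0≤2-x 0≤2-x) (ℚ.≤ᵇ⇒≤ {0ℚ} {1ℚ} _))))

√3-seq-contracts : ∀ k m n → ∣ √3-seq (k ℕ.+ m) ℚ.- √3-seq (k ℕ.+ n) ∣ ℚ.≤ half^ k
√3-seq-contracts zero m n =
  let 1≤x , x≤2 = √3-seq-bounds m
      1≤y , y≤2 = √3-seq-bounds n in
  ∣∣-≤ (ℚ.+-mono-≤ x≤2 (ℚ.neg-antimono-≤ 1≤y))
    (subst (ℚ._≤ 1ℚ) (solve 2 (λ x y → y :- x := :- (x :- y)) refl (√3-seq m) (√3-seq n))
      (ℚ.+-mono-≤ y≤2 (ℚ.neg-antimono-≤ 1≤x)))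
√3-seq-contracts (suc k) m n =
  subst (λ r → ∣ r ∣ ℚ.≤ ½ ℚ.* half^ k)
    (solve 2 (λ x y →
        (con 1ℚ :- con ¼ :* (x :+ y)) :* (x :- y)
          := (x :+ con ¼ :* (con 3ℚ :- x :* x)) :- (y :+ con ¼ :* (con 3ℚ :- y :* y)))
      refl x y)
    (subst (ℚ._≤ ½ ℚ.* half^ k) (sym (ℚ.∣p*q∣≡∣p∣*∣q∣ factor (x ℚ.- y)))
      (*-mono-≤-nonNeg (ℚ.≤ᵇ⇒≤ _) (ℚ.0≤∣p∣ (x ℚ.- y)) factor≤½ (√3-seq-contracts k m n)))
  where
  x = √3-seq (k ℕ.+ m)
  y = √3-seq (k ℕ.+ n)
  1≤x = proj₁ (√3-seq-bounds (k ℕ.+ m))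
  1≤y = proj₁ (√3-seq-bounds (k ℕ.+ n))
  x≤2 = proj₂ (√3-seq-bounds (k ℕ.+ m))
  y≤2 = proj₂ (√3-seq-bounds (k ℕ.+ n))
  factor = 1ℚ ℚ.- ¼ ℚ.* (x ℚ.+ y)
  factor≤½ : ∣ factor ∣ ℚ.≤ ½
  factor≤½ = ∣∣-≤
    (ℚ.+-monoʳ-≤ 1ℚ (ℚ.neg-antimono-≤ (ℚ.*-monoˡ-≤-nonNeg ¼ (ℚ.+-mono-≤ 1≤x 1≤y))))
    (ℚ.≤-trans
      (ℚ.neg-antimono-≤ (ℚ.+-monoʳ-≤ 1ℚ (ℚ.neg-antimono-≤
        (ℚ.*-monoˡ-≤-nonNeg ¼ (ℚ.+-mono-≤ x≤2 y≤2)))))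
      (ℚ.≤ᵇ⇒≤ _))

√3-seq-cauchy : IsCauchy √3-seq
√3-seq-cauchy ε 0<ε = let k , h = half^-small 0<ε in
  k , λ m n k≤m k≤n → subst₂ (λ i j → ∣ √3-seq i ℚ.- √3-seq j ∣ ℚ.< ε)
    (ℕ.m+[n∸m]≡n k≤m) (ℕ.m+[n∸m]≡n k≤n)
    (ℚ.≤-<-trans (√3-seq-contracts k (m ℕ.∸ k) (n ℕ.∸ k)) h)

√3 : ℝ
√3 = mkℝ √3-seq √3-seq-cauchy

√3-pos : 0ℝ < √3
√3-pos = 1ℚ , ℚ.positive⁻¹ 1ℚ , 0 , λ n _ → proj₁ (√3-seq-bounds n)

√3*√3≈3 : √3 * √3 ≈ fromℕ 3
√3*√3≈3 ε 0<ε =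
  let 0<¼ε = subst (ℚ._< ¼ ℚ.* ε) (ℚ.*-zeroʳ ¼) (ℚ.*-monoʳ-<-pos ¼ 0<ε)
      N , p = √3-seq-cauchy (¼ ℚ.* ε) 0<¼ε in
  N , λ n N≤n → ℚ.*-cancelˡ-<-nonNeg ¼ (subst (ℚ._< ¼ ℚ.* ε)
    (trans (cong ∣_∣ (solve 1
        (λ x → x :- (x :+ con ¼ :* (con 3ℚ :- x :* x)) := con ¼ :* (x :* x :- con 3ℚ))
        refl (√3-seq n)))
      (ℚ.∣p*q∣≡∣p∣*∣q∣ ¼ (√3-seq n ℚ.* √3-seq n ℚ.- 3ℚ)))
    (p n (suc n) N≤n (ℕ.m≤n⇒m≤1+n N≤n)))

c₀-1-pos : ∀ c₀ → 2ℝ + √3 ≤ c₀ → 0ℝ < c₀ - 1ℝ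
c₀-1-pos c₀ h = let N , p = h 1ℚ (ℚ.positive⁻¹ 1ℚ) in
  1ℚ , ℚ.positive⁻¹ 1ℚ , N , λ n N≤n → 0≤-⇒≤ (subst (0ℚ ℚ.≤_)
    (solve 2 (λ x c → (x :- con 1ℚ) :+ ((c :+ con 1ℚ) :- (con 2ℚ :+ x))
        := (c :+ con (ℚ.- 1ℚ)) :- (con 0ℚ :+ con 1ℚ)) refl (√3-seq n) (seq c₀ n))
    (ℚ.+-mono-≤ (≤⇒0≤- (proj₁ (√3-seq-bounds n))) (≤⇒0≤- (p n N≤n))))

-- The entries of r in r ∷ g tell which vertices of g, renamed along suc, are
-- adjacent to the new vertex zero; so each simple graph is exactly one term.
data Graph : ℕ → Set where
  []  : Graph 0
  _∷_ : ∀ {n} → Vec Bool n → Graph n → Graph (suc n)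

adjacent : ∀ {n} → Graph n → Fin n → Fin n → Bool
adjacent (r ∷ g) zero    zero    = false
adjacent (r ∷ g) zero    (suc v) = Vec.lookup r v
adjacent (r ∷ g) (suc u) zero    = Vec.lookup r u
adjacent (r ∷ g) (suc u) (suc v) = adjacent g u v

Adjacent : ∀ {n} → Graph n → Fin n → Fin n → Set
Adjacent G u v = T (adjacent G u v)

bitVecs : ∀ n → List (Vec Bool n)
bitVecs zero    = List.[ [] ]
bitVecs (suc n) = List.cartesianProductWith _∷_ (true ∷ false ∷ []) (bitVecs n)

graphs : ∀ n → List (Graph n)
graphs zero    = List.[ [] ]
graphs (suc n) = List.cartesianProductWith _∷_ (bitVecs n) (graphs n)

-- w u v, for toℕ u < toℕ v, is the probability of the edge uv.
EdgeProbabilities : ℕ → Set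
EdgeProbabilities n = Fin n → Fin n → ℝ

∏ : ∀ {n} → Vector ℝ n → ℝ
∏ = Table.foldr _*_ 1ℝ

probability : ∀ {n} → EdgeProbabilities n → Graph n → ℝ
probability w []      = 1ℝ
probability w (r ∷ g) =
  ∏ (λ v → if Vec.lookup r v then w zero (suc v) else 1ℝ - w zero (suc v))
  * probability (λ u v → w (suc u) (suc v)) g

𝔼 : ∀ {n} → EdgeProbabilities n → (Graph n → ℝ) → ℝ
𝔼 {n} w X = List.foldr _+_ 0ℝ (List.map (λ G → probability w G * X G) (graphs n))

erdosRenyi : ∀ n → ℝ → EdgeProbabilities n
erdosRenyi n p _ _ = p

-- For even n, V⁺ and its complement V⁻ have n/2 elements each.
inV⁺ : ∀ {n} → Fin n → Bool
inV⁺ {n} u = toℕ u ℕ.<ᵇ ⌊ n /2⌋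

plantedPartition : ∀ n → ℝ → ℝ → EdgeProbabilities n
plantedPartition n p q u v = if does (inV⁺ u Bool.≟ inV⁺ v) then p else q

-- A path of length k is given by its k + 1 distinct vertices.
IsPath : ∀ {n k} → Graph n → Fin n → Fin n → Vec (Fin n) (suc k) → Set
IsPath G s v xs =
  Vec.head xs ≡ s × Vec.last xs ≡ v × Linked (Adjacent G) xs × Unique xs

HasPath : ∀ {n} → Graph n → Fin n → Fin n → ℕ → Set
HasPath {n} G s v k = ∃ λ (xs : Vec (Fin n) (suc k)) → IsPath G s v xs

AtDistance : ∀ {n} → Graph n → Fin n → ℕ → Fin n → Set
AtDistance G s d v = HasPath G s v d × (∀ {k} → k ℕ.< d → ¬ HasPath G s v k)

anyVec? : ∀ {n} k {P : Vec (Fin n) k → Set} → (∀ xs → Dec (P xs)) → Dec (∃ P)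
anyVec? zero    P? = map′ ([] ,_) (λ { ([] , p) → p }) (P? [])
anyVec? (suc k) P? = map′
  (λ { (x , xs , p) → x ∷ xs , p })
  (λ { (x ∷ xs , p) → x , xs , p })
  (Fin.any? λ x → anyVec? k λ xs → P? (x ∷ xs))

hasPath? : ∀ {n} (G : Graph n) s v k → Dec (HasPath G s v k)
hasPath? G s v k = anyVec? (suc k) λ xs →
  Vec.head xs Fin.≟ s ×-dec Vec.last xs Fin.≟ v
  ×-dec linked? (λ u u′ → T? (adjacent G u u′)) xs
  ×-dec allPairs? (λ u u′ → ¬? (u Fin.≟ u′)) xs

atDistance? : ∀ {n} (G : Graph n) s d v → Dec (AtDistance G s d v)
atDistance? G s d v =
  hasPath? G s v d ×-dec ℕ.allUpTo? (λ k → ¬? (hasPath? G s v k)) d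

numberAtDistance : ∀ {n} → Graph n → Fin n → ℕ → ℕ
numberAtDistance {n} G s d = List.length (List.filter (atDistance? G s d) (List.allFin n))

expectedAtDistance : ∀ {n} → EdgeProbabilities n → Fin n → ℕ → ℝ
expectedAtDistance w s d = 𝔼 w λ G → fromℕ (numberAtDistance G s d)

-- Both expectations are c₀ᵈ (1 + O(1/n)), so the factors 1 ± 2/(c₀ - 1) leave
-- room to spare and C = 1 suffices.  Up to O(1/n), the edge probabilities seen
-- from any vertex sum to c₀ in either model.  The number of vertices at
-- distance d from s is at most the number of paths of length d from s, whose
-- expectation is at most c₀ᵈ (1 + O(1/n)).  It is at least the number of such
-- paths P without an ear of length at most d, that is, a path joining two
-- vertices of P and using no edge of P: if another path of length at most d
-- joins the ends of P, then it leaves P and its first return closes an ear.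
-- Given P, an ear is present with probability O(1/n).
--
-- Reals are sequences of rationals and their operations are termwise, so all
-- estimates are made in ℚ, uniformly in the index of the sequence.

module Submission where

open import Data.Fin.Base using (Fin)
open import Data.Nat.Base as ℕ using (ℕ)
open import Data.Nat.Divisibility using (_∣_)
open import Data.Product.Base using (∃; _×_)

-- Conditioning on a path is avoided. Each candidate P contributes its indicator times one minus the
-- number of ears present. This value is at most 1 and drops to 0 or below when an ear is present,
-- so summing it over P never overcounts the vertices at distance d. Its expectation is exact: a
-- path and an ear consist of distinct edges, so their joint probability is a product. The value is
-- negative when more than one ear is counted, hence some lemmas on sums speak of positive terms
-- only. The models enter only through their row sums, which are c up to O(1/n), and a bound O(1/n)
-- for single entries, where c is one term of the sequence `c₀`. A strict inequality of reals
-- demands one positive rational gap for all late terms, so the error constant and the gap may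
-- depend only on an integer B above the late terms c. The room comes from 2 / (c - 1) ≥ 2 / B,
-- while n is taken so large that the relative errors are at most 1 / (2 B); since c^d ≥ 1, an
-- absolute gap of 1 / (2 B) is left over.

module Rationals where

  open import Algebra.Bundles using (CommutativeRing)
  open import Data.Bool.Base using (Bool; true; false; T; if_then_else_)
  open import Data.Bool.Properties as Bool using ()
  open import Data.Fin.Base using (Fin; zero; suc; toℕ; fromℕ<)
  open import Data.Fin.Properties as Fin using ()
  open import Data.Integer.Base as ℤ using ()
  open import Data.Integer.Properties as ℤ using ()
  open import Data.List.Base as List using (List; []; _∷_; _++_; [_]; length)
  open import Data.List.Membership.DecPropositional as DecMembership using ()
  open import Data.List.Membership.Propositional using (_∈_; _∉_)
  open import Data.List.Membership.Propositional.Properties using (∈-++⁺ˡ)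
  open import Data.List.Properties as List using ()
  open import Data.List.Relation.Unary.All as All using (All; []; _∷_)
  open import Data.List.Relation.Unary.All.Properties as All using (¬Any⇒All¬)
  open import Data.List.Relation.Unary.AllPairs using (AllPairs; []; _∷_; allPairs?)
  open import Data.List.Relation.Unary.AllPairs.Properties as AllPairs using ()
  open import Data.List.Relation.Unary.Any using (here; there)
  open import Data.List.Relation.Unary.Unique.Propositional using (Unique)
  open import Data.Nat.Base using (zero; suc)
  open import Data.Nat.Properties as ℕ using ()
  open import Data.Product.Base using (_,_; proj₁; proj₂)
  open import Data.Rational.Base hiding (truncate)
  open import Data.Rational.Properties
  open import Data.Rational.Solver using (module +-*-Solver)
  open import Data.Rational.Unnormalised.Base using (mkℚᵘ; *≡*; *≤*)
  open import Data.Rational.Unnormalised.Properties as ℚᵘ using ()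
  open import Data.Sum.Base using (_⊎_; inj₁; inj₂; swap)
  open import Data.Vec.Base as Vec using (Vec; []; _∷_)
  open import Data.Vec.Properties as Vec using ()
  open import Data.Vec.Relation.Unary.All.Properties as VecAll using ()
  open import Data.Vec.Relation.Unary.AllPairs as VecAllPairs using ([]; _∷_)
  open import Data.Vec.Relation.Unary.Linked using (Linked; [-]; _∷_)
  open import Function.Base using (_∘_)
  open import Relation.Binary.PropositionalEquality hiding ([_])
  open import Relation.Nullary.Decidable using (Dec; yes; no; does; ¬?; _×-dec_; _⊎-dec_)
  open import Relation.Nullary.Negation.Core using (¬_; contradiction)
  open import Defs hiding (_+_; _*_; _-_; -_; _<_; _≤_)

  open import Algebra.Properties.Semiring.Sum (CommutativeRing.semiring +-*-commutativeRing)
    using (sum; sum-cong-≗; ∑-distrib-+; ∑-comm; *-distribˡ-sum; *-distribʳ-sum; sum-replicate-zero)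

  open +-*-Solver using (solve; _:+_; _:*_; _:-_; :-_; _:=_; con)

  -- Arithmetic of rationals and indicators

  0≤1 : 0ℚ ≤ 1ℚ
  0≤1 = ≤ᵇ⇒≤ _

  0<1 : 0ℚ < 1ℚ
  0<1 = positive⁻¹ 1ℚ

  *-monoʳ-≤ : ∀ {p q r} → 0ℚ ≤ r → p ≤ q → p * r ≤ q * r
  *-monoʳ-≤ {r = r} 0≤r = *-monoʳ-≤-nonNeg r {{nonNegative 0≤r}}

  *-monoˡ-≤ : ∀ {p q r} → 0ℚ ≤ r → p ≤ q → r * p ≤ r * q
  *-monoˡ-≤ {r = r} 0≤r = *-monoˡ-≤-nonNeg r {{nonNegative 0≤r}}

  0≤-+ : ∀ {p q} → 0ℚ ≤ p → 0ℚ ≤ q → 0ℚ ≤ p + q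
  0≤-+ = +-mono-≤

  p≤p+q : ∀ {p q} → 0ℚ ≤ q → p ≤ p + q
  p≤p+q {p} 0≤q = subst (_≤ p + _) (+-identityʳ p) (+-monoʳ-≤ p 0≤q)

  p≤q+p : ∀ {p q} → 0ℚ ≤ q → p ≤ q + p
  p≤q+p {p} {q} 0≤q = subst (_≤ q + p) (+-identityˡ p) (+-monoˡ-≤ p 0≤q)

  ≤-diff : ∀ {a b r} → b - a ≡ r → 0ℚ ≤ r → a ≤ b
  ≤-diff eq 0≤r = 0≤-⇒≤ (subst (0ℚ ≤_) (sym eq) 0≤r)

  p≤∣p∣ : ∀ p → p ≤ ∣ p ∣
  p≤∣p∣ p with ≤-total 0ℚ p
  ... | inj₁ 0≤p = ≤-reflexive (sym (0≤p⇒∣p∣≡p 0≤p))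
  ... | inj₂ p≤0 = ≤-trans p≤0 (0≤∣p∣ p)

  infixr 8 _^_
  _^_ : ℚ → ℕ → ℚ
  q ^ zero  = 1ℚ
  q ^ suc k = q * q ^ k

  0≤-^ : ∀ {q} k → 0ℚ ≤ q → 0ℚ ≤ q ^ k
  0≤-^ zero    0≤q = 0≤1
  0≤-^ (suc k) 0≤q = 0≤-* 0≤q (0≤-^ k 0≤q)

  ^-mono : ∀ {p q} k → 0ℚ ≤ p → p ≤ q → p ^ k ≤ q ^ k
  ^-mono zero    0≤p p≤q = ≤-refl
  ^-mono (suc k) 0≤p p≤q =
    *-mono-≤-nonNeg (≤-trans 0≤p p≤q) (0≤-^ k 0≤p) p≤q (^-mono k 0≤p p≤q)

  1≤-^ : ∀ {q} k → 1ℚ ≤ q → 1ℚ ≤ q ^ k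
  1≤-^ zero    1≤q = ≤-refl
  1≤-^ {q} (suc k) 1≤q = ≤-trans (1≤-^ k 1≤q)
    (subst (_≤ q * q ^ k) (*-identityˡ _) (*-monoʳ-≤ (≤-trans 0≤1 (1≤-^ k 1≤q)) 1≤q))

  *-^ : ∀ p q k → (p * q) ^ k ≡ p ^ k * q ^ k
  *-^ p q zero    = refl
  *-^ p q (suc k) = trans (cong (p * q *_) (*-^ p q k))
    (solve 4 (λ p q a b → p :* q :* (a :* b) := (p :* a) :* (q :* b)) refl p q (p ^ k) (q ^ k))

  𝟙 : Bool → ℚ
  𝟙 true  = 1ℚ
  𝟙 false = 0ℚ

  ⟦_⟧ : ∀ {P : Set} → Dec P → ℚ
  ⟦ P? ⟧ = 𝟙 (does P?)

  0≤𝟙 : ∀ b → 0ℚ ≤ 𝟙 b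
  0≤𝟙 true  = 0≤1
  0≤𝟙 false = ≤-refl

  𝟙≤1 : ∀ b → 𝟙 b ≤ 1ℚ
  𝟙≤1 true  = ≤-refl
  𝟙≤1 false = 0≤1

  ⟦⟧-true : ∀ {P : Set} (P? : Dec P) → P → ⟦ P? ⟧ ≡ 1ℚ
  ⟦⟧-true (yes _) p = refl
  ⟦⟧-true (no ¬p) p = contradiction p ¬p

  ≤⟦⟧ : ∀ {P : Set} (P? : Dec P) {q} → (P → q ≤ 1ℚ) → (¬ P → q ≤ 0ℚ) → q ≤ ⟦ P? ⟧
  ≤⟦⟧ (yes p) q≤1 q≤0 = q≤1 p
  ≤⟦⟧ (no ¬p) q≤1 q≤0 = q≤0 ¬p

  ⟦⟧≤ : ∀ {P : Set} (P? : Dec P) {q} → (P → 1ℚ ≤ q) → (¬ P → 0ℚ ≤ q) → ⟦ P? ⟧ ≤ q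
  ⟦⟧≤ (yes p) 1≤q 0≤q = 1≤q p
  ⟦⟧≤ (no ¬p) 1≤q 0≤q = 0≤q ¬p

  ⟦⟧-mono : ∀ {P Q : Set} (P? : Dec P) (Q? : Dec Q) → (P → Q) → ⟦ P? ⟧ ≤ ⟦ Q? ⟧
  ⟦⟧-mono P? Q? P⇒Q =
    ⟦⟧≤ P? (λ p → ≤-reflexive (sym (⟦⟧-true Q? (P⇒Q p)))) (λ _ → 0≤𝟙 (does Q?))

  ν : ℕ → ℚ
  ν n = ℤ.+ n / 1

  ν-suc : ∀ n → ν (suc n) ≡ 1ℚ + ν n
  ν-suc n = sym (toℚᵘ-injective
    (ℚᵘ.≃-trans (toℚᵘ-homo-+ 1ℚ (ν n))
    (ℚᵘ.≃-trans (ℚᵘ.+-congʳ (mkℚᵘ (ℤ.+ 1) 0) (toℚᵘ-fromℚᵘ (mkℚᵘ (ℤ.+ n) 0)))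
    (ℚᵘ.≃-trans (*≡* (cong (λ z → ((ℤ.+ 1) ℤ.+ z) ℤ.* (ℤ.+ 1)) (ℤ.*-identityʳ (ℤ.+ n))))
      (ℚᵘ.≃-sym (toℚᵘ-fromℚᵘ (mkℚᵘ (ℤ.+ suc n) 0)))))))

  0≤ν : ∀ n → 0ℚ ≤ ν n
  0≤ν zero    = ≤-refl
  0≤ν (suc n) = subst (0ℚ ≤_) (sym (ν-suc n)) (0≤-+ 0≤1 (0≤ν n))

  ν-+ : ∀ m n → ν (m ℕ.+ n) ≡ ν m + ν n
  ν-+ zero    n = sym (+-identityˡ (ν n))
  ν-+ (suc m) n = begin
    ν (suc (m ℕ.+ n))    ≡⟨ ν-suc (m ℕ.+ n) ⟩
    1ℚ + ν (m ℕ.+ n)     ≡⟨ cong (1ℚ +_) (ν-+ m n) ⟩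
    1ℚ + (ν m + ν n)     ≡⟨ +-assoc 1ℚ (ν m) (ν n) ⟨
    1ℚ + ν m + ν n       ≡⟨ cong (_+ ν n) (ν-suc m) ⟨
    ν (suc m) + ν n      ∎
    where open ≡-Reasoning

  ν-* : ∀ m n → ν (m ℕ.* n) ≡ ν m * ν n
  ν-* zero    n = sym (*-zeroˡ (ν n))
  ν-* (suc m) n = begin
    ν (n ℕ.+ m ℕ.* n)    ≡⟨ ν-+ n (m ℕ.* n) ⟩
    ν n + ν (m ℕ.* n)    ≡⟨ cong (λ q → ν n + q) (ν-* m n) ⟩
    ν n + ν m * ν n      ≡⟨ solve 2 (λ a b → b :+ a :* b := (con 1ℚ :+ a) :* b) refl (ν m) (ν n) ⟩
    (1ℚ + ν m) * ν n     ≡⟨ cong (_* ν n) (ν-suc m) ⟨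
    ν (suc m) * ν n      ∎
    where open ≡-Reasoning

  ν-^ : ∀ m k → ν (m ℕ.^ k) ≡ ν m ^ k
  ν-^ m zero    = refl
  ν-^ m (suc k) = trans (ν-* m (m ℕ.^ k)) (cong (ν m *_) (ν-^ m k))

  ν-mono : ∀ {m n} → m ℕ.≤ n → ν m ≤ ν n
  ν-mono {m} {n} m≤n = subst (λ k → ν m ≤ ν k) (ℕ.m+[n∸m]≡n m≤n)
    (subst (ν m ≤_) (sym (ν-+ m (n ℕ.∸ m))) (p≤p+q (0≤ν (n ℕ.∸ m))))

  ≤ν : ∀ q → ∃ λ m → q ≤ ν m
  ≤ν q@(mkℚ (ℤ.+ a) d _) = a , toℚᵘ-cancel-≤
    (ℚᵘ.≤-respʳ-≃ (ℚᵘ.≃-sym (toℚᵘ-fromℚᵘ (mkℚᵘ (ℤ.+ a) 0)))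
      (*≤* (ℤ.*-monoˡ-≤-nonNeg (ℤ.+ a) (ℤ.+≤+ (ℕ.s≤s ℕ.z≤n)))))
  ≤ν q@(mkℚ (ℤ.-[1+ a ]) d _) = 0 , <⇒≤ (negative⁻¹ q)

  ν*1/ : ∀ n .{{_ : ℕ.NonZero n}} → ν n * (ℤ.+ 1 / n) ≡ 1ℚ
  ν*1/ (suc n) = toℚᵘ-injective
    (ℚᵘ.≃-trans (toℚᵘ-homo-* (ν (suc n)) (ℤ.+ 1 / suc n))
    (ℚᵘ.≃-trans (ℚᵘ.*-cong (toℚᵘ-fromℚᵘ (mkℚᵘ (ℤ.+ suc n) 0)) (toℚᵘ-fromℚᵘ (mkℚᵘ (ℤ.+ 1) n)))
      (*≡* (cong ℤ.+_ (trans (ℕ.*-identityʳ (suc n ℕ.* 1)) (trans (ℕ.*-identityʳ (suc n))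
        (sym (trans (ℕ.*-identityˡ (1 ℕ.* suc n)) (ℕ.*-identityˡ (suc n))))))))))

  0≤1/ : ∀ n .{{_ : ℕ.NonZero n}} → 0ℚ ≤ ℤ.+ 1 / n
  0≤1/ n = nonNegative⁻¹ (ℤ.+ 1 / n) {{normalize-nonNeg 1 n}}

  bernoulli : ∀ {x} k → 0ℚ ≤ x → x ≤ 1ℚ → 1ℚ - ν k * x ≤ (1ℚ - x) ^ k
  bernoulli {x} zero    0≤x x≤1 = ≤-reflexive (solve 1 (λ x → con 1ℚ :- con 0ℚ :* x := con 1ℚ) refl x)
  bernoulli {x} (suc k) 0≤x x≤1 = begin
    1ℚ - ν (suc k) * x            ≡⟨ cong (λ q → 1ℚ - q * x) (ν-suc k) ⟩
    1ℚ - (1ℚ + ν k) * x           ≤⟨ ≤-diff (solve 2 (λ k x → (con 1ℚ :- x) :* (con 1ℚ :- k :* x) :- (con 1ℚ :- (con 1ℚ :+ k) :* x)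
                                       := k :* (x :* x)) refl (ν k) x) (0≤-* (0≤ν k) (0≤-* 0≤x 0≤x)) ⟩
    (1ℚ - x) * (1ℚ - ν k * x)     ≤⟨ *-monoˡ-≤ (≤⇒0≤- x≤1) (bernoulli k 0≤x x≤1) ⟩
    (1ℚ - x) * (1ℚ - x) ^ k       ∎
    where open ≤-Reasoning

  -- With t = 3^k ≥ 1 and x ≤ 1, the coefficient of x in (1 + x)(1 + t x) is 1 + t + t x ≤ 3 t, so
  -- each further factor at most triples the constant.
  1+x^≤ : ∀ {x} k → 0ℚ ≤ x → x ≤ 1ℚ → (1ℚ + x) ^ k ≤ 1ℚ + ν 3 ^ k * x
  1+x^≤ {x} zero    0≤x x≤1 = ≤-diff (solve 1 (λ x → con 1ℚ :+ con 1ℚ :* x :- con 1ℚ := x) refl x) 0≤x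
  1+x^≤ {x} (suc k) 0≤x x≤1 = begin
    (1ℚ + x) * (1ℚ + x) ^ k         ≤⟨ *-monoˡ-≤ (0≤-+ 0≤1 0≤x) (1+x^≤ k 0≤x x≤1) ⟩
    (1ℚ + x) * (1ℚ + t * x)         ≤⟨ ≤-diff (solve 2 (λ t x → con 1ℚ :+ con (ν 3) :* t :* x :- (con 1ℚ :+ x) :* (con 1ℚ :+ t :* x)
                                         := t :* x :* (con 1ℚ :- x) :+ (t :- con 1ℚ) :* x) refl t x)
                                       (0≤-+ (0≤-* (0≤-* 0≤t 0≤x) (≤⇒0≤- x≤1)) (0≤-* (≤⇒0≤- 1≤t) 0≤x)) ⟩
    1ℚ + ν 3 * t * x                ∎
    where
    open ≤-Reasoning
    t = ν 3 ^ k
    1≤t = 1≤-^ {ν 3} k (≤ᵇ⇒≤ _)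
    0≤t = ≤-trans 0≤1 1≤t

  -- Finite sums and sums over lists of vertices

  sum-const : ∀ n a → sum {n} (λ _ → a) ≡ ν n * a
  sum-const zero    a = sym (*-zeroˡ a)
  sum-const (suc n) a = trans (cong (a +_) (sum-const n a))
    (trans (solve 2 (λ a x → a :+ x :* a := (con 1ℚ :+ x) :* a) refl a (ν n))
      (cong (_* a) (sym (ν-suc n))))

  sum-mono : ∀ {n} {f g : Fin n → ℚ} → (∀ i → f i ≤ g i) → sum f ≤ sum g
  sum-mono {zero}  f≤g = ≤-refl
  sum-mono {suc n} f≤g = +-mono-≤ (f≤g zero) (sum-mono (f≤g ∘ suc))

  sum-nonNeg : ∀ {n} {f : Fin n → ℚ} → (∀ i → 0ℚ ≤ f i) → 0ℚ ≤ sum f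
  sum-nonNeg {zero}  0≤f = ≤-refl
  sum-nonNeg {suc n} 0≤f = 0≤-+ (0≤f zero) (sum-nonNeg (0≤f ∘ suc))

  sum-nonPos : ∀ {n} {f : Fin n → ℚ} → (∀ i → f i ≤ 0ℚ) → sum f ≤ 0ℚ
  sum-nonPos {zero}  f≤0 = ≤-refl
  sum-nonPos {suc n} f≤0 = +-mono-≤ (f≤0 zero) (sum-nonPos (f≤0 ∘ suc))

  term≤sum : ∀ {n} {f : Fin n → ℚ} → (∀ i → 0ℚ ≤ f i) → ∀ i → f i ≤ sum f
  term≤sum 0≤f zero    = p≤p+q (sum-nonNeg (0≤f ∘ suc))
  term≤sum 0≤f (suc i) = ≤-trans (term≤sum (0≤f ∘ suc) i) (p≤q+p (0≤f zero))

  sum-pos⇒term-pos : ∀ {n} (f : Fin n → ℚ) → 0ℚ < sum f → ∃ λ i → 0ℚ < f i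
  sum-pos⇒term-pos f 0<sum with Fin.any? (λ i → 0ℚ <? f i)
  ... | yes found = found
  ... | no  none  = contradiction 0<sum
    (λ 0<sum → <-irrefl refl (<-≤-trans 0<sum (sum-nonPos λ i → ≮⇒≥ λ 0<fi → none (i , 0<fi))))

  -- Terms may be negative, as they are for paths with several ears, so only the positive ones are
  -- required to coincide.
  sum≤1 : ∀ {n} (f : Fin n → ℚ) → (∀ i → f i ≤ 1ℚ) →
          (∀ i j → 0ℚ < f i → 0ℚ < f j → i ≡ j) → sum f ≤ 1ℚ
  sum≤1 {zero}  f f≤1 unique = 0≤1
  sum≤1 {suc n} f f≤1 unique with 0ℚ <? f zero
  ... | yes 0<f₀ = +-mono-≤ (f≤1 zero) (sum-nonPos λ i → ≮⇒≥ λ 0<fi → Fin.0≢1+n (unique zero (suc i) 0<f₀ 0<fi))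
  ... | no  f₀≤0 = +-mono-≤ (≮⇒≥ f₀≤0)
    (sum≤1 (f ∘ suc) (f≤1 ∘ suc) λ i j 0<fi 0<fj → Fin.suc-injective (unique (suc i) (suc j) 0<fi 0<fj))

  sum-⟦≟⟧ : ∀ {n} (x : Fin n) → sum (λ i → ⟦ x Fin.≟ i ⟧) ≡ 1ℚ
  sum-⟦≟⟧ {suc n} zero    = trans (cong (λ q → 1ℚ + q) (sum-replicate-zero n)) (+-identityʳ 1ℚ)
  sum-⟦≟⟧ {suc n} (suc x) = trans (+-identityˡ _) (sum-⟦≟⟧ x)

  -- Lists rather than vectors are the summation indices, because paths of different lengths have to
  -- be compared with each other.
  ∑* : ∀ {n} (k : ℕ) → (List (Fin n) → ℚ) → ℚ
  ∑* zero    f = f []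
  ∑* (suc k) f = sum λ x → ∑* k λ xs → f (x ∷ xs)

  ∑*-cong : ∀ {n} k {f g : List (Fin n) → ℚ} →
            (∀ xs → length xs ≡ k → f xs ≡ g xs) → ∑* k f ≡ ∑* k g
  ∑*-cong zero    f≡g = f≡g [] refl
  ∑*-cong (suc k) f≡g = sum-cong-≗ λ x → ∑*-cong k λ xs eq → f≡g (x ∷ xs) (cong suc eq)

  ∑*-mono : ∀ {n} k {f g : List (Fin n) → ℚ} →
            (∀ xs → length xs ≡ k → f xs ≤ g xs) → ∑* k f ≤ ∑* k g
  ∑*-mono zero    f≤g = f≤g [] refl
  ∑*-mono (suc k) f≤g = sum-mono λ x → ∑*-mono k λ xs eq → f≤g (x ∷ xs) (cong suc eq)

  ∑*-const : ∀ n k a → ∑* {n} k (λ _ → a) ≡ ν n ^ k * a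
  ∑*-const n zero    a = sym (*-identityˡ a)
  ∑*-const n (suc k) a = trans (sum-cong-≗ λ (_ : Fin n) → ∑*-const n k a)
    (trans (sum-const n (ν n ^ k * a)) (sym (*-assoc (ν n) (ν n ^ k) a)))

  ∑*-nonNeg : ∀ {n} k {f : List (Fin n) → ℚ} → (∀ xs → 0ℚ ≤ f xs) → 0ℚ ≤ ∑* k f
  ∑*-nonNeg zero    0≤f = 0≤f []
  ∑*-nonNeg (suc k) 0≤f = sum-nonNeg λ x → ∑*-nonNeg k λ xs → 0≤f (x ∷ xs)

  *-distribˡ-∑* : ∀ {n} k a (f : List (Fin n) → ℚ) → a * ∑* k f ≡ ∑* k (λ xs → a * f xs)
  *-distribˡ-∑* zero    a f = refl
  *-distribˡ-∑* (suc k) a f =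
    trans (*-distribˡ-sum a (λ x → ∑* k λ xs → f (x ∷ xs))) (sum-cong-≗ λ x → *-distribˡ-∑* k a λ xs → f (x ∷ xs))

  *-distribʳ-∑* : ∀ {n} k a (f : List (Fin n) → ℚ) → ∑* k f * a ≡ ∑* k (λ xs → f xs * a)
  *-distribʳ-∑* k a f = trans (*-comm (∑* k f) a)
    (trans (*-distribˡ-∑* k a f) (∑*-cong k λ xs _ → *-comm a (f xs)))

  sum-∑*-comm : ∀ {m n} k (f : Fin m → List (Fin n) → ℚ) →
                sum (λ i → ∑* k (f i)) ≡ ∑* k (λ xs → sum λ i → f i xs)
  sum-∑*-comm zero    f = refl
  sum-∑*-comm (suc k) f = trans (∑-comm λ i x → ∑* k λ xs → f i (x ∷ xs))
    (sum-cong-≗ λ x → sum-∑*-comm k λ i xs → f i (x ∷ xs))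

  term≤∑* : ∀ {n} {f : List (Fin n) → ℚ} → (∀ xs → 0ℚ ≤ f xs) →
            ∀ xs → f xs ≤ ∑* (length xs) f
  term≤∑* 0≤f []       = ≤-refl
  term≤∑* 0≤f (x ∷ xs) = ≤-trans (term≤∑* (λ ys → 0≤f (x ∷ ys)) xs)
    (term≤sum (λ y → ∑*-nonNeg (length xs) λ ys → 0≤f (y ∷ ys)) x)

  ∑*-pos⇒term-pos : ∀ {n} k (f : List (Fin n) → ℚ) → 0ℚ < ∑* k f →
                    ∃ λ xs → length xs ≡ k × 0ℚ < f xs
  ∑*-pos⇒term-pos zero    f 0<f = [] , refl , 0<f
  ∑*-pos⇒term-pos (suc k) f 0<f =
    let x  , 0<fx       = sum-pos⇒term-pos (λ x → ∑* k λ xs → f (x ∷ xs)) 0<f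
        xs , eq , 0<fxs = ∑*-pos⇒term-pos k (λ xs → f (x ∷ xs)) 0<fx
    in x ∷ xs , cong suc eq , 0<fxs

  ∑*≤1 : ∀ {n} k (f : List (Fin n) → ℚ) → (∀ xs → f xs ≤ 1ℚ) →
         (∀ xs ys → length xs ≡ k → length ys ≡ k → 0ℚ < f xs → 0ℚ < f ys → xs ≡ ys) →
         ∑* k f ≤ 1ℚ
  ∑*≤1 zero    f f≤1 unique = f≤1 []
  ∑*≤1 (suc k) f f≤1 unique = sum≤1 (λ x → ∑* k λ xs → f (x ∷ xs))
    (λ x → ∑*≤1 k (λ xs → f (x ∷ xs)) (λ xs → f≤1 (x ∷ xs))
      λ xs ys eq eq′ p q → List.∷-injectiveʳ (unique (x ∷ xs) (x ∷ ys) (cong suc eq) (cong suc eq′) p q))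
    λ x y 0<fx 0<fy →
      let xs , eq  , p = ∑*-pos⇒term-pos k (λ xs → f (x ∷ xs)) 0<fx
          ys , eq′ , q = ∑*-pos⇒term-pos k (λ ys → f (y ∷ ys)) 0<fy
      in List.∷-injectiveˡ (unique (x ∷ xs) (y ∷ ys) (cong suc eq) (cong suc eq′) p q)

  -- Expectations over random graphs

  Erow : ∀ {n} → (Fin n → ℚ) → (Vec Bool n → ℚ) → ℚ
  Erow {zero}  w X = X []
  Erow {suc n} w X = w zero * Erow (w ∘ suc) (λ r → X (true ∷ r))
                   + (1ℚ - w zero) * Erow (w ∘ suc) (λ r → X (false ∷ r))

  Weights : ℕ → Set
  Weights n = Fin n → Fin n → ℚ

  firstRow : ∀ {n} → Weights (suc n) → Fin n → ℚ
  firstRow w v = w zero (suc v)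

  minor : ∀ {n} → Weights (suc n) → Weights n
  minor w u v = w (suc u) (suc v)

  -- The expectation is integrated out one edge at a time, so that linearity, monotonicity and
  -- independence follow by recursion on the graph. `∑ˡ-graphs` identifies it with the weighted sum
  -- over all graphs.
  E : ∀ {n} → Weights n → (Graph n → ℚ) → ℚ
  E {zero}  w X = X []
  E {suc n} w X = Erow (firstRow w) λ r → E (minor w) λ g → X (r ∷ g)

  Erow-cong : ∀ {n} (w : Fin n → ℚ) {X Y : Vec Bool n → ℚ} →
              (∀ r → X r ≡ Y r) → Erow w X ≡ Erow w Y
  Erow-cong {zero}  w X≡Y = X≡Y []
  Erow-cong {suc n} w X≡Y = cong₂ _+_
    (cong (w zero *_) (Erow-cong (w ∘ suc) λ r → X≡Y (true ∷ r)))
    (cong ((1ℚ - w zero) *_) (Erow-cong (w ∘ suc) λ r → X≡Y (false ∷ r)))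

  E-cong : ∀ {n} (w : Weights n) {X Y : Graph n → ℚ} → (∀ G → X G ≡ Y G) → E w X ≡ E w Y
  E-cong {zero}  w X≡Y = X≡Y []
  E-cong {suc n} w X≡Y = Erow-cong (firstRow w) λ r → E-cong (minor w) λ g → X≡Y (r ∷ g)

  Erow-cong-weights : ∀ {n} {w w′ : Fin n → ℚ} (X : Vec Bool n → ℚ) →
                      (∀ v → w v ≡ w′ v) → Erow w X ≡ Erow w′ X
  Erow-cong-weights {zero}  X w≡w′ = refl
  Erow-cong-weights {suc n} X w≡w′ = cong₂ _+_
    (cong₂ _*_ (w≡w′ zero) (Erow-cong-weights (λ r → X (true ∷ r)) (w≡w′ ∘ suc)))
    (cong₂ (λ p q → (1ℚ - p) * q) (w≡w′ zero) (Erow-cong-weights (λ r → X (false ∷ r)) (w≡w′ ∘ suc)))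

  E-cong-weights : ∀ {n} {w w′ : Weights n} (X : Graph n → ℚ) →
                   (∀ u v → w u v ≡ w′ u v) → E w X ≡ E w′ X
  E-cong-weights {zero}  X w≡w′ = refl
  E-cong-weights {suc n} {w} {w′} X w≡w′ = trans
    (Erow-cong (firstRow w) λ r → E-cong-weights (λ g → X (r ∷ g)) λ u v → w≡w′ (suc u) (suc v))
    (Erow-cong-weights (λ r → E (minor w′) λ g → X (r ∷ g)) λ v → w≡w′ zero (suc v))

  Erow-mono : ∀ {n} (w : Fin n → ℚ) {X Y : Vec Bool n → ℚ} →
              (∀ v → 0ℚ ≤ w v × w v ≤ 1ℚ) → (∀ r → X r ≤ Y r) → Erow w X ≤ Erow w Y
  Erow-mono {zero}  w w∈[0,1] X≤Y = X≤Y []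
  Erow-mono {suc n} w w∈[0,1] X≤Y = +-mono-≤
    (*-monoˡ-≤ (proj₁ (w∈[0,1] zero)) (Erow-mono (w ∘ suc) (w∈[0,1] ∘ suc) λ r → X≤Y (true ∷ r)))
    (*-monoˡ-≤ (≤⇒0≤- (proj₂ (w∈[0,1] zero))) (Erow-mono (w ∘ suc) (w∈[0,1] ∘ suc) λ r → X≤Y (false ∷ r)))

  E-mono : ∀ {n} (w : Weights n) {X Y : Graph n → ℚ} →
           (∀ u v → 0ℚ ≤ w u v × w u v ≤ 1ℚ) → (∀ G → X G ≤ Y G) → E w X ≤ E w Y
  E-mono {zero}  w w∈[0,1] X≤Y = X≤Y []
  E-mono {suc n} w w∈[0,1] X≤Y = Erow-mono (firstRow w) (λ v → w∈[0,1] zero (suc v))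
    λ r → E-mono (minor w) (λ u v → w∈[0,1] (suc u) (suc v)) λ g → X≤Y (r ∷ g)

  Erow-+ : ∀ {n} (w : Fin n → ℚ) (X Y : Vec Bool n → ℚ) →
           Erow w (λ r → X r + Y r) ≡ Erow w X + Erow w Y
  Erow-+ {zero}  w X Y = refl
  Erow-+ {suc n} w X Y = trans
    (cong₂ (λ p q → w zero * p + (1ℚ - w zero) * q)
      (Erow-+ (w ∘ suc) (λ r → X (true ∷ r)) λ r → Y (true ∷ r))
      (Erow-+ (w ∘ suc) (λ r → X (false ∷ r)) λ r → Y (false ∷ r)))
    (solve 6 (λ p q a b c d → p :* (a :+ b) :+ q :* (c :+ d) := (p :* a :+ q :* c) :+ (p :* b :+ q :* d))
      refl (w zero) (1ℚ - w zero) _ _ _ _)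

  E-+ : ∀ {n} (w : Weights n) (X Y : Graph n → ℚ) → E w (λ G → X G + Y G) ≡ E w X + E w Y
  E-+ {zero}  w X Y = refl
  E-+ {suc n} w X Y = trans
    (Erow-cong (firstRow w) λ r → E-+ (minor w) (λ g → X (r ∷ g)) λ g → Y (r ∷ g))
    (Erow-+ (firstRow w) (λ r → E (minor w) λ g → X (r ∷ g)) λ r → E (minor w) λ g → Y (r ∷ g))

  Erow-* : ∀ {n} (w : Fin n → ℚ) a (X : Vec Bool n → ℚ) → Erow w (λ r → a * X r) ≡ a * Erow w X
  Erow-* {zero}  w a X = refl
  Erow-* {suc n} w a X = trans
    (cong₂ (λ p q → w zero * p + (1ℚ - w zero) * q)
      (Erow-* (w ∘ suc) a λ r → X (true ∷ r)) (Erow-* (w ∘ suc) a λ r → X (false ∷ r)))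
    (solve 5 (λ a p q x y → p :* (a :* x) :+ q :* (a :* y) := a :* (p :* x :+ q :* y))
      refl a (w zero) (1ℚ - w zero) _ _)

  E-* : ∀ {n} (w : Weights n) a (X : Graph n → ℚ) → E w (λ G → a * X G) ≡ a * E w X
  E-* {zero}  w a X = refl
  E-* {suc n} w a X = trans
    (Erow-cong (firstRow w) λ r → E-* (minor w) a λ g → X (r ∷ g))
    (Erow-* (firstRow w) a λ r → E (minor w) λ g → X (r ∷ g))

  Erow-const : ∀ {n} (w : Fin n → ℚ) a → Erow w (λ _ → a) ≡ a
  Erow-const {zero}  w a = refl
  Erow-const {suc n} w a = trans
    (cong (λ x → w zero * x + (1ℚ - w zero) * x) (Erow-const (w ∘ suc) a))
    (solve 2 (λ p a → p :* a :+ (con 1ℚ :- p) :* a := a) refl (w zero) a)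

  E-const : ∀ {n} (w : Weights n) a → E w (λ _ → a) ≡ a
  E-const {zero}  w a = refl
  E-const {suc n} w a = trans (Erow-cong (firstRow w) λ _ → E-const (minor w) a) (Erow-const (firstRow w) a)

  E-sum : ∀ {n m} (w : Weights n) (X : Fin m → Graph n → ℚ) →
          E w (λ G → sum λ i → X i G) ≡ sum λ i → E w (X i)
  E-sum {m = zero}  w X = E-const w 0ℚ
  E-sum {m = suc m} w X = trans (E-+ w (X zero) λ G → sum λ i → X (suc i) G)
    (cong (E w (X zero) +_) (E-sum w (X ∘ suc)))

  E-∑* : ∀ {n m} (w : Weights n) k (X : List (Fin m) → Graph n → ℚ) →
         E w (λ G → ∑* k λ xs → X xs G) ≡ ∑* k λ xs → E w (X xs)
  E-∑* w zero    X = refl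
  E-∑* w (suc k) X = trans (E-sum w λ x G → ∑* k λ xs → X (x ∷ xs) G)
    (sum-cong-≗ λ x → E-∑* w k λ xs → X (x ∷ xs))

  E-- : ∀ {n} (w : Weights n) (X Y : Graph n → ℚ) → E w (λ G → X G - Y G) ≡ E w X - E w Y
  E-- w X Y = trans (E-cong w λ G → cong (X G +_) (-1* (Y G)))
    (trans (E-+ w X λ G → (- 1ℚ) * Y G)
      (cong (E w X +_) (trans (E-* w (- 1ℚ) Y) (sym (-1* (E w Y))))))
    where
    -1* : ∀ q → - q ≡ (- 1ℚ) * q
    -1* = solve 1 (λ q → :- q := (:- con 1ℚ) :* q) refl

  -- Agreement with the sum over all graphs

  ∑ˡ : ∀ {A : Set} → (A → ℚ) → List A → ℚ
  ∑ˡ f xs = List.foldr _+_ 0ℚ (List.map f xs)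

  ∑ˡ-cong : ∀ {A : Set} {f g : A → ℚ} → (∀ x → f x ≡ g x) → ∀ xs → ∑ˡ f xs ≡ ∑ˡ g xs
  ∑ˡ-cong f≡g []       = refl
  ∑ˡ-cong f≡g (x ∷ xs) = cong₂ _+_ (f≡g x) (∑ˡ-cong f≡g xs)

  ∑ˡ-++ : ∀ {A : Set} (f : A → ℚ) xs ys → ∑ˡ f (xs ++ ys) ≡ ∑ˡ f xs + ∑ˡ f ys
  ∑ˡ-++ f []       ys = sym (+-identityˡ _)
  ∑ˡ-++ f (x ∷ xs) ys = trans (cong (f x +_) (∑ˡ-++ f xs ys)) (sym (+-assoc (f x) _ _))

  ∑ˡ-map : ∀ {A B : Set} (f : B → ℚ) (g : A → B) xs → ∑ˡ f (List.map g xs) ≡ ∑ˡ (f ∘ g) xs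
  ∑ˡ-map f g []       = refl
  ∑ˡ-map f g (x ∷ xs) = cong (f (g x) +_) (∑ˡ-map f g xs)

  *-distribˡ-∑ˡ : ∀ {A : Set} a (f : A → ℚ) xs → ∑ˡ (λ x → a * f x) xs ≡ a * ∑ˡ f xs
  *-distribˡ-∑ˡ a f []       = sym (*-zeroʳ a)
  *-distribˡ-∑ˡ a f (x ∷ xs) = trans (cong (a * f x +_) (*-distribˡ-∑ˡ a f xs)) (sym (*-distribˡ-+ a _ _))

  ∑ˡ-cartesianProductWith : ∀ {A B C : Set} (f : C → ℚ) (_∙_ : A → B → C) xs ys →
    ∑ˡ f (List.cartesianProductWith _∙_ xs ys) ≡ ∑ˡ (λ x → ∑ˡ (λ y → f (x ∙ y)) ys) xs
  ∑ˡ-cartesianProductWith f _∙_ []       ys = refl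
  ∑ˡ-cartesianProductWith f _∙_ (x ∷ xs) ys =
    trans (∑ˡ-++ f (List.map (x ∙_) ys) (List.cartesianProductWith _∙_ xs ys))
      (cong₂ _+_ (∑ˡ-map f (x ∙_) ys) (∑ˡ-cartesianProductWith f _∙_ xs ys))

  rowProbability : ∀ {n} → (Fin n → ℚ) → Vec Bool n → ℚ
  rowProbability w []      = 1ℚ
  rowProbability w (b ∷ r) = (if b then w zero else 1ℚ - w zero) * rowProbability (w ∘ suc) r

  ∑ˡ-bitVecs : ∀ {n} (w : Fin n → ℚ) (X : Vec Bool n → ℚ) →
               ∑ˡ (λ r → rowProbability w r * X r) (bitVecs n) ≡ Erow w X
  ∑ˡ-bitVecs {zero}  w X = trans (+-identityʳ _) (*-identityˡ (X []))
  ∑ˡ-bitVecs {suc n} w X = trans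
    (∑ˡ-cartesianProductWith (λ r → rowProbability w r * X r) _∷_ (true ∷ false ∷ []) (bitVecs n))
    (cong₂ _+_ (part true) (trans (+-identityʳ _) (part false)))
    where
    part : ∀ b → ∑ˡ (λ r → rowProbability w (b ∷ r) * X (b ∷ r)) (bitVecs n)
               ≡ (if b then w zero else 1ℚ - w zero) * Erow (w ∘ suc) (λ r → X (b ∷ r))
    part b = trans (∑ˡ-cong (λ r → *-assoc q (rowProbability (w ∘ suc) r) (X (b ∷ r))) (bitVecs n))
      (trans (*-distribˡ-∑ˡ q (λ r → rowProbability (w ∘ suc) r * X (b ∷ r)) (bitVecs n))
        (cong (q *_) (∑ˡ-bitVecs (w ∘ suc) λ r → X (b ∷ r))))
      where q = if b then w zero else 1ℚ - w zero

  graphProbability : ∀ {n} → Weights n → Graph n → ℚ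
  graphProbability w []      = 1ℚ
  graphProbability w (r ∷ g) =
    rowProbability (firstRow w) r * graphProbability (minor w) g

  ∑ˡ-graphs : ∀ {n} (w : Weights n) (X : Graph n → ℚ) →
              ∑ˡ (λ G → graphProbability w G * X G) (graphs n) ≡ E w X
  ∑ˡ-graphs {zero}  w X = trans (+-identityʳ _) (*-identityˡ (X []))
  ∑ˡ-graphs {suc n} w X = trans
    (∑ˡ-cartesianProductWith (λ G → graphProbability w G * X G) _∷_ (bitVecs n) (graphs n))
    (trans (∑ˡ-cong part (bitVecs n)) (∑ˡ-bitVecs (firstRow w) λ r → E (minor w) λ g → X (r ∷ g)))
    where
    part : ∀ r → ∑ˡ (λ g → graphProbability w (r ∷ g) * X (r ∷ g)) (graphs n)
               ≡ rowProbability (firstRow w) r * E (minor w) (λ g → X (r ∷ g))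
    part r = trans (∑ˡ-cong (λ g → *-assoc (rowProbability (firstRow w) r) (graphProbability (minor w) g) (X (r ∷ g))) (graphs n))
      (trans (*-distribˡ-∑ˡ (rowProbability (firstRow w) r) (λ g → graphProbability (minor w) g * X (r ∷ g)) (graphs n))
        (cong (rowProbability (firstRow w) r *_) (∑ˡ-graphs (minor w) λ g → X (r ∷ g))))

  seq-∏ : ∀ {n} k (w : Fin n → ℝ) (r : Vec Bool n) →
          seq (∏ λ v → if Vec.lookup r v then w v else Defs.1ℝ Defs.- w v) k
          ≡ rowProbability (λ v → seq (w v) k) r
  seq-∏ k w []          = refl
  seq-∏ k w (true  ∷ r) = cong (seq (w zero) k *_) (seq-∏ k (w ∘ suc) r)
  seq-∏ k w (false ∷ r) = cong ((1ℚ - seq (w zero) k) *_) (seq-∏ k (w ∘ suc) r)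

  seq-probability : ∀ {n} k (w : EdgeProbabilities n) G →
                    seq (probability w G) k ≡ graphProbability (λ u v → seq (w u v) k) G
  seq-probability k w []      = refl
  seq-probability k w (r ∷ g) = cong₂ _*_ (seq-∏ k (λ v → w zero (suc v)) r)
    (seq-probability k (λ u v → w (suc u) (suc v)) g)

  seq-∑ : ∀ {A : Set} k (f : A → ℝ) xs →
          seq (List.foldr Defs._+_ Defs.0ℝ (List.map f xs)) k ≡ ∑ˡ (λ x → seq (f x) k) xs
  seq-∑ k f []       = refl
  seq-∑ k f (x ∷ xs) = cong (seq (f x) k +_) (seq-∑ k f xs)

  seq-𝔼 : ∀ {n} k (w : EdgeProbabilities n) (X : Graph n → ℝ) →
          seq (𝔼 w X) k ≡ E (λ u v → seq (w u v) k) (λ G → seq (X G) k)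
  seq-𝔼 {n} k w X = trans (seq-∑ k (λ G → probability w G Defs.* X G) (graphs n))
    (trans (∑ˡ-cong (λ G → cong (_* seq (X G) k) (seq-probability k w G)) (graphs n))
      (∑ˡ-graphs (λ u v → seq (w u v) k) λ G → seq (X G) k))

  -- Independence of distinct edges

  Edge : ℕ → Set
  Edge n = Fin n × Fin n

  SameEdge : ∀ {n} → Edge n → Edge n → Set
  SameEdge (a , b) (u , v) = (a ≡ u × b ≡ v) ⊎ (a ≡ v × b ≡ u)

  sameEdge? : ∀ {n} (e f : Edge n) → Dec (SameEdge e f)
  sameEdge? (a , b) (u , v) = (a Fin.≟ u ×-dec b Fin.≟ v) ⊎-dec (a Fin.≟ v ×-dec b Fin.≟ u)

  SameEdge-sym : ∀ {n} {e f : Edge n} → SameEdge e f → SameEdge f e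
  SameEdge-sym (inj₁ (refl , refl)) = inj₁ (refl , refl)
  SameEdge-sym (inj₂ (refl , refl)) = inj₂ (refl , refl)

  -- A pointwise substitute for independence of `X` and the edge `e`; `E-edge` turns it into a
  -- product of expectations.
  Ignores : ∀ {n} → Edge n → (Graph n → ℚ) → Set
  Ignores e X = ∀ G G′ →
    (∀ a b → ¬ SameEdge (a , b) e → adjacent G a b ≡ adjacent G′ a b) → X G ≡ X G′

  -- At the bit `v` itself both branches of `X` have the same expectation, so discarding the branch
  -- where the bit is false leaves just the factor `w v`. All other bits pass through by linearity.
  Erow-bit : ∀ {n} (w : Fin n → ℚ) v (X : Vec Bool n → ℚ) →
    (∀ r r′ → (∀ i → i ≢ v → Vec.lookup r i ≡ Vec.lookup r′ i) → X r ≡ X r′) →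
    Erow w (λ r → 𝟙 (Vec.lookup r v) * X r) ≡ w v * Erow w X
  Erow-bit {suc n} w zero X ignores = begin
    w zero * Erow (w ∘ suc) (λ r → 1ℚ * X (true ∷ r)) + (1ℚ - w zero) * Erow (w ∘ suc) (λ r → 0ℚ * X (false ∷ r))
      ≡⟨ cong₂ (λ p q → w zero * p + (1ℚ - w zero) * q)
           (Erow-* (w ∘ suc) 1ℚ λ r → X (true ∷ r)) (Erow-* (w ∘ suc) 0ℚ λ r → X (false ∷ r)) ⟩
    w zero * (1ℚ * A) + (1ℚ - w zero) * (0ℚ * B)
      ≡⟨ solve 3 (λ p a b → p :* (con 1ℚ :* a) :+ (con 1ℚ :- p) :* (con 0ℚ :* b)
           := p :* (p :* a :+ (con 1ℚ :- p) :* a)) refl (w zero) A B ⟩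
    w zero * (w zero * A + (1ℚ - w zero) * A)
      ≡⟨ cong (λ q → w zero * (w zero * A + (1ℚ - w zero) * q)) A≡B ⟩
    w zero * (w zero * A + (1ℚ - w zero) * B) ∎
    where
    open ≡-Reasoning
    A = Erow (w ∘ suc) λ r → X (true ∷ r)
    B = Erow (w ∘ suc) λ r → X (false ∷ r)
    A≡B : A ≡ B
    A≡B = Erow-cong (w ∘ suc) λ r → ignores (true ∷ r) (false ∷ r)
      λ { zero 0≢0 → contradiction refl 0≢0 ; (suc i) _ → refl }
  Erow-bit {suc n} w (suc v) X ignores = trans
    (cong₂ (λ p q → w zero * p + (1ℚ - w zero) * q) (part true) (part false))
    (solve 5 (λ p q a x y → p :* (a :* x) :+ q :* (a :* y) := a :* (p :* x :+ q :* y)) refl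
      (w zero) (1ℚ - w zero) (w (suc v)) (Erow (w ∘ suc) λ r → X (true ∷ r)) (Erow (w ∘ suc) λ r → X (false ∷ r)))
    where
    part : ∀ b → Erow (w ∘ suc) (λ r → 𝟙 (Vec.lookup r v) * X (b ∷ r))
               ≡ w (suc v) * Erow (w ∘ suc) (λ r → X (b ∷ r))
    part b = Erow-bit (w ∘ suc) v (λ r → X (b ∷ r)) λ r r′ agree →
      ignores (b ∷ r) (b ∷ r′) λ { zero _ → refl ; (suc i) i≢v → agree i (i≢v ∘ cong suc) }

  Symmetric : ∀ {n} → Weights n → Set
  Symmetric w = ∀ u v → w u v ≡ w v u

  E-firstRow : ∀ {n} (w : Weights (suc n)) v (X : Graph (suc n) → ℚ) → Ignores (zero , suc v) X →
    E w (λ G → 𝟙 (adjacent G zero (suc v)) * X G) ≡ w zero (suc v) * E w X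
  E-firstRow {n} w v X ignores = trans
    (Erow-cong (firstRow w) λ r → E-* (minor w) (𝟙 (Vec.lookup r v)) λ g → X (r ∷ g))
    (Erow-bit (firstRow w) v (λ r → E (minor w) λ g → X (r ∷ g)) λ r r′ agree →
      E-cong (minor w) λ g → ignores (r ∷ g) (r′ ∷ g) (agree′ r r′ g agree))
    where
    agree′ : ∀ r r′ (g : Graph n) → (∀ i → i ≢ v → Vec.lookup r i ≡ Vec.lookup r′ i) →
      ∀ a b → ¬ SameEdge (a , b) (zero , suc v) → adjacent (r ∷ g) a b ≡ adjacent (r′ ∷ g) a b
    agree′ r r′ g agree zero    zero    _ = refl
    agree′ r r′ g agree zero    (suc b) ≠ = agree b λ { refl → ≠ (inj₁ (refl , refl)) }
    agree′ r r′ g agree (suc a) zero    ≠ = agree a λ { refl → ≠ (inj₂ (refl , refl)) }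
    agree′ r r′ g agree (suc a) (suc b) _ = refl

  -- A graph stores each edge once, in the row of its smaller end. Symmetry of the weights pays for
  -- reading the pair in the other order.
  E-edge : ∀ {n} (w : Weights n) → Symmetric w → ∀ u v (X : Graph n → ℚ) → u ≢ v → Ignores (u , v) X →
    E w (λ G → 𝟙 (adjacent G u v) * X G) ≡ w u v * E w X
  E-edge w w-sym zero    zero    X u≢v ignores = contradiction refl u≢v
  E-edge w w-sym zero    (suc v) X u≢v ignores = E-firstRow w v X ignores
  E-edge w w-sym (suc u) zero    X u≢v ignores = trans
    (E-firstRow w u X λ G G′ agree → ignores G G′ λ a b ≠ → agree a b (≠ ∘ swap))
    (cong (_* E w X) (w-sym zero (suc u)))
  E-edge w w-sym (suc u) (suc v) X u≢v ignores = trans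
    (Erow-cong (firstRow w) λ r →
      E-edge (minor w) (λ a b → w-sym (suc a) (suc b)) u v (λ g → X (r ∷ g)) (u≢v ∘ cong suc)
        λ g g′ agree → ignores (r ∷ g) (r ∷ g′) λ
          { zero    zero    _ → refl
          ; zero    (suc b) _ → refl
          ; (suc a) zero    _ → refl
          ; (suc a) (suc b) ≠ → agree a b λ
              { (inj₁ (refl , refl)) → ≠ (inj₁ (refl , refl))
              ; (inj₂ (refl , refl)) → ≠ (inj₂ (refl , refl)) } })
    (Erow-* (firstRow w) (w (suc u) (suc v)) λ r → E (minor w) λ g → X (r ∷ g))

  present : ∀ {n} → List (Edge n) → Graph n → ℚ
  present []            G = 1ℚ
  present ((u , v) ∷ L) G = 𝟙 (adjacent G u v) * present L G

  weight : ∀ {n} → Weights n → List (Edge n) → ℚ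
  weight w []            = 1ℚ
  weight w ((u , v) ∷ L) = w u v * weight w L

  NonLoop : ∀ {n} → Edge n → Set
  NonLoop (u , v) = u ≢ v

  -- Loops are excluded because they are never present, whereas the weights may be nonzero on the
  -- diagonal.
  Distinct : ∀ {n} → List (Edge n) → Set
  Distinct L = All NonLoop L × AllPairs (λ e f → ¬ SameEdge e f) L

  distinct? : ∀ {n} (L : List (Edge n)) → Dec (Distinct L)
  distinct? L = All.all? (λ { (u , v) → ¬? (u Fin.≟ v) }) L ×-dec allPairs? (λ e f → ¬? (sameEdge? e f)) L

  present-ignores : ∀ {n} {e : Edge n} L → All (λ f → ¬ SameEdge e f) L → Ignores e (present L)
  present-ignores []            []        G G′ agree = refl
  present-ignores {e = e} ((u , v) ∷ L) (≠ ∷ ≠s) G G′ agree =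
    cong₂ (λ b p → 𝟙 b * p) (agree u v (≠ ∘ SameEdge-sym {e = u , v} {e})) (present-ignores L ≠s G G′ agree)

  E-present : ∀ {n} (w : Weights n) → Symmetric w → ∀ L → Distinct L → E w (present L) ≡ weight w L
  E-present w w-sym []            _ = E-const w 1ℚ
  E-present w w-sym ((u , v) ∷ L) (u≢v ∷ nonLoop , ≠s ∷ distinct) = trans
    (E-edge w w-sym u v (present L) u≢v (present-ignores L ≠s))
    (cong (w u v *_) (E-present w w-sym L (nonLoop , distinct)))

  present-++ : ∀ {n} (L M : List (Edge n)) G → present (L ++ M) G ≡ present L G * present M G
  present-++ []            M G = sym (*-identityˡ _)
  present-++ ((u , v) ∷ L) M G = trans (cong (𝟙 (adjacent G u v) *_) (present-++ L M G))
    (sym (*-assoc (𝟙 (adjacent G u v)) (present L G) (present M G)))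

  weight-++ : ∀ {n} (w : Weights n) (L M : List (Edge n)) → weight w (L ++ M) ≡ weight w L * weight w M
  weight-++ w []            M = sym (*-identityˡ _)
  weight-++ w ((u , v) ∷ L) M = trans (cong (w u v *_) (weight-++ w L M))
    (sym (*-assoc (w u v) (weight w L) (weight w M)))

  0≤present : ∀ {n} (L : List (Edge n)) G → 0ℚ ≤ present L G
  0≤present []            G = 0≤1
  0≤present ((u , v) ∷ L) G = 0≤-* (0≤𝟙 (adjacent G u v)) (0≤present L G)

  0≤weight : ∀ {n} {w : Weights n} → (∀ u v → 0ℚ ≤ w u v) → ∀ L → 0ℚ ≤ weight w L
  0≤weight 0≤w []            = 0≤1
  0≤weight 0≤w ((u , v) ∷ L) = 0≤-* (0≤w u v) (0≤weight 0≤w L)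

  -- Paths and ears

  module _ {n : ℕ} where

    private V = Fin n

    -- A path is kept as its first vertex together with the list of the later ones, so the length of
    -- the list is the length of the path.
    edges : V → List V → List (Edge n)
    edges x []       = []
    edges x (y ∷ ys) = (x , y) ∷ edges y ys

    endpoint : V → List V → V
    endpoint x []       = x
    endpoint x (y ∷ ys) = endpoint y ys

    endpoint∈ : ∀ x ys → endpoint x ys ∈ x ∷ ys
    endpoint∈ x []       = here refl
    endpoint∈ x (y ∷ ys) = there (endpoint∈ y ys)

    _#_ : Edge n → List (Edge n) → Set
    e # L = All (λ f → ¬ SameEdge e f) L

    avoid : ∀ {u x} xs {y} → All (u ≢_) (x ∷ xs) → (u , y) # edges x xs
    avoid []       _                   = []
    avoid (z ∷ xs) (u≢x ∷ u≢z ∷ u∉xs) =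
      (λ { (inj₁ (u≡x , _)) → u≢x u≡x ; (inj₂ (u≡z , _)) → u≢z u≡z }) ∷ avoid xs (u≢z ∷ u∉xs)

    #-flip : ∀ {u v} L → (u , v) # L → (v , u) # L
    #-flip L = All.map λ
      { ≠ (inj₁ (v≡a , u≡b)) → ≠ (inj₂ (u≡b , v≡a)) ; ≠ (inj₂ (v≡b , u≡a)) → ≠ (inj₁ (u≡a , v≡b)) }

    edges-distinct : ∀ x xs → Unique (x ∷ xs) → Distinct (edges x xs)
    edges-distinct x []       _                       = [] , []
    edges-distinct x (y ∷ xs) (x∉@(x≢y ∷ _) ∷ unique) =
      let nonLoop , distinct = edges-distinct y xs unique in
      x≢y ∷ nonLoop , avoid xs x∉ ∷ distinct

    distinct-prefix : ∀ (L M : List (Edge n)) → Distinct (L ++ M) → Distinct L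
    distinct-prefix []      M _                                   = [] , []
    distinct-prefix (e ∷ L) M (nonLoop ∷ nonLoops , ≠s ∷ distinct) =
      let nonLoop′ , distinct′ = distinct-prefix L M (nonLoops , distinct) in
      nonLoop ∷ nonLoop′ , All.++⁻ˡ L ≠s ∷ distinct′

    distinct-++ : ∀ L M → Distinct L → Distinct M → All (_# L) M → Distinct (L ++ M)
    distinct-++ L M (nonLoopL , distinctL) (nonLoopM , distinctM) M#L =
      All.++⁺ nonLoopL nonLoopM ,
      AllPairs.++⁺ distinctL distinctM (All.tabulate λ {e} e∈L →
        All.map (λ {f} f#L → All.lookup f#L e∈L ∘ SameEdge-sym {e = e} {f}) M#L)

    -- The walk t, y ∷ ys up to its first vertex b in P after t.
    record Hit (P : List V) (t y : V) (ys : List V) : Set where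
      constructor hit
      field
        b        : V
        zs       : List V
        rest     : List (Edge n)
        b∈P      : b ∈ P
        zs∉P     : All (λ z → All (z ≢_) P) zs
        short    : length zs ℕ.≤ length ys
        starts   : ∃ λ us → zs ++ [ b ] ≡ y ∷ us
        splits   : edges t (y ∷ ys) ≡ edges t (zs ++ [ b ]) ++ rest

    firstHit : ∀ P t y ys → endpoint y ys ∈ P → Hit P t y ys
    firstHit P t y ys end∈P with DecMembership._∈?_ Fin._≟_ y P
    firstHit P t y ys       end∈P | yes y∈P = hit y [] (edges y ys) y∈P [] ℕ.z≤n ([] , refl) refl
    firstHit P t y []       end∈P | no  y∉P = contradiction end∈P y∉P
    firstHit P t y (z ∷ ys) end∈P | no  y∉P =
      let hit b zs rest b∈P zs∉P short _ splits = firstHit P y z ys end∈P in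
      hit b (y ∷ zs) rest b∈P (¬Any⇒All¬ P y∉P ∷ zs∉P) (ℕ.s≤s short) (zs ++ [ b ] , refl)
        (cong ((t , y) ∷_) splits)

    -- Every edge of the excursion starts at a vertex off the path, even the last one, which ends on
    -- it at `b`.
    excursion-avoids : ∀ {x xs} z zs b → All (λ z → All (z ≢_) (x ∷ xs)) (z ∷ zs) →
                       All (_# edges x xs) (edges z (zs ++ [ b ]))
    excursion-avoids {x} {xs} z []        b (z∉ ∷ [])  = avoid xs z∉ ∷ []
    excursion-avoids {x} {xs} z (z′ ∷ zs) b (z∉ ∷ zs∉) = avoid xs z∉ ∷ excursion-avoids z′ zs b zs∉

    -- An ear of the path s ∷ xs along the path s ∷ ys, possibly a chord.
    record Ear (s : V) (xs ys : List V) : Set where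
      constructor ear
      field
        a b      : V
        zs       : List V
        a∈       : a ∈ s ∷ xs
        b∈       : b ∈ s ∷ xs
        short    : length zs ℕ.< length ys
        distinct : Distinct (edges s xs ++ edges a (zs ++ [ b ]))
        along    : All (_∈ edges s ys) (edges a (zs ++ [ b ]))

    -- The recursion strips shared first edges. The vertices left behind cannot interfere later,
    -- because a simple path never comes back to them. Once the first steps differ, the common end
    -- guarantees that the second path meets the first one again.
    diverge : ∀ s xs ys → Unique (s ∷ xs) → Unique (s ∷ ys) →
              endpoint s xs ≡ endpoint s ys → xs ≢ ys → Ear s xs ys
    diverge s []       []       _ _ _ ≠ = contradiction refl ≠
    diverge s []       (y ∷ ys) _ (s∉ ∷ _) eq _ = contradiction eq (All.lookup s∉ (endpoint∈ y ys))
    diverge s (x ∷ xs) []       (s∉ ∷ _) _ eq _ = contradiction (sym eq) (All.lookup s∉ (endpoint∈ x xs))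
    diverge s (x ∷ xs) (y ∷ ys) uniqueˣ@(s∉xs ∷ uˣ) uniqueʸ@(s∉ys ∷ uʸ) eq ≠ with x Fin.≟ y
    -- `along` allows the shared edge to be put back: the ear uses only edges of the rest of the
    -- second path, and these avoid `s`.
    ... | yes refl = let ear a b zs a∈ b∈ short (nonLoop , distinct) along =
                           diverge x xs ys uˣ uʸ eq (≠ ∘ cong (x ∷_)) in
      ear a b zs (there a∈) (there b∈) (ℕ.m≤n⇒m≤1+n short)
        ( All.head s∉xs ∷ nonLoop
        , All.++⁺ (avoid xs s∉xs) (All.map (All.lookup (avoid ys s∉ys)) along) ∷ distinct)
        (All.map there along)
    ... | no x≢y with firstHit (s ∷ x ∷ xs) s y ys (subst (_∈ s ∷ x ∷ xs) eq (there (endpoint∈ x xs)))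
    ...   | hit b zs rest b∈P zs∉P short starts splits =
      ear s b zs (here refl) b∈P (ℕ.s≤s short)
        (distinct-++ (edges s (x ∷ xs)) (edges s (zs ++ [ b ])) (edges-distinct s (x ∷ xs) uniqueˣ)
          (distinct-prefix (edges s (zs ++ [ b ])) rest
            (subst Distinct splits (edges-distinct s (y ∷ ys) uniqueʸ)))
          (avoids zs zs∉P starts))
        (All.tabulate λ {e} e∈ → subst (e ∈_) (sym splits) (∈-++⁺ˡ e∈))
      where
      avoids : ∀ zs → All (λ z → All (z ≢_) (s ∷ x ∷ xs)) zs → (∃ λ us → zs ++ [ b ] ≡ y ∷ us) →
               All (_# edges s (x ∷ xs)) (edges s (zs ++ [ b ]))
      -- The excursion is the single edge from `s` to `y`. Both of its ends lie on the path, so it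
      -- differs from the first edge of the path only because `y` differs from `x`; `starts`
      -- preserves that information.
      avoids []       _            (_ , refl) =
        ((λ { (inj₁ (_ , y≡x)) → x≢y (sym y≡x) ; (inj₂ (s≡x , _)) → All.head s∉xs s≡x })
          ∷ avoid xs s∉xs) ∷ []
      avoids (z ∷ zs) zs∉@(z∉ ∷ _) _          =
        #-flip (edges s (x ∷ xs)) (avoid (x ∷ xs) z∉) ∷ excursion-avoids z zs b zs∉

    Present : Graph n → Edge n → Set
    Present G (u , v) = Adjacent G u v

    Path : Graph n → V → List V → Set
    Path G s xs = Unique (s ∷ xs) × All (Present G) (edges s xs)

    unique-toList : ∀ {k} {xs : Vec V k} → VecAllPairs.AllPairs _≢_ xs → Unique (Vec.toList xs)
    unique-toList []         = []
    unique-toList (x∉ ∷ xs!) = VecAll.toList⁺ x∉ ∷ unique-toList xs!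

    unique-fromList : ∀ {xs : List V} → Unique xs → VecAllPairs.AllPairs _≢_ (Vec.fromList xs)
    unique-fromList []         = []
    unique-fromList (x∉ ∷ xs!) = VecAll.fromList⁺ x∉ ∷ unique-fromList xs!

    hasPath⇒path : ∀ {G : Graph n} {s v k} → HasPath G s v k →
                   ∃ λ xs → length xs ≡ k × endpoint s xs ≡ v × Path G s xs
    hasPath⇒path {G} (s ∷ xs , refl , last≡v , linked , unique) =
      Vec.toList xs , Vec.length-toList xs , trans (endpoint-toList s xs) last≡v ,
      unique-toList unique , adjs s xs linked
      where
      endpoint-toList : ∀ {k} s (xs : Vec V k) → endpoint s (Vec.toList xs) ≡ Vec.last (s ∷ xs)
      endpoint-toList s []       = refl
      endpoint-toList s (x ∷ xs) = endpoint-toList x xs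
      adjs : ∀ {k} s (xs : Vec V k) → Linked (Adjacent G) (s ∷ xs) →
                All (Present G) (edges s (Vec.toList xs))
      adjs s []       _          = []
      adjs s (x ∷ xs) (adj ∷ linked) = adj ∷ adjs x xs linked

    path⇒hasPath : ∀ {G : Graph n} {s} xs → Path G s xs → HasPath G s (endpoint s xs) (length xs)
    path⇒hasPath {G} {s} xs (unique , adjs) =
      s ∷ Vec.fromList xs , refl , last-fromList s xs , linked s xs adjs , unique-fromList unique
      where
      last-fromList : ∀ s xs → Vec.last (s ∷ Vec.fromList xs) ≡ endpoint s xs
      last-fromList s []       = refl
      last-fromList s (x ∷ xs) = last-fromList x xs
      linked : ∀ s xs → All (Present G) (edges s xs) → Linked (Adjacent G) (s ∷ Vec.fromList xs)
      linked s []       _              = [-]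
      linked s (x ∷ xs) (adj ∷ adjs) = adj ∷ linked x xs adjs

  -- Counting vertices by earless paths

  length-filter-tabulate : ∀ {A : Set} {n} {P : A → Set} (P? : ∀ x → Dec (P x)) (f : Fin n → A) →
    ν (length (List.filter P? (List.tabulate f))) ≡ sum λ i → ⟦ P? (f i) ⟧
  length-filter-tabulate {n = zero}  P? f = refl
  length-filter-tabulate {n = suc n} P? f with does (P? (f zero))
  ... | true  = trans (ν-suc (length (List.filter P? (List.tabulate (f ∘ suc))))) (cong (λ q → 1ℚ + q) (length-filter-tabulate P? (f ∘ suc)))
  ... | false = trans (length-filter-tabulate P? (f ∘ suc)) (sym (+-identityˡ _))

  module _ {n : ℕ} where

    private V = Fin n

    open DecMembership (Fin._≟_ {n}) using (_∈?_)

    -- Sums over the ends a, b and the fewer than d interior vertices zs of an ear.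
    ∑ᵉ : ℕ → (V → V → List V → ℚ) → ℚ
    ∑ᵉ d f = sum {d} λ i → sum λ a → sum λ b → ∑* (toℕ i) λ zs → f a b zs

    ∑ᵉ-cong : ∀ d {f g : V → V → List V → ℚ} → (∀ a b zs → f a b zs ≡ g a b zs) → ∑ᵉ d f ≡ ∑ᵉ d g
    ∑ᵉ-cong d f≡g = sum-cong-≗ {d} λ i → sum-cong-≗ λ a → sum-cong-≗ λ b → ∑*-cong (toℕ i) λ zs _ → f≡g a b zs

    *-distribˡ-∑ᵉ : ∀ d p (f : V → V → List V → ℚ) → p * ∑ᵉ d f ≡ ∑ᵉ d λ a b zs → p * f a b zs
    *-distribˡ-∑ᵉ d p f =
      trans (*-distribˡ-sum {d} p _) (sum-cong-≗ {d} λ i →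
      trans (*-distribˡ-sum p (λ a → sum λ b → ∑* (toℕ i) (f a b))) (sum-cong-≗ λ a →
      trans (*-distribˡ-sum p (λ b → ∑* (toℕ i) (f a b))) (sum-cong-≗ λ b →
      *-distribˡ-∑* (toℕ i) p (f a b))))

    E-∑ᵉ : ∀ (w : Weights n) d (X : V → V → List V → Graph n → ℚ) →
           E w (λ G → ∑ᵉ d λ a b zs → X a b zs G) ≡ ∑ᵉ d λ a b zs → E w (X a b zs)
    E-∑ᵉ w d X =
      trans (E-sum {m = d} w λ i G → sum λ a → sum λ b → ∑* (toℕ i) λ zs → X a b zs G) (sum-cong-≗ {d} λ i →
      trans (E-sum w λ a G → sum λ b → ∑* (toℕ i) λ zs → X a b zs G) (sum-cong-≗ λ a →
      trans (E-sum w λ b G → ∑* (toℕ i) λ zs → X a b zs G) (sum-cong-≗ λ b →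
      E-∑* w (toℕ i) (X a b))))

    term≤∑ᵉ : ∀ d {f : V → V → List V → ℚ} → (∀ a b zs → 0ℚ ≤ f a b zs) →
              ∀ a b zs → length zs ℕ.< d → f a b zs ≤ ∑ᵉ d f
    term≤∑ᵉ d {f} 0≤f a b zs short =
      ≤-trans (subst (λ k → f a b zs ≤ ∑* k (f a b)) (sym (Fin.toℕ-fromℕ< short)) (term≤∑* (0≤f a b) zs))
      (≤-trans (term≤sum (λ b → ∑*-nonNeg (toℕ i) (0≤f a b)) b)
      (≤-trans (term≤sum (λ a → sum-nonNeg λ b → ∑*-nonNeg (toℕ i) (0≤f a b)) a)
      (term≤sum {d} (λ i → sum-nonNeg λ a → sum-nonNeg λ b → ∑*-nonNeg (toℕ i) (0≤f a b)) i)))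
      where i = fromℕ< short

    unique? : (xs : List V) → Dec (Unique xs)
    unique? = allPairs? λ x y → ¬? (x Fin.≟ y)

    -- The interior vertices may repeat or lie on the path. Distinctness of the edges is all that is
    -- required for the expectation to factorise, and the surplus terms can only lower `earless`.
    IsEar : V → List V → V → V → List V → Set
    IsEar s xs a b zs = a ∈ s ∷ xs × b ∈ s ∷ xs × Distinct (edges s xs ++ edges a (zs ++ [ b ]))

    isEar? : ∀ s xs a b zs → Dec (IsEar s xs a b zs)
    isEar? s xs a b zs = a ∈? s ∷ xs ×-dec b ∈? s ∷ xs ×-dec distinct? (edges s xs ++ edges a (zs ++ [ b ]))

    earTerm : V → List V → Graph n → V → V → List V → ℚ
    earTerm s xs G a b zs = ⟦ isEar? s xs a b zs ⟧ * present (edges a (zs ++ [ b ])) G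

    ears : ℕ → V → List V → Graph n → ℚ
    ears d s xs G = ∑ᵉ d (earTerm s xs G)

    isPath : V → List V → Graph n → ℚ
    isPath s xs G = ⟦ unique? (s ∷ xs) ⟧ * present (edges s xs) G

    -- Positive only if s ∷ xs is a path without ears.
    earless : ℕ → V → List V → Graph n → ℚ
    earless d s xs G = isPath s xs G * (1ℚ - ears d s xs G)

    present-cases : ∀ (G : Graph n) L → (All (Present G) L × present L G ≡ 1ℚ) ⊎ (present L G ≡ 0ℚ)
    present-cases G []            = inj₁ ([] , refl)
    present-cases G ((u , v) ∷ L) with adjacent G u v in eq | present-cases G L
    ... | false | _                = inj₂ (*-zeroˡ (present L G))
    ... | true  | inj₁ (all , ≡1) = inj₁ (subst T (sym eq) _ ∷ all , trans (*-identityˡ _) ≡1)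
    ... | true  | inj₂ ≡0         = inj₂ (trans (*-identityˡ _) ≡0)

    present≡1 : ∀ (G : Graph n) L → All (Present G) L → present L G ≡ 1ℚ
    present≡1 G []            []           = refl
    present≡1 G ((u , v) ∷ L) (adj ∷ adjs) with adjacent G u v
    ... | true = trans (*-identityˡ _) (present≡1 G L adjs)

    isPath-cases : ∀ s xs (G : Graph n) → (Path G s xs × isPath s xs G ≡ 1ℚ) ⊎ (isPath s xs G ≡ 0ℚ)
    isPath-cases s xs G = cases (unique? (s ∷ xs)) (present-cases G (edges s xs))
      where
      p = present (edges s xs) G
      cases : (u : Dec (Unique (s ∷ xs))) → (All (Present G) (edges s xs) × p ≡ 1ℚ) ⊎ (p ≡ 0ℚ) →
              (Path G s xs × ⟦ u ⟧ * p ≡ 1ℚ) ⊎ (⟦ u ⟧ * p ≡ 0ℚ)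
      cases (no  _)      _                  = inj₂ (*-zeroˡ p)
      cases (yes unique) (inj₁ (adjs , ≡1)) = inj₁ ((unique , adjs) , trans (*-identityˡ p) ≡1)
      cases (yes unique) (inj₂ ≡0)          = inj₂ (trans (*-identityˡ p) ≡0)

    isPath≡1 : ∀ {s xs} {G : Graph n} → Path G s xs → isPath s xs G ≡ 1ℚ
    isPath≡1 {s} {xs} {G} (unique , adjs) =
      cong₂ _*_ (⟦⟧-true (unique? (s ∷ xs)) unique) (present≡1 G (edges s xs) adjs)

    0≤isPath : ∀ s xs (G : Graph n) → 0ℚ ≤ isPath s xs G
    0≤isPath s xs G = 0≤-* (0≤𝟙 (does (unique? (s ∷ xs)))) (0≤present (edges s xs) G)

    0≤earTerm : ∀ s xs (G : Graph n) a b zs → 0ℚ ≤ earTerm s xs G a b zs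
    0≤earTerm s xs G a b zs = 0≤-* (0≤𝟙 (does (isEar? s xs a b zs))) (0≤present (edges a (zs ++ [ b ])) G)

    0≤ears : ∀ d s xs (G : Graph n) → 0ℚ ≤ ears d s xs G
    0≤ears d s xs G = sum-nonNeg {d} λ i → sum-nonNeg λ a → sum-nonNeg λ b → ∑*-nonNeg (toℕ i) (0≤earTerm s xs G a b)

    ear⇒1≤ears : ∀ d {s xs ys} {G : Graph n} → length ys ℕ.≤ d → Path G s ys → Ear s xs ys → 1ℚ ≤ ears d s xs G
    ear⇒1≤ears d {s} {xs} {ys} {G} ys≤d (_ , adjs) (ear a b zs a∈ b∈ short distinct along) =
      subst (_≤ ears d s xs G)
        (cong₂ _*_ (⟦⟧-true (isEar? s xs a b zs) (a∈ , b∈ , distinct))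
          (present≡1 G (edges a (zs ++ [ b ])) (All.map (All.lookup adjs) along)))
        (term≤∑ᵉ d (0≤earTerm s xs G) a b zs (ℕ.<-≤-trans short ys≤d))

    earless≤1 : ∀ d s xs (G : Graph n) → earless d s xs G ≤ 1ℚ
    earless≤1 d s xs G with isPath-cases s xs G
    ... | inj₁ (_ , ≡1) = subst (λ p → p * (1ℚ - ears d s xs G) ≤ 1ℚ) (sym ≡1)
      (≤-diff (solve 1 (λ e → con 1ℚ :- con 1ℚ :* (con 1ℚ :- e) := e) refl (ears d s xs G)) (0≤ears d s xs G))
    ... | inj₂ ≡0 = subst (λ p → p * (1ℚ - ears d s xs G) ≤ 1ℚ) (sym ≡0)
      (≤-trans (≤-reflexive (*-zeroˡ (1ℚ - ears d s xs G))) 0≤1)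

    -- A rival path would yield, through `diverge`, an ear of value 1 and make the factor
    -- `1ℚ - ears d s xs G` nonpositive. Rivals shorter than d are covered, which settles the
    -- distance, and so are rivals of length d, which makes each vertex count once.
    earless-pos : ∀ d s xs (G : Graph n) → 0ℚ < earless d s xs G →
      Path G s xs × (∀ ys → length ys ℕ.≤ d → Path G s ys → endpoint s xs ≡ endpoint s ys → xs ≡ ys)
    earless-pos d s xs G 0<p with isPath-cases s xs G
    ... | inj₂ ≡0 = contradiction
      (subst (0ℚ <_) (trans (cong (_* (1ℚ - ears d s xs G)) ≡0) (*-zeroˡ (1ℚ - ears d s xs G))) 0<p) (<-irrefl refl)
    ... | inj₁ (path , ≡1) = path , λ ys ys≤d pathʸ ends → unique ys ys≤d pathʸ ends (List.≡-dec Fin._≟_ xs ys)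
      where
      unique : ∀ ys → length ys ℕ.≤ d → Path G s ys → endpoint s xs ≡ endpoint s ys → Dec (xs ≡ ys) → xs ≡ ys
      unique ys _    _     _    (yes xs≡ys) = xs≡ys
      unique ys ys≤d pathʸ ends (no  xs≢ys) = contradiction
        (<-≤-trans (subst (0ℚ <_) (trans (cong (_* (1ℚ - ears d s xs G)) ≡1) (*-identityˡ (1ℚ - ears d s xs G))) 0<p)
          (≤-diff (solve 1 (λ e → con 0ℚ :- (con 1ℚ :- e) := e :- con 1ℚ) refl (ears d s xs G))
            (≤⇒0≤- (ear⇒1≤ears d ys≤d pathʸ (diverge s xs ys (proj₁ path) (proj₁ pathʸ) ends xs≢ys)))))
        (<-irrefl refl)

    earlessTo : ℕ → V → V → Graph n → List V → ℚ
    earlessTo d s v G xs = ⟦ endpoint s xs Fin.≟ v ⟧ * earless d s xs G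

    earlessTo-pos : ∀ d s v (G : Graph n) xs → 0ℚ < earlessTo d s v G xs →
                    endpoint s xs ≡ v × 0ℚ < earless d s xs G
    earlessTo-pos d s v G xs 0<p with endpoint s xs Fin.≟ v
    ... | yes ends = ends , subst (0ℚ <_) (*-identityˡ _) 0<p
    ... | no  _    = contradiction (subst (0ℚ <_) (*-zeroˡ (earless d s xs G)) 0<p) (<-irrefl refl)

    earlessTo≤1 : ∀ d s v (G : Graph n) xs → earlessTo d s v G xs ≤ 1ℚ
    earlessTo≤1 d s v G xs with endpoint s xs Fin.≟ v
    ... | yes _ = subst (_≤ 1ℚ) (sym (*-identityˡ _)) (earless≤1 d s xs G)
    ... | no  _ = subst (_≤ 1ℚ) (sym (*-zeroˡ (earless d s xs G))) 0≤1

    earless⇒atDistance : ∀ d s xs (G : Graph n) → length xs ≡ d → 0ℚ < earless d s xs G →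
                         AtDistance G s d (endpoint s xs)
    earless⇒atDistance d s xs G refl 0<p =
      let path , unique = earless-pos d s xs G 0<p in
      path⇒hasPath {G = G} xs path , λ {k} k<d hasPath →
        let ys , length≡ , ends , pathʸ = hasPath⇒path {G = G} hasPath
            ys<d = subst (ℕ._< d) (sym length≡) k<d
        in ℕ.<-irrefl (cong length (sym (unique ys (ℕ.<⇒≤ ys<d) pathʸ (sym ends)))) ys<d

    -- A vertex at distance d receives at most one positive term, and any other vertex receives
    -- none.
    ∑earlessTo≤ : ∀ d s v (G : Graph n) → ∑* d (earlessTo d s v G) ≤ ⟦ atDistance? G s d v ⟧
    ∑earlessTo≤ d s v G = ≤⟦⟧ (atDistance? G s d v)
      (λ _ → ∑*≤1 d (earlessTo d s v G) (earlessTo≤1 d s v G) λ xs ys _ ys≡d 0<x 0<y →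
        let endsˣ , 0<x = earlessTo-pos d s v G xs 0<x
            endsʸ , 0<y = earlessTo-pos d s v G ys 0<y
        in proj₂ (earless-pos d s xs G 0<x) ys (ℕ.≤-reflexive ys≡d) (proj₁ (earless-pos d s ys G 0<y))
             (trans endsˣ (sym endsʸ)))
      (λ ¬atDistance → ≮⇒≥ λ 0<∑ →
        let xs , xs≡d , 0<x = ∑*-pos⇒term-pos d (earlessTo d s v G) 0<∑
            ends , 0<x = earlessTo-pos d s v G xs 0<x
        in ¬atDistance (subst (AtDistance G s d) ends (earless⇒atDistance d s xs G xs≡d 0<x)))

    atDistance≤∑ : ∀ d s v (G : Graph n) →
      ⟦ atDistance? G s d v ⟧ ≤ ∑* d λ xs → ⟦ endpoint s xs Fin.≟ v ⟧ * isPath s xs G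
    atDistance≤∑ d s v G = ⟦⟧≤ (atDistance? G s d v)
      (λ (hasPath , _) →
        let xs , xs≡d , ends , path = hasPath⇒path {G = G} hasPath in
        subst₂ (λ q k → q ≤ ∑* k pathTo)
          (cong₂ _*_ (⟦⟧-true (endpoint s xs Fin.≟ v) ends) (isPath≡1 path)) xs≡d
          (term≤∑* 0≤pathTo xs))
      (λ _ → ∑*-nonNeg d 0≤pathTo)
      where
      pathTo : List V → ℚ
      pathTo xs = ⟦ endpoint s xs Fin.≟ v ⟧ * isPath s xs G
      0≤pathTo : ∀ xs → 0ℚ ≤ pathTo xs
      0≤pathTo xs = 0≤-* (0≤𝟙 (does (endpoint s xs Fin.≟ v))) (0≤isPath s xs G)

    -- Every list has exactly one endpoint, so exactly one of the indicators is 1.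
    sum-endpoints : ∀ d s (f : List V → ℚ) →
      sum (λ v → ∑* d λ xs → ⟦ endpoint s xs Fin.≟ v ⟧ * f xs) ≡ ∑* d f
    sum-endpoints d s f = trans (sum-∑*-comm d λ v xs → ⟦ endpoint s xs Fin.≟ v ⟧ * f xs)
      (∑*-cong d λ xs _ → trans (sym (*-distribʳ-sum (f xs) λ v → ⟦ endpoint s xs Fin.≟ v ⟧))
        (trans (cong (_* f xs) (sum-⟦≟⟧ (endpoint s xs))) (*-identityˡ (f xs))))

    ∑earless≤number : ∀ d s (G : Graph n) → ∑* d (λ xs → earless d s xs G) ≤ ν (numberAtDistance G s d)
    ∑earless≤number d s G = subst₂ _≤_ (sum-endpoints d s λ xs → earless d s xs G)
      (sym (length-filter-tabulate (atDistance? G s d) λ v → v))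
      (sum-mono λ v → ∑earlessTo≤ d s v G)

    number≤∑isPath : ∀ d s (G : Graph n) → ν (numberAtDistance G s d) ≤ ∑* d λ xs → isPath s xs G
    number≤∑isPath d s G = subst₂ _≤_ (sym (length-filter-tabulate (atDistance? G s d) λ v → v))
      (sum-endpoints d s λ xs → isPath s xs G)
      (sum-mono λ v → atDistance≤∑ d s v G)

  -- Expected numbers of paths and ears

  earConstant : ℕ → ℚ → ℚ
  earConstant d m = ν d * (ν (suc d) * (ν (suc d) * m ^ d))

  module _ {n : ℕ} where

    private V = Fin n

    open DecMembership (Fin._≟_ {n}) using (_∈?_)

    sum-∈ : ∀ (L : List V) → sum (λ v → ⟦ v ∈? L ⟧) ≤ ν (length L)
    sum-∈ []      = ≤-reflexive (sum-replicate-zero n)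
    sum-∈ (x ∷ L) = begin
      sum (λ v → ⟦ v ∈? x ∷ L ⟧)                          ≤⟨ sum-mono ∈-cons ⟩
      sum (λ v → ⟦ x Fin.≟ v ⟧ + ⟦ v ∈? L ⟧)              ≡⟨ ∑-distrib-+ (λ v → ⟦ x Fin.≟ v ⟧) (λ v → ⟦ v ∈? L ⟧) ⟩
      sum (λ v → ⟦ x Fin.≟ v ⟧) + sum (λ v → ⟦ v ∈? L ⟧)  ≤⟨ +-mono-≤ (≤-reflexive (sum-⟦≟⟧ x)) (sum-∈ L) ⟩
      1ℚ + ν (length L)                                   ≡⟨ ν-suc (length L) ⟨
      ν (length (x ∷ L))                                  ∎
      where
      open ≤-Reasoning
      ∈-cons : ∀ v → ⟦ v ∈? x ∷ L ⟧ ≤ ⟦ x Fin.≟ v ⟧ + ⟦ v ∈? L ⟧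
      ∈-cons v = ⟦⟧≤ (v ∈? x ∷ L)
        (λ { (here refl) → ≤-trans (≤-reflexive (sym (⟦⟧-true (x Fin.≟ v) refl))) (p≤p+q (0≤𝟙 (does (v ∈? L))))
           ; (there v∈L) → ≤-trans (≤-reflexive (sym (⟦⟧-true (v ∈? L) v∈L))) (p≤q+p (0≤𝟙 (does (x Fin.≟ v)))) })
        (λ _ → 0≤-+ (0≤𝟙 (does (x Fin.≟ v))) (0≤𝟙 (does (v ∈? L))))

    -- Self-avoidance in the form that the recursion along a path calls for: `L` collects the
    -- vertices passed before `x`.
    Fresh : List V → V → List V → Set
    Fresh L x xs = Unique (x ∷ xs) × All (_∉ L) xs

    fresh? : ∀ L x xs → Dec (Fresh L x xs)
    fresh? L x xs = unique? (x ∷ xs) ×-dec All.all? (λ y → ¬? (y ∈? L)) xs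

    fresh-∷ : ∀ L x y ys → y ∉ x ∷ L → Fresh (x ∷ L) y ys → Fresh L x (y ∷ ys)
    fresh-∷ L x y ys y∉ (unique , ys∉) =
      ((λ x≡y → y∉ (here (sym x≡y))) ∷ All.map (λ z∉ x≡z → z∉ (here (sym x≡z))) ys∉) ∷ unique ,
      (λ y∈L → y∉ (there y∈L)) ∷ All.map (λ z∉ z∈L → z∉ (there z∈L)) ys∉

    -- The expected number of ears given that the path is present; since ears share no edge with the
    -- path, the condition leaves their weights unchanged.
    earWeight : Weights n → ℕ → V → List V → ℚ
    earWeight w d s xs = ∑ᵉ d λ a b zs → ⟦ isEar? s xs a b zs ⟧ * weight w (edges a (zs ++ [ b ]))

    module _ (w : Weights n) (0≤w : ∀ u v → 0ℚ ≤ w u v) where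

      ∑weight≤ : ∀ {r} k → 0ℚ ≤ r → (∀ x → sum (w x) ≤ r) → ∀ x →
                 ∑* k (λ xs → weight w (edges x xs)) ≤ r ^ k
      ∑weight≤ zero    0≤r rows x = ≤-refl
      ∑weight≤ {r} (suc k) 0≤r rows x = begin
        sum (λ y → ∑* k λ ys → w x y * weight w (edges y ys))
          ≡⟨ sum-cong-≗ (λ y → *-distribˡ-∑* k (w x y) λ ys → weight w (edges y ys)) ⟨
        sum (λ y → w x y * ∑* k λ ys → weight w (edges y ys))
          ≤⟨ sum-mono (λ y → *-monoˡ-≤ (0≤w x y) (∑weight≤ k 0≤r rows y)) ⟩
        sum (λ y → w x y * r ^ k)
          ≡⟨ *-distribʳ-sum (r ^ k) (w x) ⟨
        sum (w x) * r ^ k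
          ≤⟨ *-monoʳ-≤ (0≤-^ k 0≤r) (rows x) ⟩
        r * r ^ k ∎
        where open ≤-Reasoning

      sum-∉ : ∀ {M} → (∀ u v → w u v ≤ M) → 0ℚ ≤ M → ∀ x L →
              sum (w x) ≤ sum (λ y → ⟦ ¬? (y ∈? L) ⟧ * w x y) + ν (length L) * M
      sum-∉ {M} w≤M 0≤M x L = begin
        sum (w x)
          ≤⟨ sum-mono split ⟩
        sum (λ y → ⟦ ¬? (y ∈? L) ⟧ * w x y + ⟦ y ∈? L ⟧ * M)
          ≡⟨ ∑-distrib-+ (λ y → ⟦ ¬? (y ∈? L) ⟧ * w x y) (λ y → ⟦ y ∈? L ⟧ * M) ⟩
        outside + sum (λ y → ⟦ y ∈? L ⟧ * M)
          ≡⟨ cong (outside +_) (*-distribʳ-sum M λ y → ⟦ y ∈? L ⟧) ⟨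
        outside + sum (λ y → ⟦ y ∈? L ⟧) * M
          ≤⟨ +-monoʳ-≤ outside (*-monoʳ-≤ 0≤M (sum-∈ L)) ⟩
        outside + ν (length L) * M ∎
        where
        open ≤-Reasoning
        outside = sum (λ y → ⟦ ¬? (y ∈? L) ⟧ * w x y)
        split : ∀ y → w x y ≤ ⟦ ¬? (y ∈? L) ⟧ * w x y + ⟦ y ∈? L ⟧ * M
        split y with does (y ∈? L)
        ... | true  = ≤-trans (w≤M x y) (≤-reflexive
          (solve 2 (λ a m → m := con 0ℚ :* a :+ con 1ℚ :* m) refl (w x y) M))
        ... | false = ≤-reflexive
          (solve 2 (λ a m → a := con 1ℚ :* a :+ con 0ℚ :* m) refl (w x y) M)

      -- Each step may lead anywhere except to `x` and the vertices of `L`. These are at most `D`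
      -- vertices with entries at most `M`, so at least `ℓ` of the row of `x` remains available.
      ≤∑fresh : ∀ {M ℓ D} → (∀ u v → w u v ≤ M) → 0ℚ ≤ M → 0ℚ ≤ ℓ →
                (∀ x → ℓ + ν D * M ≤ sum (w x)) → ∀ k x L → length L ℕ.+ k ℕ.≤ D →
                ℓ ^ k ≤ ∑* k λ xs → ⟦ fresh? L x xs ⟧ * weight w (edges x xs)
      ≤∑fresh w≤M 0≤M 0≤ℓ rows zero x L bound =
        ≤-reflexive (sym (trans (*-identityʳ _) (⟦⟧-true (fresh? L x []) ([] ∷ [] , []))))
      ≤∑fresh {M} {ℓ} {D} w≤M 0≤M 0≤ℓ rows (suc k) x L bound = begin
        ℓ * ℓ ^ k
          ≤⟨ *-monoʳ-≤ (0≤-^ k 0≤ℓ) ℓ≤outside ⟩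
        sum (λ y → ⟦ ¬? (y ∈? x ∷ L) ⟧ * w x y) * ℓ ^ k
          ≡⟨ *-distribʳ-sum (ℓ ^ k) (λ y → ⟦ ¬? (y ∈? x ∷ L) ⟧ * w x y) ⟩
        sum (λ y → ⟦ ¬? (y ∈? x ∷ L) ⟧ * w x y * ℓ ^ k)
          ≤⟨ sum-mono (λ y → *-monoˡ-≤ (0≤-* (0≤𝟙 (does (¬? (y ∈? x ∷ L)))) (0≤w x y))
               (≤∑fresh w≤M 0≤M 0≤ℓ rows k y (x ∷ L) (subst (ℕ._≤ D) (ℕ.+-suc (length L) k) bound))) ⟩
        sum (λ y → ⟦ ¬? (y ∈? x ∷ L) ⟧ * w x y * ∑* k λ ys → ⟦ fresh? (x ∷ L) y ys ⟧ * weight w (edges y ys))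
          ≡⟨ sum-cong-≗ (λ y → *-distribˡ-∑* k (⟦ ¬? (y ∈? x ∷ L) ⟧ * w x y)
               λ ys → ⟦ fresh? (x ∷ L) y ys ⟧ * weight w (edges y ys)) ⟩
        sum (λ y → ∑* k λ ys → ⟦ ¬? (y ∈? x ∷ L) ⟧ * w x y * (⟦ fresh? (x ∷ L) y ys ⟧ * weight w (edges y ys)))
          ≤⟨ sum-mono (λ y → ∑*-mono k λ ys _ → extend y ys) ⟩
        sum (λ y → ∑* k λ ys → ⟦ fresh? L x (y ∷ ys) ⟧ * (w x y * weight w (edges y ys))) ∎
        where
        open ≤-Reasoning
        ℓ≤outside : ℓ ≤ sum λ y → ⟦ ¬? (y ∈? x ∷ L) ⟧ * w x y
        ℓ≤outside = ≤-diff {r = (sum (w x) - (ℓ + ν D * M)) + (outside + νL * M - sum (w x)) + (ν D - νL) * M}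
          (solve 6 (λ o l s m a b → o :- l := (s :- (l :+ a :* m)) :+ (o :+ b :* m :- s) :+ (a :- b) :* m) refl
            outside ℓ (sum (w x)) M (ν D) νL)
          (0≤-+ (0≤-+ (≤⇒0≤- (rows x)) (≤⇒0≤- (sum-∉ w≤M 0≤M x (x ∷ L))))
            (0≤-* (≤⇒0≤- (ν-mono (ℕ.≤-trans (ℕ.m≤m+n (suc (length L)) k) (subst (ℕ._≤ D) (ℕ.+-suc (length L) k) bound)))) 0≤M))
          where
          outside = sum λ y → ⟦ ¬? (y ∈? x ∷ L) ⟧ * w x y
          νL = ν (length (x ∷ L))
        indicators : ∀ y ys → ⟦ ¬? (y ∈? x ∷ L) ⟧ * ⟦ fresh? (x ∷ L) y ys ⟧ ≤ ⟦ fresh? L x (y ∷ ys) ⟧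
        indicators y ys = ≤⟦⟧ (fresh? L x (y ∷ ys))
          (λ _ → *-mono-≤-nonNeg {b = 1ℚ} {d = 1ℚ} 0≤1 (0≤𝟙 (does (fresh? (x ∷ L) y ys)))
            (𝟙≤1 (does (¬? (y ∈? x ∷ L)))) (𝟙≤1 (does (fresh? (x ∷ L) y ys))))
          (λ ¬fresh → impossible ¬fresh (y ∈? x ∷ L) (fresh? (x ∷ L) y ys))
          where
          impossible : ¬ Fresh L x (y ∷ ys) → (∈? : Dec (y ∈ x ∷ L)) (f? : Dec (Fresh (x ∷ L) y ys)) →
                       ⟦ ¬? ∈? ⟧ * ⟦ f? ⟧ ≤ 0ℚ
          impossible ¬fresh (yes _) f?        = ≤-reflexive (*-zeroˡ ⟦ f? ⟧)
          impossible ¬fresh (no  _) (no  _)   = ≤-refl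
          impossible ¬fresh (no y∉) (yes f)   = contradiction (fresh-∷ L x y ys y∉ f) ¬fresh
        extend : ∀ y ys → ⟦ ¬? (y ∈? x ∷ L) ⟧ * w x y * (⟦ fresh? (x ∷ L) y ys ⟧ * weight w (edges y ys))
               ≤ ⟦ fresh? L x (y ∷ ys) ⟧ * (w x y * weight w (edges y ys))
        extend y ys = ≤-trans
          (≤-reflexive (solve 4 (λ a b c d → (a :* b) :* (c :* d) := (a :* c) :* (b :* d)) refl
            ⟦ ¬? (y ∈? x ∷ L) ⟧ (w x y) ⟦ fresh? (x ∷ L) y ys ⟧ (weight w (edges y ys))))
          (*-monoʳ-≤ (0≤weight 0≤w (edges x (y ∷ ys))) (indicators y ys))

      ≤∑unique : ∀ {M ℓ} d → (∀ u v → w u v ≤ M) → 0ℚ ≤ M → 0ℚ ≤ ℓ →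
                 (∀ x → ℓ + ν d * M ≤ sum (w x)) → ∀ s →
                 ℓ ^ d ≤ ∑* d λ xs → ⟦ unique? (s ∷ xs) ⟧ * weight w (edges s xs)
      ≤∑unique d w≤M 0≤M 0≤ℓ rows s = ≤-trans (≤∑fresh w≤M 0≤M 0≤ℓ rows d s [] ℕ.≤-refl)
        (∑*-mono d λ xs _ → *-monoʳ-≤ (0≤weight 0≤w (edges s xs))
          (⟦⟧-mono (fresh? [] s xs) (unique? (s ∷ xs)) proj₁))

      weight-edges≤ : ∀ {M} → (∀ u v → w u v ≤ M) → 0ℚ ≤ M → ∀ x xs → weight w (edges x xs) ≤ M ^ length xs
      weight-edges≤ w≤M 0≤M x []       = ≤-refl
      weight-edges≤ w≤M 0≤M x (y ∷ ys) = *-mono-≤-nonNeg 0≤M (0≤weight 0≤w (edges y ys))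
        (w≤M x y) (weight-edges≤ w≤M 0≤M y ys)

      -- An ear with i interior vertices has at most n^i choices for them but i + 1 edges of weight
      -- at most m h. As n h = 1, one factor h survives, next to m^(i+1) ≤ m^d. The d values of i
      -- and the d + 1 choices for either end make up the rest of `earConstant`.
      earWeight≤ : ∀ {m h} → (∀ u v → w u v ≤ m * h) → 1ℚ ≤ m → 0ℚ ≤ h → ν n * h ≡ 1ℚ →
                   ∀ d s xs → length xs ≡ d → earWeight w d s xs ≤ earConstant d m * h
      earWeight≤ {m} {h} w≤mh 1≤m 0≤h νn*h≡1 d s xs refl = begin
        earWeight w d s xs
          ≤⟨ sum-mono {d} (λ i → sum-mono λ a → sum-mono λ b → per-ends (toℕ i) (Fin.toℕ<n i) a b) ⟩
        sum {d} (λ _ → sum λ a → sum λ b → ⟦ a ∈? s ∷ xs ⟧ * (⟦ b ∈? s ∷ xs ⟧ * κ))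
          ≤⟨ sum-mono {d} (λ _ → ∑ends≤) ⟩
        sum {d} (λ _ → ν (suc d) * (ν (suc d) * κ))
          ≡⟨ sum-const d (ν (suc d) * (ν (suc d) * κ)) ⟩
        ν d * (ν (suc d) * (ν (suc d) * κ))
          ≡⟨ solve 4 (λ a b c h → a :* (b :* (b :* (c :* h))) := a :* (b :* (b :* c)) :* h) refl
               (ν d) (ν (suc d)) (m ^ d) h ⟩
        earConstant d m * h ∎
        where
        open ≤-Reasoning
        κ = m ^ d * h
        0≤m = ≤-trans 0≤1 1≤m
        0≤κ = 0≤-* (0≤-^ d 0≤m) 0≤h
        m^-mono : ∀ {i j} → i ℕ.≤ j → m ^ i ≤ m ^ j
        m^-mono {j = j} ℕ.z≤n       = 1≤-^ j 1≤m
        m^-mono (ℕ.s≤s i≤j) = *-monoˡ-≤ 0≤m (m^-mono i≤j)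
        n^*mh^ : ∀ i → ν n ^ i * (m * h) ^ suc i ≡ m ^ suc i * h
        n^*mh^ i = trans (cong (λ q → ν n ^ i * (m * h * q)) (*-^ m h i))
          (trans (solve 5 (λ a m h b c → a :* (m :* h :* (b :* c)) := (a :* c) :* (m :* b :* h)) refl
                   (ν n ^ i) m h (m ^ i) (h ^ i))
          (trans (cong (_* (m * m ^ i * h)) (trans (sym (*-^ (ν n) h i)) (trans (cong (_^ i) νn*h≡1) (1^ i))))
            (*-identityˡ (m * m ^ i * h))))
          where
          1^ : ∀ i → 1ℚ ^ i ≡ 1ℚ
          1^ zero    = refl
          1^ (suc i) = trans (*-identityˡ (1ℚ ^ i)) (1^ i)
        isEar≤ : ∀ a b zs → ⟦ isEar? s xs a b zs ⟧ ≤ ⟦ a ∈? s ∷ xs ⟧ * ⟦ b ∈? s ∷ xs ⟧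
        isEar≤ a b zs = ⟦⟧≤ (isEar? s xs a b zs)
          (λ (a∈ , b∈ , _) → ≤-reflexive (sym (cong₂ _*_ (⟦⟧-true (a ∈? s ∷ xs) a∈) (⟦⟧-true (b ∈? s ∷ xs) b∈))))
          (λ _ → 0≤-* (0≤𝟙 (does (a ∈? s ∷ xs))) (0≤𝟙 (does (b ∈? s ∷ xs))))
        per-ends : ∀ i → i ℕ.< d → ∀ a b →
          ∑* i (λ zs → ⟦ isEar? s xs a b zs ⟧ * weight w (edges a (zs ++ [ b ])))
          ≤ ⟦ a ∈? s ∷ xs ⟧ * (⟦ b ∈? s ∷ xs ⟧ * κ)
        per-ends i i<d a b = begin
          ∑* i (λ zs → ⟦ isEar? s xs a b zs ⟧ * weight w (edges a (zs ++ [ b ])))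
            ≤⟨ ∑*-mono i (λ zs zs≡i → *-mono-≤-nonNeg 0≤𝟙𝟙 (0≤weight 0≤w (edges a (zs ++ [ b ])))
                 (isEar≤ a b zs) (subst (λ k → weight w (edges a (zs ++ [ b ])) ≤ (m * h) ^ k)
                   (trans (List.length-++-comm zs [ b ]) (cong suc zs≡i))
                   (weight-edges≤ w≤mh (0≤-* 0≤m 0≤h) a (zs ++ [ b ])))) ⟩
          ∑* i (λ _ → ⟦ a ∈? s ∷ xs ⟧ * ⟦ b ∈? s ∷ xs ⟧ * (m * h) ^ suc i)
            ≡⟨ ∑*-const n i (⟦ a ∈? s ∷ xs ⟧ * ⟦ b ∈? s ∷ xs ⟧ * (m * h) ^ suc i) ⟩
          ν n ^ i * (⟦ a ∈? s ∷ xs ⟧ * ⟦ b ∈? s ∷ xs ⟧ * (m * h) ^ suc i)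
            ≡⟨ solve 4 (λ p a b q → p :* (a :* b :* q) := a :* b :* (p :* q)) refl
                 (ν n ^ i) ⟦ a ∈? s ∷ xs ⟧ ⟦ b ∈? s ∷ xs ⟧ ((m * h) ^ suc i) ⟩
          ⟦ a ∈? s ∷ xs ⟧ * ⟦ b ∈? s ∷ xs ⟧ * (ν n ^ i * (m * h) ^ suc i)
            ≡⟨ cong (⟦ a ∈? s ∷ xs ⟧ * ⟦ b ∈? s ∷ xs ⟧ *_) (n^*mh^ i) ⟩
          ⟦ a ∈? s ∷ xs ⟧ * ⟦ b ∈? s ∷ xs ⟧ * (m ^ suc i * h)
            ≤⟨ *-monoˡ-≤ 0≤𝟙𝟙 (*-monoʳ-≤ 0≤h (m^-mono i<d)) ⟩
          ⟦ a ∈? s ∷ xs ⟧ * ⟦ b ∈? s ∷ xs ⟧ * κ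
            ≡⟨ *-assoc ⟦ a ∈? s ∷ xs ⟧ ⟦ b ∈? s ∷ xs ⟧ κ ⟩
          ⟦ a ∈? s ∷ xs ⟧ * (⟦ b ∈? s ∷ xs ⟧ * κ) ∎
          where 0≤𝟙𝟙 = 0≤-* (0≤𝟙 (does (a ∈? s ∷ xs))) (0≤𝟙 (does (b ∈? s ∷ xs)))
        ∑∈≤ : ∀ {q} → 0ℚ ≤ q → sum (λ a → ⟦ a ∈? s ∷ xs ⟧ * q) ≤ ν (suc d) * q
        ∑∈≤ {q} 0≤q = ≤-trans (≤-reflexive (sym (*-distribʳ-sum q λ a → ⟦ a ∈? s ∷ xs ⟧)))
          (*-monoʳ-≤ 0≤q (sum-∈ (s ∷ xs)))
        ∑ends≤ : sum (λ a → sum λ b → ⟦ a ∈? s ∷ xs ⟧ * (⟦ b ∈? s ∷ xs ⟧ * κ)) ≤ ν (suc d) * (ν (suc d) * κ)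
        ∑ends≤ = ≤-trans
          (sum-mono λ a → ≤-trans
            (≤-reflexive (sym (*-distribˡ-sum ⟦ a ∈? s ∷ xs ⟧ λ b → ⟦ b ∈? s ∷ xs ⟧ * κ)))
            (*-monoˡ-≤ (0≤𝟙 (does (a ∈? s ∷ xs))) (∑∈≤ 0≤κ)))
          (∑∈≤ (0≤-* (0≤ν (suc d)) 0≤κ))

    E-isPath : ∀ (w : Weights n) → Symmetric w → ∀ s xs →
               E w (isPath s xs) ≡ ⟦ unique? (s ∷ xs) ⟧ * weight w (edges s xs)
    E-isPath w w-sym s xs = trans (E-* w ⟦ unique? (s ∷ xs) ⟧ (present (edges s xs))) (value (unique? (s ∷ xs)))
      where
      value : (u : Dec (Unique (s ∷ xs))) → ⟦ u ⟧ * E w (present (edges s xs)) ≡ ⟦ u ⟧ * weight w (edges s xs)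
      value (yes unique) = cong (1ℚ *_) (E-present w w-sym (edges s xs) (edges-distinct s xs unique))
      value (no _)       = trans (*-zeroˡ (E w (present (edges s xs)))) (sym (*-zeroˡ (weight w (edges s xs))))

    -- Where `IsEar` fails, both sides have a zero term. Where it holds, the edges of the path and
    -- the ear together are distinct, so the probability of their joint presence is the product of
    -- the weights.
    E-present*ears : ∀ (w : Weights n) → Symmetric w → ∀ d s xs →
      E w (λ G → present (edges s xs) G * ears d s xs G) ≡ weight w (edges s xs) * earWeight w d s xs
    E-present*ears w w-sym d s xs = begin
      E w (λ G → present P G * ears d s xs G)
        ≡⟨ E-cong w (λ G → *-distribˡ-∑ᵉ d (present P G) (earTerm s xs G)) ⟩
      E w (λ G → ∑ᵉ d λ a b zs → present P G * earTerm s xs G a b zs)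
        ≡⟨ E-∑ᵉ w d (λ a b zs G → present P G * earTerm s xs G a b zs) ⟩
      ∑ᵉ d (λ a b zs → E w λ G → present P G * earTerm s xs G a b zs)
        ≡⟨ ∑ᵉ-cong d term ⟩
      ∑ᵉ d (λ a b zs → weight w P * (⟦ isEar? s xs a b zs ⟧ * weight w (edges a (zs ++ [ b ]))))
        ≡⟨ *-distribˡ-∑ᵉ d (weight w P) (λ a b zs → ⟦ isEar? s xs a b zs ⟧ * weight w (edges a (zs ++ [ b ]))) ⟨
      weight w P * earWeight w d s xs ∎
      where
      open ≡-Reasoning
      P = edges s xs
      term : ∀ a b zs → E w (λ G → present P G * earTerm s xs G a b zs)
                      ≡ weight w P * (⟦ isEar? s xs a b zs ⟧ * weight w (edges a (zs ++ [ b ])))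
      term a b zs = trans
        (E-cong w λ G → trans
          (solve 3 (λ p e r → p :* (e :* r) := e :* (p :* r)) refl (present P G) ⟦ isEar? s xs a b zs ⟧ (present R G))
          (cong (⟦ isEar? s xs a b zs ⟧ *_) (sym (present-++ P R G))))
        (trans (E-* w ⟦ isEar? s xs a b zs ⟧ (present (P ++ R))) (value (isEar? s xs a b zs)))
        where
        R = edges a (zs ++ [ b ])
        value : (e : Dec (IsEar s xs a b zs)) → ⟦ e ⟧ * E w (present (P ++ R)) ≡ weight w P * (⟦ e ⟧ * weight w R)
        value (yes (_ , _ , distinct)) =
          trans (cong (1ℚ *_) (trans (E-present w w-sym (P ++ R) distinct) (weight-++ w P R)))
            (solve 2 (λ p r → con 1ℚ :* (p :* r) := p :* (con 1ℚ :* r)) refl (weight w P) (weight w R))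
        value (no _) = trans (*-zeroˡ (E w (present (P ++ R))))
          (solve 2 (λ p r → con 0ℚ := p :* (con 0ℚ :* r)) refl (weight w P) (weight w R))

    E-earless : ∀ (w : Weights n) → Symmetric w → ∀ d s xs →
      E w (earless d s xs) ≡ ⟦ unique? (s ∷ xs) ⟧ * weight w (edges s xs) * (1ℚ - earWeight w d s xs)
    E-earless w w-sym d s xs = begin
      E w (earless d s xs)
        ≡⟨ E-cong w (λ G → solve 3 (λ u p e → u :* p :* (con 1ℚ :- e) := u :* p :- u :* (p :* e)) refl
             u (present P G) (ears d s xs G)) ⟩
      E w (λ G → isPath s xs G - u * (present P G * ears d s xs G))
        ≡⟨ E-- w (isPath s xs) (λ G → u * (present P G * ears d s xs G)) ⟩
      E w (isPath s xs) - E w (λ G → u * (present P G * ears d s xs G))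
        ≡⟨ cong₂ _-_ (E-isPath w w-sym s xs) (trans (E-* w u λ G → present P G * ears d s xs G)
             (cong (u *_) (E-present*ears w w-sym d s xs))) ⟩
      u * weight w P - u * (weight w P * earWeight w d s xs)
        ≡⟨ solve 3 (λ u p e → u :* p :- u :* (p :* e) := u :* p :* (con 1ℚ :- e)) refl
             u (weight w P) (earWeight w d s xs) ⟩
      u * weight w P * (1ℚ - earWeight w d s xs) ∎
      where
      open ≡-Reasoning
      P = edges s xs
      u = ⟦ unique? (s ∷ xs) ⟧

    -- In the lower bound, giving up `d` entries of each row pays for self-avoidance, and the factor
    -- next to `ℓ ^ d` pays for ears. The upper bound admits all walks of length `d`.
    E-number-bounds : ∀ (w : Weights n) {m h ℓ r} d → Symmetric w →
      (∀ u v → 0ℚ ≤ w u v × w u v ≤ 1ℚ) → (∀ u v → w u v ≤ m * h) →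
      1ℚ ≤ m → 0ℚ ≤ h → ν n * h ≡ 1ℚ → 0ℚ ≤ ℓ → 0ℚ ≤ r →
      (∀ x → ℓ + ν d * (m * h) ≤ sum (w x)) → (∀ x → sum (w x) ≤ r) →
      (0≤1-κ : 0ℚ ≤ 1ℚ - earConstant d m * h) → ∀ s →
      let N = E w λ G → ν (numberAtDistance G s d) in
      ℓ ^ d * (1ℚ - earConstant d m * h) ≤ N × N ≤ r ^ d
    E-number-bounds w {m} {h} {ℓ} {r} d w-sym w∈[0,1] w≤mh 1≤m 0≤h νn*h≡1 0≤ℓ 0≤r ℓ≤rows rows≤r 0≤1-κ s =
      lower , upper
      where
      open ≤-Reasoning
      0≤w : ∀ u v → 0ℚ ≤ w u v
      0≤w u v = proj₁ (w∈[0,1] u v)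
      κ = earConstant d m * h
      lower : ℓ ^ d * (1ℚ - κ) ≤ E w λ G → ν (numberAtDistance G s d)
      lower = begin
        ℓ ^ d * (1ℚ - κ)
          ≤⟨ *-monoʳ-≤ 0≤1-κ (≤∑unique w 0≤w d w≤mh (0≤-* (≤-trans 0≤1 1≤m) 0≤h) 0≤ℓ ℓ≤rows s) ⟩
        ∑* d (λ xs → ⟦ unique? (s ∷ xs) ⟧ * weight w (edges s xs)) * (1ℚ - κ)
          ≡⟨ *-distribʳ-∑* d (1ℚ - κ) (λ xs → ⟦ unique? (s ∷ xs) ⟧ * weight w (edges s xs)) ⟩
        ∑* d (λ xs → ⟦ unique? (s ∷ xs) ⟧ * weight w (edges s xs) * (1ℚ - κ))
          ≤⟨ ∑*-mono d (λ xs xs≡d → *-monoˡ-≤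
               (0≤-* (0≤𝟙 (does (unique? (s ∷ xs)))) (0≤weight 0≤w (edges s xs)))
               (+-monoʳ-≤ 1ℚ (neg-antimono-≤ (earWeight≤ w 0≤w w≤mh 1≤m 0≤h νn*h≡1 d s xs xs≡d)))) ⟩
        ∑* d (λ xs → ⟦ unique? (s ∷ xs) ⟧ * weight w (edges s xs) * (1ℚ - earWeight w d s xs))
          ≡⟨ ∑*-cong d (λ xs _ → E-earless w w-sym d s xs) ⟨
        ∑* d (λ xs → E w (earless d s xs))
          ≡⟨ E-∑* w d (earless d s) ⟨
        E w (λ G → ∑* d λ xs → earless d s xs G)
          ≤⟨ E-mono w w∈[0,1] (∑earless≤number d s) ⟩
        E w (λ G → ν (numberAtDistance G s d)) ∎
      upper : E w (λ G → ν (numberAtDistance G s d)) ≤ r ^ d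
      upper = begin
        E w (λ G → ν (numberAtDistance G s d))
          ≤⟨ E-mono w w∈[0,1] (number≤∑isPath d s) ⟩
        E w (λ G → ∑* d λ xs → isPath s xs G)
          ≡⟨ E-∑* w d (isPath s) ⟩
        ∑* d (λ xs → E w (isPath s xs))
          ≡⟨ ∑*-cong d (λ xs _ → E-isPath w w-sym s xs) ⟩
        ∑* d (λ xs → ⟦ unique? (s ∷ xs) ⟧ * weight w (edges s xs))
          ≤⟨ ∑*-mono d (λ xs _ → ≤-trans
               (*-monoʳ-≤ (0≤weight 0≤w (edges s xs)) (𝟙≤1 (does (unique? (s ∷ xs)))))
               (≤-reflexive (*-identityˡ (weight w (edges s xs))))) ⟩
        ∑* d (λ xs → weight w (edges s xs))
          ≤⟨ ∑weight≤ w 0≤w d 0≤r rows≤r s ⟩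
        r ^ d ∎

  -- The two models

  -- The row sums include the diagonal entries, which belong to no edge.
  record NearRegular {n} (c M : ℚ) (w : Weights n) : Set where
    field
      symmetric : Symmetric w
      0≤entries   : ∀ u v → 0ℚ ≤ w u v
      bounded   : ∀ u v → w u v ≤ M
      c≤rows    : ∀ u → c ≤ sum (w u)
      rows≤c+M  : ∀ u → sum (w u) ≤ c + M

  -- Coefficients of 1/n. In `lowerError`, d times the loss d m of a row comes from self-avoidance
  -- and the other summand is `earConstant`. In `upperError`, 3^d m comes from `1+x^≤`; the further
  -- m makes m / n ≤ 1 a consequence of the total error being at most 1.
  lowerError upperError errorConstant : ℕ → ℕ → ℕ
  lowerError d m = d ℕ.* (d ℕ.* m) ℕ.+ d ℕ.* (suc d ℕ.* (suc d ℕ.* m ℕ.^ d))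
  upperError d m = 3 ℕ.^ d ℕ.* m ℕ.+ m
  errorConstant d m = lowerError d m ℕ.+ upperError d m

  -- Because c ≥ 1, absolute perturbations of the row sums become relative ones: c - x ≥ c (1 - x)
  -- and c + M ≤ c (1 + M). The powers are then linearised by `bernoulli` and `1+x^≤`.
  nearRegular-bounds : ∀ {n} {w : Weights n} {c h} m d → 1 ℕ.≤ m → 1 ℕ.≤ d → 1ℚ ≤ c → 0ℚ ≤ h → ν n * h ≡ 1ℚ →
    NearRegular c (ν m * h) w → ν (errorConstant d m) * h ≤ 1ℚ → ∀ s →
    let N = E w λ G → ν (numberAtDistance G s d)
        ε = ν (errorConstant d m) * h
    in c ^ d * (1ℚ - ε) ≤ N × N ≤ c ^ d * (1ℚ + ε)
  nearRegular-bounds {n} {w} {c} {h} m d 1≤m 1≤d 1≤c 0≤h νn*h≡1 regular ε≤1 s =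
    ≤-trans lower (proj₁ bounds) , ≤-trans (proj₂ bounds) upper
    where
    open NearRegular regular
    open ≤-Reasoning
    M = ν m * h
    x = ν d * M
    κ = earConstant d (ν m) * h
    ε = ν (errorConstant d m) * h
    0≤c = ≤-trans 0≤1 1≤c
    0≤M = 0≤-* (0≤ν m) 0≤h
    0≤x = 0≤-* (0≤ν d) 0≤M
    0≤κ : 0ℚ ≤ κ
    0≤κ = 0≤-* (0≤-* (0≤ν d) (0≤-* (0≤ν (suc d)) (0≤-* (0≤ν (suc d)) (0≤-^ d (0≤ν m))))) 0≤h
    lower≤ : ν d * x + κ ≤ ε
    lower≤ = begin
      ν d * x + κ
        ≡⟨ solve 5 (λ d m h a b → d :* (d :* (m :* h)) :+ d :* (a :* (a :* b)) :* h
             := (d :* (d :* m) :+ d :* (a :* (a :* b))) :* h) refl (ν d) (ν m) h (ν (suc d)) (ν m ^ d) ⟩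
      (ν d * (ν d * ν m) + ν d * (ν (suc d) * (ν (suc d) * ν m ^ d))) * h
        ≡⟨ cong (_* h) (trans (ν-+ (d ℕ.* (d ℕ.* m)) (d ℕ.* (suc d ℕ.* (suc d ℕ.* m ℕ.^ d)))) (cong₂ _+_
             (trans (ν-* d (d ℕ.* m)) (cong (ν d *_) (ν-* d m)))
             (trans (ν-* d (suc d ℕ.* (suc d ℕ.* m ℕ.^ d))) (cong (ν d *_) (trans (ν-* (suc d) (suc d ℕ.* m ℕ.^ d)) (cong (ν (suc d) *_)
               (trans (ν-* (suc d) (m ℕ.^ d)) (cong (ν (suc d) *_) (ν-^ m d))))))))) ⟨
      ν (lowerError d m) * h
        ≤⟨ *-monoʳ-≤ 0≤h (ν-mono (ℕ.m≤m+n (lowerError d m) (upperError d m))) ⟩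
      ε ∎
    upper≤ : ν 3 ^ d * M + M ≤ ε
    upper≤ = begin
      ν 3 ^ d * M + M
        ≡⟨ solve 3 (λ t m h → t :* (m :* h) :+ m :* h := (t :* m :+ m) :* h) refl (ν 3 ^ d) (ν m) h ⟩
      (ν 3 ^ d * ν m + ν m) * h
        ≡⟨ cong (_* h) (trans (ν-+ (3 ℕ.^ d ℕ.* m) m)
             (cong (_+ ν m) (trans (ν-* (3 ℕ.^ d) m) (cong (_* ν m) (ν-^ 3 d))))) ⟨
      ν (upperError d m) * h
        ≤⟨ *-monoʳ-≤ 0≤h (ν-mono (ℕ.m≤n+m (upperError d m) (lowerError d m))) ⟩
      ε ∎
    κ≤1 : κ ≤ 1ℚ
    κ≤1 = ≤-trans (p≤q+p (0≤-* (0≤ν d) 0≤x)) (≤-trans lower≤ ε≤1)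
    M≤1 : M ≤ 1ℚ
    M≤1 = ≤-trans (p≤q+p (0≤-* (0≤-^ d (0≤ν 3)) 0≤M)) (≤-trans upper≤ ε≤1)
    x≤1 : x ≤ 1ℚ
    x≤1 = begin
      x             ≡⟨ *-identityˡ x ⟨
      1ℚ * x        ≤⟨ *-monoʳ-≤ 0≤x (ν-mono 1≤d) ⟩
      ν d * x       ≤⟨ p≤p+q 0≤κ ⟩
      ν d * x + κ   ≤⟨ lower≤ ⟩
      ε             ≤⟨ ε≤1 ⟩
      1ℚ            ∎
    bounds = E-number-bounds w {ν m} {h} {c - x} {c + M} d symmetric
      (λ u v → 0≤entries u v , ≤-trans (bounded u v) M≤1) bounded (ν-mono 1≤m) 0≤h νn*h≡1
      (≤⇒0≤- (≤-trans x≤1 1≤c)) (0≤-+ 0≤c 0≤M)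
      (λ u → ≤-trans (≤-reflexive (solve 2 (λ c x → c :- x :+ x := c) refl c x)) (c≤rows u)) rows≤c+M
      (≤⇒0≤- κ≤1) s
    lower : c ^ d * (1ℚ - ε) ≤ (c - x) ^ d * (1ℚ - κ)
    lower = begin
      c ^ d * (1ℚ - ε)
        ≤⟨ *-monoˡ-≤ (0≤-^ d 0≤c) (+-monoʳ-≤ 1ℚ (neg-antimono-≤ lower≤)) ⟩
      c ^ d * (1ℚ - (ν d * x + κ))
        ≤⟨ *-monoˡ-≤ (0≤-^ d 0≤c) (≤-diff
             (solve 2 (λ a k → (con 1ℚ :- a) :* (con 1ℚ :- k) :- (con 1ℚ :- (a :+ k)) := a :* k) refl (ν d * x) κ)
             (0≤-* (0≤-* (0≤ν d) 0≤x) 0≤κ)) ⟩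
      c ^ d * ((1ℚ - ν d * x) * (1ℚ - κ))
        ≤⟨ *-monoˡ-≤ (0≤-^ d 0≤c) (*-monoʳ-≤ (≤⇒0≤- κ≤1) (bernoulli d 0≤x x≤1)) ⟩
      c ^ d * ((1ℚ - x) ^ d * (1ℚ - κ))
        ≡⟨ *-assoc (c ^ d) ((1ℚ - x) ^ d) (1ℚ - κ) ⟨
      c ^ d * (1ℚ - x) ^ d * (1ℚ - κ)
        ≡⟨ cong (_* (1ℚ - κ)) (*-^ c (1ℚ - x) d) ⟨
      (c * (1ℚ - x)) ^ d * (1ℚ - κ)
        ≤⟨ *-monoʳ-≤ (≤⇒0≤- κ≤1) (^-mono d (0≤-* 0≤c (≤⇒0≤- x≤1)) (≤-diff
             (solve 2 (λ c x → c :- x :- c :* (con 1ℚ :- x) := (c :- con 1ℚ) :* x) refl c x)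
             (0≤-* (≤⇒0≤- 1≤c) 0≤x))) ⟩
      (c - x) ^ d * (1ℚ - κ) ∎
    upper : (c + M) ^ d ≤ c ^ d * (1ℚ + ε)
    upper = begin
      (c + M) ^ d
        ≤⟨ ^-mono d (0≤-+ 0≤c 0≤M) (≤-diff
             (solve 2 (λ c x → c :* (con 1ℚ :+ x) :- (c :+ x) := (c :- con 1ℚ) :* x) refl c M)
             (0≤-* (≤⇒0≤- 1≤c) 0≤M)) ⟩
      (c * (1ℚ + M)) ^ d
        ≡⟨ *-^ c (1ℚ + M) d ⟩
      c ^ d * (1ℚ + M) ^ d
        ≤⟨ *-monoˡ-≤ (0≤-^ d 0≤c) (1+x^≤ d 0≤M M≤1) ⟩
      c ^ d * (1ℚ + ν 3 ^ d * M)
        ≤⟨ *-monoˡ-≤ (0≤-^ d 0≤c) (+-monoʳ-≤ 1ℚ (≤-trans (p≤p+q {ν 3 ^ d * M} 0≤M) upper≤)) ⟩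
      c ^ d * (1ℚ + ε) ∎

  sum-threshold : ∀ k m (f : Bool → ℚ) →
    sum {k ℕ.+ m} (λ y → f (toℕ y ℕ.<ᵇ k)) ≡ ν k * f true + ν m * f false
  sum-threshold zero    m f = trans (sum-const m (f false))
    (solve 2 (λ a b → b := con 0ℚ :* a :+ b) refl (f true) (ν m * f false))
  sum-threshold (suc k) m f = trans (cong (f true +_) (sum-threshold k m f))
    (trans (solve 3 (λ k a b → a :+ (k :* a :+ b) := (con 1ℚ :+ k) :* a :+ b) refl (ν k) (f true) (ν m * f false))
      (cong (λ q → q * f true + ν m * f false) (sym (ν-suc k))))

  constant-nearRegular : ∀ {n c h m} → 0ℚ ≤ c → c ≤ m → 0ℚ ≤ h → ν n * h ≡ 1ℚ →
                         NearRegular {n} c (m * h) (λ _ _ → c * h)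
  constant-nearRegular {n} {c} {h} {m} 0≤c c≤m 0≤h νn*h≡1 = record
    { symmetric = λ _ _ → refl
    ; 0≤entries = λ _ _ → 0≤-* 0≤c 0≤h
    ; bounded   = λ _ _ → *-monoʳ-≤ 0≤h c≤m
    ; c≤rows    = λ _ → ≤-reflexive (sym row≡c)
    ; rows≤c+M  = λ _ → ≤-trans (≤-reflexive row≡c) (p≤p+q (0≤-* (≤-trans 0≤c c≤m) 0≤h))
    }
    where
    row≡c : sum {n} (λ _ → c * h) ≡ c
    row≡c = trans (sum-const n (c * h))
      (trans (solve 3 (λ n c h → n :* (c :* h) := c :* (n :* h)) refl (ν n) c h)
        (trans (cong (c *_) νn*h≡1) (*-identityʳ c)))

  planted : ∀ n → ℚ → ℚ → Weights n
  planted n p q u v = if does (inV⁺ u Bool.≟ inV⁺ v) then p else q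

  sum-planted : ∀ {n} k → n ≡ k ℕ.+ k → ∀ p q u → sum (planted n p q u) ≡ ν k * (p + q)
  sum-planted k refl p q u = trans
    (cong (λ j → sum {k ℕ.+ k} λ v → block (toℕ v ℕ.<ᵇ j)) (sym (ℕ.n≡⌊n+n/2⌋ k)))
    (trans (sum-threshold k k block) (both (inV⁺ u)))
    where
    block : Bool → ℚ
    block b = if does (inV⁺ u Bool.≟ b) then p else q
    both : ∀ b → ν k * (if does (b Bool.≟ true) then p else q) + ν k * (if does (b Bool.≟ false) then p else q)
               ≡ ν k * (p + q)
    both true  = sym (*-distribˡ-+ (ν k) p q)
    both false = trans (+-comm (ν k * q) (ν k * p)) (sym (*-distribˡ-+ (ν k) p q))

  -- With its correction term, q₂ equals (1 - α) p₁ + 2 α p₁ h. Hence p₂ + q₂ = 2 p₁ + 2 α p₁ h, and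
  -- a row with n/2 entries of each kind, its diagonal entry p₂ included, sums to c + α c h. From α
  -- ≤ 1 and 2 h ≤ 1, both entries are at most 2 p₁.
  planted-nearRegular : ∀ {n c α h m} k → n ≡ k ℕ.+ k → 0ℚ ≤ c → ν 2 * c ≤ m → 0ℚ ≤ α → α ≤ 1ℚ →
    0ℚ ≤ h → ν n * h ≡ 1ℚ → ν 2 * h ≤ 1ℚ →
    let p₁ = c * h
        p₂ = (1ℚ + α) * p₁
        q₂ = ν 2 * p₁ - p₂ - ν 2 * (p₁ - p₂) * h
    in NearRegular c (m * h) (planted n p₂ q₂)
  planted-nearRegular {n} {c} {α} {h} {m} k n≡k+k 0≤c 2c≤m 0≤α α≤1 0≤h νn*h≡1 2h≤1 = record
    { symmetric = λ u v → sym-block (inV⁺ u) (inV⁺ v)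
    ; 0≤entries = λ u v → entry (0ℚ ≤_) 0≤p₂ 0≤q₂ (does (inV⁺ u Bool.≟ inV⁺ v))
    ; bounded   = λ u v → entry (_≤ m * h) p₂≤ q₂≤ (does (inV⁺ u Bool.≟ inV⁺ v))
    ; c≤rows    = λ u → ≤-trans (p≤p+q (0≤-* (0≤-* 0≤α 0≤c) 0≤h)) (≤-reflexive (sym (row≡ u)))
    ; rows≤c+M  = λ u → ≤-trans (≤-reflexive (row≡ u)) (+-monoʳ-≤ c (*-monoʳ-≤ 0≤h αc≤m))
    }
    where
    open ≡-Reasoning
    p₁ = c * h
    p₂ = (1ℚ + α) * p₁
    q₂ = ν 2 * p₁ - p₂ - ν 2 * (p₁ - p₂) * h
    0≤p₁ = 0≤-* 0≤c 0≤h
    0≤p₂ = 0≤-* (0≤-+ 0≤1 0≤α) 0≤p₁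
    q₂≡ : q₂ ≡ (1ℚ - α) * p₁ + α * p₁ * (ν 2 * h)
    q₂≡ = solve 3 (λ p a h → con (ν 2) :* p :- (con 1ℚ :+ a) :* p :- con (ν 2) :* (p :- (con 1ℚ :+ a) :* p) :* h
      := (con 1ℚ :- a) :* p :+ a :* p :* (con (ν 2) :* h)) refl p₁ α h
    0≤q₂ : 0ℚ ≤ q₂
    0≤q₂ = ≤-trans (0≤-+ (0≤-* (≤⇒0≤- α≤1) 0≤p₁) (0≤-* (0≤-* 0≤α 0≤p₁) (0≤-* (0≤ν 2) 0≤h)))
      (≤-reflexive (sym q₂≡))
    2p₁≤ : ν 2 * p₁ ≤ m * h
    2p₁≤ = ≤-trans (≤-reflexive (sym (*-assoc (ν 2) c h))) (*-monoʳ-≤ 0≤h 2c≤m)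
    p₂≤ : p₂ ≤ m * h
    p₂≤ = ≤-trans (≤-diff (solve 2 (λ a p → con (ν 2) :* p :- (con 1ℚ :+ a) :* p := (con 1ℚ :- a) :* p) refl α p₁)
      (0≤-* (≤⇒0≤- α≤1) 0≤p₁)) 2p₁≤
    q₂≤ : q₂ ≤ m * h
    q₂≤ = ≤-trans (≤-diff (trans (cong (λ q → ν 2 * p₁ - q) q₂≡)
        (solve 3 (λ a p t → con (ν 2) :* p :- ((con 1ℚ :- a) :* p :+ a :* p :* t) := p :+ a :* p :* (con 1ℚ :- t))
          refl α p₁ (ν 2 * h)))
      (0≤-+ 0≤p₁ (0≤-* (0≤-* 0≤α 0≤p₁) (≤⇒0≤- 2h≤1)))) 2p₁≤
    αc≤m : α * c ≤ m
    αc≤m = ≤-trans (≤-diff (solve 2 (λ a c → con (ν 2) :* c :- a :* c := c :+ (con 1ℚ :- a) :* c) refl α c)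
      (0≤-+ 0≤c (0≤-* (≤⇒0≤- α≤1) 0≤c))) 2c≤m
    2νk*h≡1 : ν k * ν 2 * h ≡ 1ℚ
    2νk*h≡1 = begin
      ν k * ν 2 * h      ≡⟨ cong (_* h) (solve 1 (λ k → k :* con (ν 2) := k :+ k) refl (ν k)) ⟩
      (ν k + ν k) * h    ≡⟨ cong (_* h) (trans (cong ν n≡k+k) (ν-+ k k)) ⟨
      ν n * h            ≡⟨ νn*h≡1 ⟩
      1ℚ                 ∎
    row≡ : ∀ u → sum (planted n p₂ q₂ u) ≡ c + α * c * h
    row≡ u = begin
      sum (planted n p₂ q₂ u)
        ≡⟨ sum-planted k n≡k+k p₂ q₂ u ⟩
      ν k * (p₂ + q₂)
        ≡⟨ solve 4 (λ k c a h → k :* ((con 1ℚ :+ a) :* (c :* h) :+ (con (ν 2) :* (c :* h) :- (con 1ℚ :+ a) :* (c :* h)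
               :- con (ν 2) :* (c :* h :- (con 1ℚ :+ a) :* (c :* h)) :* h))
             := (k :* con (ν 2) :* h) :* (c :+ a :* c :* h)) refl (ν k) c α h ⟩
      (ν k * ν 2 * h) * (c + α * c * h)
        ≡⟨ trans (cong (_* (c + α * c * h)) 2νk*h≡1) (*-identityˡ (c + α * c * h)) ⟩
      c + α * c * h ∎
    sym-block : ∀ a b → (if does (a Bool.≟ b) then p₂ else q₂) ≡ (if does (b Bool.≟ a) then p₂ else q₂)
    sym-block true  true  = refl
    sym-block true  false = refl
    sym-block false true  = refl
    sym-block false false = refl
    entry : (P : ℚ → Set) → P p₂ → P q₂ → ∀ b → P (if b then p₂ else q₂)
    entry P Pp Pq true  = Pp
    entry P Pp Pq false = Pq

  -- Comparison of the two expectations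

  record Separated (ε δ h e₁ e₂ : ℚ) : Set where
    constructor separated
    field
      lower : (1ℚ - δ) * (1ℚ - h) * e₂ + ε ≤ e₁
      upper : e₁ + ε ≤ (1ℚ + δ) * (1ℚ + h) * e₂

  -- The factors 1 ± δ offer relative room of at least 2 b. The errors y ≤ b / 2 of both
  -- expectations use up at most b + b² of it, and b ≤ ½ leaves at least b / 2. Multiplication by X
  -- ≥ 1 makes this an absolute gap.
  separation : ∀ {X y b δ h E₁ E₂} → 1ℚ ≤ X → 0ℚ ≤ y → y ≤ ½ * b → 0ℚ ≤ b → b ≤ ½ → ν 2 * b ≤ δ →
    0ℚ ≤ h → h ≤ 1ℚ →
    X * (1ℚ - y) ≤ E₁ × E₁ ≤ X * (1ℚ + y) → X * (1ℚ - y) ≤ E₂ × E₂ ≤ X * (1ℚ + y) →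
    Separated (½ * b) δ h E₁ E₂
  separation {X} {y} {b} {δ} {h} {E₁} {E₂} 1≤X 0≤y y≤½b 0≤b b≤½ 2b≤δ 0≤h h≤1 (l₁ , u₁) (l₂ , u₂) = separated lower upper
    where
    open ≤-Reasoning
    0≤X = ≤-trans 0≤1 1≤X
    0≤½b-y = ≤⇒0≤- y≤½b
    0≤½-b = ≤⇒0≤- b≤½
    0≤½ : 0ℚ ≤ ½
    0≤½ = ≤ᵇ⇒≤ _
    0≤2 = 0≤ν 2
    y≤1 : y ≤ 1ℚ
    y≤1 = ≤-trans y≤½b (≤-diff {r = (½ - b) * ½ + (1ℚ - ½ * ½)}
      (solve 1 (λ b → con 1ℚ :- con ½ :* b := (con ½ :- b) :* con ½ :+ (con 1ℚ :- con ½ :* con ½)) refl b)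
      (0≤-+ (0≤-* 0≤½-b 0≤½) (≤ᵇ⇒≤ _)))
    0≤E₂ = ≤-trans (0≤-* 0≤X (≤⇒0≤- y≤1)) l₂
    0≤1-2b : 0ℚ ≤ 1ℚ - ν 2 * b
    0≤1-2b = ≤-trans (0≤-* 0≤2 0≤½-b)
      (≤-reflexive (solve 1 (λ b → con (ν 2) :* (con ½ :- b) := con 1ℚ :- con (ν 2) :* b) refl b))
    0≤δ-2b = ≤⇒0≤- 2b≤δ
    0≤1-h = ≤⇒0≤- h≤1
    0≤δ = ≤-trans (0≤-* 0≤2 0≤b) 2b≤δ
    lower : (1ℚ - δ) * (1ℚ - h) * E₂ + ½ * b ≤ E₁
    lower = begin
      (1ℚ - δ) * (1ℚ - h) * E₂ + ½ * b
        -- Passing from `δ` to `ν 2 * b` before `E₂` is estimated makes the leading factor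
        -- nonnegative, whatever the sign of `1ℚ - δ`.
        ≤⟨ +-monoˡ-≤ (½ * b) (≤-diff {(1ℚ - δ) * (1ℚ - h) * E₂} {(1ℚ - ν 2 * b) * E₂}
             (solve 4 (λ b δ h e → (con 1ℚ :- con (ν 2) :* b) :* e :- (con 1ℚ :- δ) :* (con 1ℚ :- h) :* e
                := (δ :- con (ν 2) :* b) :* (con 1ℚ :- h) :* e :+ (con 1ℚ :- con (ν 2) :* b) :* h :* e) refl b δ h E₂)
             (0≤-+ (0≤-* (0≤-* 0≤δ-2b 0≤1-h) 0≤E₂) (0≤-* (0≤-* 0≤1-2b 0≤h) 0≤E₂))) ⟩
      (1ℚ - ν 2 * b) * E₂ + ½ * b
        ≤⟨ +-monoˡ-≤ (½ * b) (*-monoˡ-≤ 0≤1-2b u₂) ⟩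
      (1ℚ - ν 2 * b) * (X * (1ℚ + y)) + ½ * b
        ≤⟨ ≤-diff (solve 3 (λ X y b → X :* (con 1ℚ :- y) :- ((con 1ℚ :- con (ν 2) :* b) :* (X :* (con 1ℚ :+ y)) :+ con ½ :* b)
             := (X :* (con (ν 2) :* (con ½ :* b :- y)) :+ X :* (con (ν 2) :* (b :* y)) :+ (X :- con 1ℚ) :* b) :+ con ½ :* b)
             refl X y b)
           (0≤-+ (0≤-+ (0≤-+ (0≤-* 0≤X (0≤-* 0≤2 0≤½b-y)) (0≤-* 0≤X (0≤-* 0≤2 (0≤-* 0≤b 0≤y))))
             (0≤-* (≤⇒0≤- 1≤X) 0≤b)) (0≤-* 0≤½ 0≤b)) ⟩
      X * (1ℚ - y)
        ≤⟨ l₁ ⟩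
      E₁ ∎
    upper : E₁ + ½ * b ≤ (1ℚ + δ) * (1ℚ + h) * E₂
    upper = begin
      E₁ + ½ * b
        ≤⟨ +-monoˡ-≤ (½ * b) u₁ ⟩
      X * (1ℚ + y) + ½ * b
        ≤⟨ ≤-diff (solve 3 (λ X y b → (con 1ℚ :+ con (ν 2) :* b) :* (X :* (con 1ℚ :- y)) :- (X :* (con 1ℚ :+ y) :+ con ½ :* b)
             := X :* (con (ν 2) :* (con 1ℚ :+ b)) :* (con ½ :* b :- y) :+ X :* (b :* (con ½ :- b)) :+ (X :- con 1ℚ) :* (con ½ :* b))
             refl X y b)
           (0≤-+ (0≤-+ (0≤-* (0≤-* 0≤X (0≤-* 0≤2 (0≤-+ 0≤1 0≤b))) 0≤½b-y) (0≤-* 0≤X (0≤-* 0≤b 0≤½-b)))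
             (0≤-* (≤⇒0≤- 1≤X) (0≤-* 0≤½ 0≤b))) ⟩
      (1ℚ + ν 2 * b) * (X * (1ℚ - y))
        ≤⟨ *-monoˡ-≤ (0≤-+ 0≤1 (0≤-* 0≤2 0≤b)) l₂ ⟩
      (1ℚ + ν 2 * b) * E₂
        ≤⟨ ≤-diff
             (solve 4 (λ b δ h e → (con 1ℚ :+ δ) :* (con 1ℚ :+ h) :* e :- (con 1ℚ :+ con (ν 2) :* b) :* e
                := (δ :- con (ν 2) :* b) :* e :+ (con 1ℚ :+ δ) :* h :* e) refl b δ h E₂)
             (0≤-+ (0≤-* 0≤δ-2b 0≤E₂) (0≤-* (0≤-* (0≤-+ 0≤1 0≤δ) 0≤h) 0≤E₂)) ⟩
      (1ℚ + δ) * (1ℚ + h) * E₂ ∎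

  expectedℚ : ∀ {n} → Weights n → Fin n → ℕ → ℚ
  expectedℚ w s d = E w λ G → ν (numberAtDistance G s d)

  seq-erdosRenyi : ∀ {n p p′} k s d → seq p k ≡ p′ →
    seq (expectedAtDistance (erdosRenyi n p) s d) k ≡ expectedℚ {n} (λ _ _ → p′) s d
  seq-erdosRenyi {n} {p} k s d refl = seq-𝔼 k (erdosRenyi n p) λ G → fromℕ (numberAtDistance G s d)

  seq-planted : ∀ {n p q p′ q′} k s d → seq p k ≡ p′ → seq q k ≡ q′ →
    seq (expectedAtDistance (plantedPartition n p q) s d) k ≡ expectedℚ (planted n p′ q′) s d
  seq-planted {n} {p} {q} k s d refl refl = trans
    (seq-𝔼 k (plantedPartition n p q) λ G → fromℕ (numberAtDistance G s d))
    (E-cong-weights (λ G → ν (numberAtDistance G s d)) λ u v → seq-if (does (inV⁺ u Bool.≟ inV⁺ v)))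
    where
    seq-if : ∀ b → seq (if b then p else q) k ≡ (if b then seq p k else seq q k)
    seq-if true  = refl
    seq-if false = refl

  -- From this size on, the relative error K / n with K = `errorConstant d (2 ℕ.* B)` is at most 1 /
  -- (2 B), which is `margin B`. The argument 2 B arises since entries of both models are at most 2
  -- c / n ≤ 2 B / n.
  sizeBound : ℕ → ℕ → ℕ
  sizeBound B d = 2 ℕ.* B ℕ.* errorConstant d (2 ℕ.* B)

  margin : ℕ → ℚ
  margin B = ½ * recip (ν B)

  module _ {B : ℕ} (4≤B : 4 ℕ.≤ B) where

    private
      m = 2 ℕ.* B
      b = recip (ν B)
      1≤m : 1 ℕ.≤ m
      1≤m = ℕ.≤-trans (ℕ.≤-trans (ℕ.s≤s ℕ.z≤n) 4≤B) (ℕ.m≤m+n B (B ℕ.+ 0))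
      0<νB : 0ℚ < ν B
      0<νB = <-≤-trans (positive⁻¹ (ν 4)) (ν-mono 4≤B)

    0<margin : 0ℚ < margin B
    0<margin = positive⁻¹ (margin B) {{pos*pos⇒pos ½ b {{positive (recip-pos 0<νB)}}}}

    -- Neither the gap nor the bound on n depends on the terms c and α, only on B and d. This
    -- uniformity is what lets the termwise estimates give a strict inequality of reals. The room is
    -- 2 / (c - 1) ≥ 2 / B.
    separated-expectations : ∀ {d} → 1 ℕ.≤ d → ∀ n .{{_ : ℕ.NonZero n}} → sizeBound B d ℕ.≤ n → ∀ k → n ≡ k ℕ.+ k → ∀ s₁ s₂ {c α} →
      ν 2 ≤ c → c ≤ ν B → 0ℚ ≤ α → α ≤ 1ℚ →
      let h  = ℤ.+ 1 / n
          p₁ = c * h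
          p₂ = (1ℚ + α) * p₁
          q₂ = ν 2 * p₁ - p₂ - ν 2 * (p₁ - p₂) * h
          E₁ = expectedℚ {n} (λ _ _ → p₁) s₁ d
          E₂ = expectedℚ (planted n p₂ q₂) s₂ d
          δ  = ν 2 * recip (c - 1ℚ)
      in Separated (margin B) δ h E₁ E₂
    separated-expectations {d} 1≤d n mK≤n k n≡k+k s₁ s₂ {c} {α} 2≤c c≤B 0≤α α≤1 =
      separation {c ^ d} {ε} (1≤-^ d 1≤c) 0≤ε ε≤½b 0≤b b≤½
        (*-monoˡ-≤ (0≤ν 2) (recip-anti 0<c-1 c-1≤B)) 0≤h h≤1
        (nearRegular-bounds m d 1≤m 1≤d 1≤c 0≤h νn*h≡1 (constant-nearRegular 0≤c c≤m 0≤h νn*h≡1) ε≤1 s₁)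
        (nearRegular-bounds m d 1≤m 1≤d 1≤c 0≤h νn*h≡1
          (planted-nearRegular k n≡k+k 0≤c 2c≤m 0≤α α≤1 0≤h νn*h≡1 2h≤1) ε≤1 s₂)
      where
      open ≤-Reasoning
      K = errorConstant d m
      h = ℤ.+ 1 / n
      ε = ν K * h
      0≤h = 0≤1/ n
      νn*h≡1 = ν*1/ n
      0≤ε : 0ℚ ≤ ε
      0≤ε = 0≤-* (0≤ν K) 0≤h
      0≤b = <⇒≤ (recip-pos 0<νB)
      1≤c = ≤-trans (≤ᵇ⇒≤ {1ℚ} {ν 2} _) 2≤c
      0≤c = ≤-trans 0≤1 1≤c
      c-1≤B : c - 1ℚ ≤ ν B
      c-1≤B = ≤-trans (≤-diff (solve 1 (λ c → c :- (c :- con 1ℚ) := con 1ℚ) refl c) 0≤1) c≤B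
      0<c-1 : 0ℚ < c - 1ℚ
      0<c-1 = <-≤-trans 0<1 (+-monoˡ-≤ (- 1ℚ) 2≤c)
      2c≤m : ν 2 * c ≤ ν m
      2c≤m = ≤-trans (*-monoˡ-≤ (0≤ν 2) c≤B) (≤-reflexive (sym (ν-* 2 B)))
      c≤m : c ≤ ν m
      c≤m = ≤-trans (≤-diff (solve 1 (λ c → con (ν 2) :* c :- c := c) refl c) 0≤c) 2c≤m
      ε≤½b : ε ≤ ½ * b
      ε≤½b = begin
        ν K * h
          ≡⟨ *-identityˡ (ν K * h) ⟨
        1ℚ * (ν K * h)
          ≡⟨ cong (_* (ν K * h)) (recip-inverse 0<νB) ⟨
        b * ν B * (ν K * h)
          ≡⟨ solve 4 (λ b B K h → b :* B :* (K :* h) := con ½ :* b :* (con (ν 2) :* B :* K :* h)) refl b (ν B) (ν K) h ⟩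
        ½ * b * (ν 2 * ν B * ν K * h)
          ≡⟨ cong (λ q → ½ * b * (q * h)) (trans (ν-* m K) (cong (_* ν K) (ν-* 2 B))) ⟨
        ½ * b * (ν (m ℕ.* K) * h)
          ≤⟨ *-monoˡ-≤ (<⇒≤ 0<margin) (*-monoʳ-≤ 0≤h (ν-mono mK≤n)) ⟩
        ½ * b * (ν n * h)
          ≡⟨ trans (cong (½ * b *_) νn*h≡1) (*-identityʳ (½ * b)) ⟩
        ½ * b ∎
      b≤½ : b ≤ ½
      b≤½ = ≤-trans (recip-anti (positive⁻¹ (ν 4)) (ν-mono 4≤B)) (≤ᵇ⇒≤ _)
      ε≤1 : ε ≤ 1ℚ
      ε≤1 = ≤-trans ε≤½b (≤-trans (*-monoˡ-≤ {r = ½} (≤ᵇ⇒≤ _) b≤½) (≤ᵇ⇒≤ _))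
      mh≤1 : ν m * h ≤ 1ℚ
      mh≤1 = ≤-trans (*-monoʳ-≤ 0≤h (ν-mono (ℕ.≤-trans (ℕ.m≤n+m m (3 ℕ.^ d ℕ.* m)) (ℕ.m≤n+m (upperError d m) (lowerError d m))))) ε≤1
      2h≤1 : ν 2 * h ≤ 1ℚ
      2h≤1 = ≤-trans (*-monoʳ-≤ 0≤h (ν-mono (ℕ.*-monoʳ-≤ 2 (ℕ.≤-trans (ℕ.s≤s ℕ.z≤n) 4≤B)))) mh≤1
      h≤1 : h ≤ 1ℚ
      h≤1 = ≤-trans (≤-diff (solve 1 (λ h → con (ν 2) :* h :- h := h) refl h) 0≤h) 2h≤1

open import Data.Integer.Base using (+_)
open import Data.Nat.Divisibility using (divides)
open import Data.Nat.Properties as ℕ using ()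
open import Data.Product.Base using (_,_; proj₁; proj₂)
open import Data.Rational.Base as ℚ using (0ℚ; 1ℚ)
open import Data.Rational.Properties as ℚ using ()
open import Data.Rational.Solver using (module +-*-Solver)
open import Relation.Binary.PropositionalEquality using (_≡_; refl; trans; cong; cong₂)
open import Defs
open Rationals using (ν; Separated; margin; 0<margin; sizeBound; separated-expectations; seq-erdosRenyi; seq-planted)

open +-*-Solver using (solve; _:+_; _:-_; _:=_; con)

-- From rational terms to real numbers

separated⇒< : (δ h E₁ E₂ : ℝ) → ∀ ε → 0ℚ ℚ.< ε →
  Eventually (λ j → Separated ε (seq δ j) (seq h j) (seq E₁ j) (seq E₂ j)) →
  (1ℝ - δ) * (1ℝ - h) * E₂ < E₁ × E₁ < (1ℝ + δ) * (1ℝ + h) * E₂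
separated⇒< δ h E₁ E₂ ε 0<ε (K , sep) =
  (ε , 0<ε , K , λ j K≤j → Separated.lower (sep j K≤j)) ,
  (ε , 0<ε , K , λ j K≤j → Separated.upper (sep j K≤j))

seq-/ℕ : ∀ x n .{{_ : ℕ.NonZero n}} j → seq (x /ℕ n) j ≡ seq x j ℚ.* (+ 1 ℚ./ n)
seq-/ℕ x n j = refl

seq-1/ : ∀ n .{{_ : ℕ.NonZero n}} j → seq (1ℝ /ℕ n) j ≡ + 1 ℚ./ n
seq-1/ n j = ℚ.*-identityˡ (+ 1 ℚ./ n)

seq-q₂ : ∀ p₁ p₂ n .{{_ : ℕ.NonZero n}} j → seq (2ℝ * p₁ - p₂ - 2ℝ * (p₁ - p₂) /ℕ n) j
  ≡ ν 2 ℚ.* seq p₁ j ℚ.- seq p₂ j ℚ.- ν 2 ℚ.* (seq p₁ j ℚ.- seq p₂ j) ℚ.* (+ 1 ℚ./ n)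
seq-q₂ p₁ p₂ n j = refl

Separated-resp : ∀ {ε δ δ′ h h′ e₁ e₁′ e₂ e₂′} → δ ≡ δ′ → h ≡ h′ → e₁ ≡ e₁′ → e₂ ≡ e₂′ →
  Separated ε δ′ h′ e₁′ e₂′ → Separated ε δ h e₁ e₂
Separated-resp refl refl refl refl sep = sep

-- The reals are variables here: conversion checking would otherwise unfold their
-- termwise rational operations.
module _ {c₀ α₀ δ η p₁ p₂ q₂ : ℝ} {n : ℕ} .{{_ : ℕ.NonZero n}}
  (seq-δ : ∀ j → seq δ j ≡ ν 2 ℚ.* recip (seq c₀ j ℚ.- 1ℚ))
  (seq-η : ∀ j → seq η j ≡ + 1 ℚ./ n)
  (seq-p₁ : ∀ j → seq p₁ j ≡ seq c₀ j ℚ.* (+ 1 ℚ./ n))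
  (seq-p₂ : ∀ j → seq p₂ j ≡ (1ℚ ℚ.+ seq α₀ j) ℚ.* seq p₁ j)
  (seq-q₂ : ∀ j → seq q₂ j ≡ ν 2 ℚ.* seq p₁ j ℚ.- seq p₂ j ℚ.- ν 2 ℚ.* (seq p₁ j ℚ.- seq p₂ j) ℚ.* (+ 1 ℚ./ n))
  where

  eventually-separated : ∀ {B d} → 4 ℕ.≤ B → 1 ℕ.≤ d →
    (Eventually λ j → (ν 2 ℚ.≤ seq c₀ j × seq c₀ j ℚ.≤ ν B) × (0ℚ ℚ.≤ seq α₀ j × seq α₀ j ℚ.≤ 1ℚ)) →
    sizeBound B d ℕ.≤ n → 2 ∣ n → (s₁ s₂ : Fin n) →
    let E₁ = expectedAtDistance (erdosRenyi n p₁) s₁ d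
        E₂ = expectedAtDistance (plantedPartition n p₂ q₂) s₂ d
    in (1ℝ - δ) * (1ℝ - η) * E₂ < E₁ × E₁ < (1ℝ + δ) * (1ℝ + η) * E₂
  eventually-separated {B} {d} 4≤B 1≤d (K , bounds) N≤n (divides k n≡k*2) s₁ s₂ =
    separated⇒< δ η (expectedAtDistance (erdosRenyi n p₁) s₁ d) (expectedAtDistance (plantedPartition n p₂ q₂) s₂ d)
      (margin B) (0<margin 4≤B)
      (K , λ j K≤j → let (2≤c , c≤B) , (0≤α , α≤1) = bounds j K≤j in
        Separated-resp (seq-δ j) (seq-η j)
          (seq-erdosRenyi j s₁ d (seq-p₁ j))
          (seq-planted j s₂ d
            (trans (seq-p₂ j) (cong ((1ℚ ℚ.+ seq α₀ j) ℚ.*_) (seq-p₁ j)))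
            (trans (seq-q₂ j) (cong₂ (λ p p′ → ν 2 ℚ.* p ℚ.- p′ ℚ.- ν 2 ℚ.* (p ℚ.- p′) ℚ.* (+ 1 ℚ./ n)) (seq-p₁ j)
              (trans (seq-p₂ j) (cong ((1ℚ ℚ.+ seq α₀ j) ℚ.*_) (seq-p₁ j))))))
          (separated-expectations 4≤B 1≤d n N≤n k (trans n≡k*2 k*2≡k+k) s₁ s₂ {seq c₀ j} {seq α₀ j} 2≤c c≤B 0≤α α≤1))
    where
    k*2≡k+k : k ℕ.* 2 ≡ k ℕ.+ k
    k*2≡k+k = trans (ℕ.*-comm k 2) (cong (k ℕ.+_) (ℕ.+-identityʳ k))

theorem1 : (α₀ c₀ : ℝ) → 0ℝ < α₀ → α₀ < 1ℝ →
    (c₀≥2+√3 : 2ℝ + √3 ≤ c₀) →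
    (d : ℕ) → 1 ℕ.≤ d →
    ∃ λ (C : ℝ) → 0ℝ < C × (∃ λ (N : ℕ) →
      (n : ℕ) .{{_ : ℕ.NonZero n}} → N ℕ.≤ n → 2 ∣ n →
      (s₁ s₂ : Fin n) →
      let p₁ = c₀ /ℕ n
          p₂ = (1ℝ + α₀) * p₁
          q₂ = 2ℝ * p₁ - p₂ - 2ℝ * (p₁ - p₂) /ℕ n
          E₁ = expectedAtDistance (erdosRenyi n p₁) s₁ d
          E₂ = expectedAtDistance (plantedPartition n p₂ q₂) s₂ d
          δ  = 2ℝ / (c₀ - 1ℝ) [ c₀-1-pos c₀ c₀≥2+√3 ]
      in (1ℝ - δ) * (1ℝ - C /ℕ n) * E₂ < E₁
         × E₁ < (1ℝ + δ) * (1ℝ + C /ℕ n) * E₂)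
-- With the instances n≢0 written out, the types agree without unfolding expectations.
theorem1 α₀ c₀ (a , 0<a , K₁ , a≤α₀) (a′ , 0<a′ , K₂ , α₀+a′≤1) c₀≥2+√3 d 1≤d =
  1ℝ , (1ℚ , ℚ.positive⁻¹ 1ℚ , 0 , λ _ _ → ℚ.≤-refl) , sizeBound B d , λ n {{n≢0}} N≤n 2∣n s₁ s₂ →
  let p₁ = _/ℕ_ c₀ n {{n≢0}}
      p₂ = (1ℝ + α₀) * p₁
      q₂ = 2ℝ * p₁ - p₂ - _/ℕ_ (2ℝ * (p₁ - p₂)) n {{n≢0}}
  in eventually-separated {c₀} {α₀} {2ℝ / (c₀ - 1ℝ) [ c₀-1-pos c₀ c₀≥2+√3 ]} {_/ℕ_ 1ℝ n {{n≢0}}} {p₁} {p₂} {q₂} {n}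
       (seq-δ (c₀-1-pos c₀ c₀≥2+√3)) (seq-1/ n {{n≢0}}) (seq-/ℕ c₀ n {{n≢0}}) (seq-p₂ p₁) (seq-q₂ p₁ p₂ n {{n≢0}})
       {B} {d} (ℕ.m≤n+m 4 B₀) 1≤d (K , bounds) N≤n 2∣n s₁ s₂
  where
  bounded = cauchy-bounded (cauchy c₀)
  ∣c₀∣≤ = proj₂ (proj₂ (proj₂ bounded))
  B₀ = proj₁ (Rationals.≤ν (proj₁ bounded))
  -- An integer above the late terms of `c₀`, raised by 4 to keep its reciprocal below one half.
  B = B₀ ℕ.+ 4
  K₃ = proj₁ (proj₂ (proj₂ bounded))
  K₄ = proj₁ (c₀≥2+√3 1ℚ (ℚ.positive⁻¹ 1ℚ))
  K = K₁ ℕ.⊔ K₂ ℕ.⊔ (K₃ ℕ.⊔ K₄)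

  seq-δ : ∀ 0<c₀-1 j → seq (2ℝ / (c₀ - 1ℝ) [ 0<c₀-1 ]) j ≡ ν 2 ℚ.* recip (seq c₀ j ℚ.- 1ℚ)
  seq-δ 0<c₀-1 j = refl
  seq-p₂ : ∀ p₁ j → seq ((1ℝ + α₀) * p₁) j ≡ (1ℚ ℚ.+ seq α₀ j) ℚ.* seq p₁ j
  seq-p₂ p₁ j = refl

  bounds : ∀ j → K ℕ.≤ j → (ν 2 ℚ.≤ seq c₀ j × seq c₀ j ℚ.≤ ν B) × (0ℚ ℚ.≤ seq α₀ j × seq α₀ j ℚ.≤ 1ℚ)
  bounds j K≤j = (2≤c , c≤B) , (0≤α , α≤1)
    where
    K₁⊔K₂≤j = ℕ.m⊔n≤o⇒m≤o (K₁ ℕ.⊔ K₂) (K₃ ℕ.⊔ K₄) K≤j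
    K₃⊔K₄≤j = ℕ.m⊔n≤o⇒n≤o (K₁ ℕ.⊔ K₂) (K₃ ℕ.⊔ K₄) K≤j
    0≤α : 0ℚ ℚ.≤ seq α₀ j
    0≤α = ℚ.≤-trans (Rationals.p≤p+q (ℚ.<⇒≤ 0<a)) (a≤α₀ j (ℕ.m⊔n≤o⇒m≤o K₁ K₂ K₁⊔K₂≤j))
    α≤1 : seq α₀ j ℚ.≤ 1ℚ
    α≤1 = ℚ.≤-trans (Rationals.p≤p+q (ℚ.<⇒≤ 0<a′)) (α₀+a′≤1 j (ℕ.m⊔n≤o⇒n≤o K₁ K₂ K₁⊔K₂≤j))
    c≤B : seq c₀ j ℚ.≤ ν B
    c≤B = ℚ.≤-trans (Rationals.p≤∣p∣ (seq c₀ j))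
      (ℚ.≤-trans (∣c₀∣≤ j (ℕ.m⊔n≤o⇒m≤o K₃ K₄ K₃⊔K₄≤j))
      (ℚ.≤-trans (proj₂ (Rationals.≤ν (proj₁ bounded)))
        (Rationals.ν-mono (ℕ.m≤m+n B₀ 4))))
    2≤c : ν 2 ℚ.≤ seq c₀ j
    -- With tolerance 1, the bound on `c₀` gives 2 + r ≤ c + 1 for the terms c of `c₀` and r of
    -- `√3`, and r ≥ 1.
    2≤c = Rationals.≤-diff
      (solve 2 (λ c r → c :- con (ν 2) := ((c :+ con 1ℚ) :- (con (ν 2) :+ r)) :+ (r :- con 1ℚ)) refl
        (seq c₀ j) (√3-seq j))
      (ℚ.+-mono-≤ (≤⇒0≤- (proj₂ (c₀≥2+√3 1ℚ (ℚ.positive⁻¹ 1ℚ)) j (ℕ.m⊔n≤o⇒n≤o K₃ K₄ K₃⊔K₄≤j)))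
        (≤⇒0≤- (proj₁ (√3-seq-bounds j))))
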